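{- In the extra-special case: (i) The map $\tau:W^0\to\mathrm{AN}(\Delta(1))$, $\tau(w)=\Gamma_w:=\min(\Delta(1)\setminus N(w))$, is surjective, $I(\Gamma_w)=\Delta(1)\setminus N(w)$, and $\#\tau^{ -1}(\Gamma_w)=1$ if the upper ideal $I(\Gamma_w)$ is not Lagrangian, while $\#\tau^{ -1}(\Gamma_w)=2$ if $I(\Gamma_w)$ is Lagrangian. (ii) For $w\in W^0$, the following are equivalent: the upper ideal $I_w:=\Delta(1)\setminus N(w)$ is Lagrangian; $w(\theta)\in\Pi_l\cup(-\Pi_l)$; $\tau^{ -1}(\Gamma_w)=\{w,ws_\theta\}$. In particular, $\#\mathrm{AN}(\Delta(1))=\#W^0-\#\Pi_l=(h-1)\cdot\#\Pi_l$.
   Context: Let $\mathfrak g$ be a complex simple Lie algebra with root system $\Delta$ in a real Euclidean space with $W$-invariant inner product $(\,,\,)$, positive roots $\Delta^+$, simple roots $\Pi$, Weyl group $W$, Coxeter number $h$, highest root $\theta$, $\theta^\vee=2\theta/(\theta,\theta)$; $s_\theta\in W$ is the reflection in $\theta$. $\Pi_l$ is the set of simple roots of the same length as $\theta$ (all simple roots if all roots have the same length). Extra-special case: $\Delta(j)=\{\gamma\in\Delta:(\gamma,\theta^\vee)=j\}$, so $\Delta(2)=\{\theta\}$ and $\Delta^+=\Delta(0)^+\sqcup\Delta(1)\sqcup\{\theta\}$ with $\Delta(0)^+=\Delta(0)\cap\Delta^+$; $\Pi(0)=\Pi\cap\Delta(0)$. $\Delta(1)$ is partially ordered by $\mu\preccurlyeq\gamma$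 iff $\gamma-\mu$ is a nonnegative integer combination of $\Pi(0)$; $\mathrm{AN}(\Delta(1))$ is its set of antichains, $I(\Gamma)$ is the upper ideal generated by $\Gamma$, and $\min$ denotes the set of minimal elements. $W^0=\{w\in W:w(\alpha)\in\Delta^+\ \forall\alpha\in\Delta(0)^+\}$; $N(w)=\{\gamma\in\Delta^+:w(\gamma)\in-\Delta^+\}$. A subset $S\subset\Delta(1)$ is Lagrangian if $\#S=\frac12\#\Delta(1)$ and there are no $\gamma_1,\gamma_2\in S$ with $\gamma_1+\gamma_2=\theta$. -}

module Defs where

open import Data.Nat as ℕ using (ℕ; zero; suc)
open import Data.Integer as ℤ using (ℤ; +_; -[1+_]; 0ℤ; 1ℤ)
open import Data.Integer.DivMod using (_/_)
open import Data.Fin as F using (Fin)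
open import Data.Vec as V using (Vec; lookup; tabulate)
open import Data.List as L using (List; length)
open import Data.List.Membership.Propositional using (_∈_)
open import Data.List.Relation.Unary.All using (All)
open import Data.List.Relation.Unary.Any using (Any)
open import Data.List.Relation.Unary.AllPairs using (AllPairs)
open import Data.Product using (Σ; ∃; ∃₂; _×_; _,_)
open import Data.Sum using (_⊎_)
open import Data.Bool using (Bool; true; false)
open import Relation.Binary.PropositionalEquality using (_≡_; _≢_)
open import Relation.Nullary using (¬_)

CardBy : {A : Set} → (A → A → Set) → (A → Set) → ℕ → Set
CardBy {A} _≈_ P k =
  Σ (List A) λ xs → (length xs ≡ k) × All P xs
    × AllPairs (λ x y → ¬ (x ≈ y)) xs × (∀ x → P x → Any (x ≈_) xs)

Card : {A : Set} → (A → Set) → ℕ → Set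
Card = CardBy _≡_

-- Integer vectors (coordinates w.r.t. the simple roots α_1..α_n)

sumFin : ∀ {n} → (Fin n → ℤ) → ℤ
sumFin {zero} f = 0ℤ
sumFin {suc n} f = f F.zero ℤ.+ sumFin (λ i → f (F.suc i))

e : ∀ {n} → Fin n → Vec ℤ n
e i = tabulate (λ j → δ i j)
  where
  δ : ∀ {n} → Fin n → Fin n → ℤ
  δ F.zero F.zero = 1ℤ
  δ F.zero (F.suc j) = 0ℤ
  δ (F.suc i) F.zero = 0ℤ
  δ (F.suc i) (F.suc j) = δ i j

_⊕_ : ∀ {n} → Vec ℤ n → Vec ℤ n → Vec ℤ n
_⊕_ = V.zipWith ℤ._+_

_⊖_ : ∀ {n} → Vec ℤ n → Vec ℤ n → Vec ℤ n
_⊖_ = V.zipWith ℤ._-_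

_•_ : ∀ {n} → ℤ → Vec ℤ n → Vec ℤ n
c • v = V.map (c ℤ.*_) v

neg : ∀ {n} → Vec ℤ n → Vec ℤ n
neg = V.map (λ x → ℤ.- x)

-- A linear map is represented by the matrix whose i-th row is the image of α_i.
Mat : ℕ → Set
Mat n = Vec (Vec ℤ n) n

app : ∀ {n} → Mat n → Vec ℤ n → Vec ℤ n
app M v = tabulate λ k → sumFin λ i → lookup v i ℤ.* lookup (lookup M i) k

compose : ∀ {n} → Mat n → Mat n → Mat n
compose M N = tabulate λ i → app M (lookup N i)

idMat : ∀ {n} → Mat n
idMat = tabulate e

-- exact integer division (used only where the division is exact); 0 on divisor 0
divℤ : ℤ → ℤ → ℤ
divℤ x (+ zero) = 0ℤ
divℤ x (+ suc k) = x / (+ suc k)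
divℤ x (-[1+ k ]) = x / (-[1+ k ])

-- Cartan data:  a i j = ⟨α_i^∨, α_j⟩ = 2(α_i,α_j)/(α_i,α_i),
-- d i with (α_i,α_i) = 2 d_i, so (α_i,α_j) = d_i a_ij.

record CartanData (n : ℕ) : Set where
  field
    a : Fin n → Fin n → ℤ
    d : Fin n → ℕ

module _ {n : ℕ} (C : CartanData n) where
  open CartanData C

  -- the W-invariant inner product, in simple-root coordinates
  form : Vec ℤ n → Vec ℤ n → ℤ
  form x y = sumFin λ i → sumFin λ j →
    lookup x i ℤ.* ((+ d i) ℤ.* a i j) ℤ.* lookup y j

  -- C is the Cartan matrix (with symmetrisation d) of a complex simple Lie algebra:
  -- integer generalized Cartan matrix, symmetrisable, positive definite, indecomposable.
  IsSimpleCartan : Set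
  IsSimpleCartan =
    (1 ℕ.≤ n)
    × (∀ i → a i i ≡ + 2)
    × (∀ i j → i ≢ j → a i j ℤ.≤ 0ℤ)
    × (∀ i → 1 ℕ.≤ d i)
    × (∀ i j → (+ d i) ℤ.* a i j ≡ (+ d j) ℤ.* a j i)
    × (∀ x → x ≢ V.replicate n 0ℤ → 0ℤ ℤ.< form x x)
    × (∀ (S : Fin n → Bool) → (∃ λ i → S i ≡ true) → (∃ λ j → S j ≡ false)
         → ∃₂ λ i j → S i ≡ true × S j ≡ false × a i j ≢ 0ℤ)

  sRefl : Fin n → Vec ℤ n → Vec ℤ n
  sRefl i v = v ⊖ ((sumFin λ j → a i j ℤ.* lookup v j) • e i)

  act : List (Fin n) → Vec ℤ n → Vec ℤ n
  act L.[] v = v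
  act (i L.∷ w) v = sRefl i (act w v)

  matOf : List (Fin n) → Mat n
  matOf w = tabulate λ i → act w (e i)

  InW : Mat n → Set
  InW M = ∃ λ w → matOf w ≡ M

  IsRoot : Vec ℤ n → Set
  IsRoot v = ∃₂ λ w i → act w (e i) ≡ v

  PosRoot : Vec ℤ n → Set
  PosRoot v = IsRoot v × (∀ i → 0ℤ ℤ.≤ lookup v i)

  NegRoot : Vec ℤ n → Set
  NegRoot v = IsRoot v × (∀ i → lookup v i ℤ.≤ 0ℤ)

  IsHighestRoot : Vec ℤ n → Set
  IsHighestRoot θ = IsRoot θ × (∀ β → IsRoot β → ∀ i → lookup β i ℤ.≤ lookup θ i)

  coxPow : ℕ → Mat n
  coxPow zero = idMat
  coxPow (suc k) = compose (matOf (L.allFin n)) (coxPow k)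

  IsCoxeterNumber : ℕ → Set
  IsCoxeterNumber h = (1 ℕ.≤ h) × (coxPow h ≡ idMat)
    × (∀ k → 1 ℕ.≤ k → k ℕ.< h → coxPow k ≢ idMat)

  Nw : Mat n → Vec ℤ n → Set
  Nw M γ = PosRoot γ × NegRoot (app M γ)

  module _ (θ : Vec ℤ n) where

    -- Δ(1) = {γ ∈ Δ : (γ,θ^∨) = 1},  Δ(0)^+
    Δ1 : Vec ℤ n → Set
    Δ1 γ = IsRoot γ × ((+ 2) ℤ.* form γ θ ≡ form θ θ)

    Δ0⁺ : Vec ℤ n → Set
    Δ0⁺ γ = PosRoot γ × (form γ θ ≡ 0ℤ)

    Π0 : Fin n → Set
    Π0 i = form (e i) θ ≡ 0ℤ

    -- μ ≼ γ : γ - μ is a nonnegative integer combination of Π(0)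
    _≼_ : Vec ℤ n → Vec ℤ n → Set
    μ ≼ γ = ∀ i → (0ℤ ℤ.≤ lookup (γ ⊖ μ) i) × (¬ Π0 i → lookup (γ ⊖ μ) i ≡ 0ℤ)

    W0 : Mat n → Set
    W0 M = InW M × (∀ α → Δ0⁺ α → PosRoot (app M α))

    Iw : Mat n → Vec ℤ n → Set
    Iw M γ = Δ1 γ × ¬ Nw M γ

    MinOf : (Vec ℤ n → Set) → Vec ℤ n → Set
    MinOf P γ = P γ × (∀ μ → P μ → μ ≼ γ → μ ≡ γ)

    Up : (Vec ℤ n → Set) → Vec ℤ n → Set
    Up P γ = Δ1 γ × ∃ λ g → P g × g ≼ γ

    Antichain : List (Vec ℤ n) → Set
    Antichain Γ = All Δ1 Γ × (∀ x y → x ∈ Γ → y ∈ Γ → x ≼ y → x ≡ y)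

    Γw : Mat n → Vec ℤ n → Set
    Γw M = MinOf (Iw M)

    Fib : Mat n → Mat n → Set
    Fib M M' = W0 M' × (∀ x → (Γw M x → Γw M' x) × (Γw M' x → Γw M x))

    Lagrangian : (Vec ℤ n → Set) → Set
    Lagrangian S =
      (∃₂ λ k m → Card S k × Card Δ1 m × (2 ℕ.* k ≡ m))
      × (∀ γ₁ γ₂ → S γ₁ → S γ₂ → (γ₁ ⊕ γ₂) ≢ θ)

    Πl : Vec ℤ n → Set
    Πl v = ∃ λ i → (v ≡ e i) × (form (e i) (e i) ≡ form θ θ)

    ±Πl : Vec ℤ n → Set
    ±Πl v = Πl v ⊎ Πl (neg v)

    sθ : Mat n
    sθ = tabulate λ i → e i ⊖ (divℤ ((+ 2) ℤ.* form (e i) θ) (form θ θ) • θ)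

Represents : ∀ {n} → List (Vec ℤ n) → (Vec ℤ n → Set) → Set
Represents Γ P = ∀ x → (x ∈ Γ → P x) × (P x → x ∈ Γ)

SameSet : ∀ {n} → List (Vec ℤ n) → List (Vec ℤ n) → Set
SameSet Γ Γ' = ∀ x → (x ∈ Γ → x ∈ Γ') × (x ∈ Γ' → x ∈ Γ)

{-# OPTIONS --safe #-}
module Submission where

-- An element w of W⁰ is determined by w(θ), an arbitrary long root, and also by the set N(w),
-- which consists of a subset of Δ(1) and possibly θ; such subsets are exactly the biconvex ones.
-- The complement L in Δ(1) of an upper ideal I is biconvex iff it contains no pair γ, θ-γ, and
-- L ∪ {θ} is biconvex iff I contains no such pair.  They cannot both contain a pair: for
-- γ, δ ∈ Δ(1), γ is comparable with δ or with θ-δ.  Hence I comes from some w, and from two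
-- elements w, w s_θ iff it is Lagrangian; this means that w(θ) is not a sum of two roots of the
-- same sign, i.e. that ± w(θ) is simple.  So antichains correspond to non-simple long roots.
-- The number h #Π_l of long roots comes from a bipartite Coxeter element, which is conjugate to
-- the given one because the Dynkin diagram is a tree: applying the products S true, S false of the
-- simple reflections of either colour alternately, all simple roots turn negative at the same
-- step, and this step is h.

open import Defs
open import Data.Nat as ℕ using (ℕ; zero; suc)
import Data.Nat.Properties as ℕP
open import Data.Integer as ℤ using (ℤ; +_; -[1+_]; 0ℤ; 1ℤ; _+_; _*_; _-_; -_; _≤_; _<_; +≤+; -≤+; +<+)
open import Data.Integer.Properties as ℤP using ()
import Data.Integer.DivMod as DM
open import Data.Integer.Tactic.RingSolver using (solve-∀)
open import Data.Fin as F using (Fin)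
import Data.Fin.Properties as FP
open import Data.Vec as V using (Vec; lookup; tabulate)
import Data.Vec.Properties as VP
open import Data.List as L using (List; length; []; _∷_; _++_; reverse; filter; allFin)
import Data.List.Properties as LP
open import Data.List.Membership.Propositional using (_∈_; _∉_; find; lose)
import Data.List.Membership.Propositional.Properties as ∈P
open import Data.List.Relation.Unary.Any as Any using (Any; here; there)
open import Data.List.Relation.Unary.All as All using (All)
import Data.List.Relation.Unary.All.Properties as AllP
open import Data.List.Relation.Unary.AllPairs using (AllPairs; []; _∷_)
open import Data.List.Relation.Unary.Unique.Propositional using (Unique)
import Data.List.Relation.Unary.Unique.Propositional.Properties as UP
open import Data.List.Relation.Binary.Permutation.Propositional using (_↭_; ↭-sym; ↭-trans; ↭-refl; prep; swap)
import Data.List.Relation.Binary.Permutation.Propositional.Properties as PP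
open import Data.Bool using (Bool; true; false; not)
import Data.Bool.Properties as BP
open import Data.Product using (Σ; ∃; ∃₂; _×_; _,_; proj₁; proj₂)
open import Data.Sum using (_⊎_; inj₁; inj₂) renaming ([_,_] to either)
open import Data.Empty using (⊥; ⊥-elim)
open import Function.Bundles using (_⇔_; mk⇔; Equivalence)
open import Relation.Binary.PropositionalEquality hiding ([_])
open import Relation.Nullary using (¬_; Dec; yes; no; ¬?; does; _×-dec_; _→-dec_)
open import Relation.Nullary.Decidable using (dec-true; dec-false; map′)

-- A root is given only as an element of a W-orbit, so signs, finiteness and decidability all have
-- to be earned. Signs come from positive definiteness together with the integrality of coroots;
-- finiteness and decidability come from the same enumeration that counts the long roots. Up to
-- sign, each of the h layers of this enumeration is an isometric copy of the set of simple roots,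
-- so it counts roots of each length separately. The step at which the simple roots turn negative is
-- the order of the Coxeter element: the alternating product up to that step is the longest element,
-- so going twice as far gives the identity, and an earlier return to the identity would make a root
-- of a lower layer negative. The Lagrangian condition is visible on w(θ) alone because the
-- decompositions of θ into two roots are exactly the pairs γ, θ - γ in Δ(1), and w carries them to
-- the decompositions of w(θ). A pair inside I_w, or outside it, becomes a decomposition into two
-- roots of the same sign.

0≤-+ : ∀ {a b} → 0ℤ ≤ a → 0ℤ ≤ b → 0ℤ ≤ a + b
0≤-+ p q = ℤP.+-mono-≤ p q

0≤-* : ∀ {a b} → 0ℤ ≤ a → 0ℤ ≤ b → 0ℤ ≤ a * b
0≤-* {+ a} {+ b} _ _ = subst (0ℤ ≤_) (ℤP.pos-* a b) (+≤+ ℕ.z≤n)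

≤0⇒0≤- : ∀ {a} → a ≤ 0ℤ → 0ℤ ≤ - a
≤0⇒0≤- p = ℤP.neg-mono-≤ p

0≤⇒-≤0 : ∀ {a} → 0ℤ ≤ a → - a ≤ 0ℤ
0≤⇒-≤0 p = ℤP.neg-mono-≤ p

0≤-⇒≤0 : ∀ {a} → 0ℤ ≤ - a → a ≤ 0ℤ
0≤-⇒≤0 {a} p = subst (_≤ 0ℤ) (ℤP.neg-involutive a) (ℤP.neg-mono-≤ p)

≤⇒0≤- : ∀ {a b} → a ≤ b → 0ℤ ≤ b - a
≤⇒0≤- = ℤP.i≤j⇒0≤j-i

0≤-⇒≤ : ∀ {a b} → 0ℤ ≤ b - a → a ≤ b
0≤-⇒≤ = ℤP.0≤i-j⇒j≤i

0<⇒1≤ : ∀ {a} → 0ℤ < a → 1ℤ ≤ a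
0<⇒1≤ = ℤP.i<j⇒suc[i]≤j

<⇒≱ : ∀ {a b} → a < b → b ≤ a → ⊥
<⇒≱ p q = ℤP.<-irrefl refl (ℤP.<-≤-trans p q)

pos-cancelˡ : ∀ {d m} → 0ℤ < d → 0ℤ < d * m → 0ℤ < m
pos-cancelˡ {+ suc d} {m} _ p = ℤP.*-cancelˡ-<-nonNeg {0ℤ} {m} (+ suc d) (subst (_< + suc d * m) (sym (ℤP.*-zeroʳ (+ suc d))) p)
pos-cancelˡ {+ zero} (+<+ ()) _

0<-* : ∀ {a b} → 0ℤ < a → 0ℤ < b → 0ℤ < a * b
0<-* {+ suc a} {+ suc b} _ _ = +<+ (ℕ.s≤s ℕ.z≤n)
0<-* {+ zero} (+<+ ()) _
0<-* {+ suc a} {+ zero} _ (+<+ ())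

*-cancel : ∀ {d} a b → 0ℤ < d → d * a ≡ d * b → a ≡ b
*-cancel {+ suc d} a b _ = ℤP.*-cancelˡ-≡ (+ suc d) a b
*-cancel {+ zero} _ _ (+<+ ())

-- If the computed quotient differs from `m` by x, then the remainder is `- x * K`; as it lies
-- between 0 and K - 1, x vanishes. This is what makes the division in `sθ` harmless.
divℤ-exact : ∀ m {k} → 0ℤ < k → divℤ (m * k) k ≡ m
divℤ-exact m {+ zero} (+<+ ())
divℤ-exact m {+ suc k} _ = sym (uniq (q - m) r r<)
  where
  K = + suc k
  q = (m * K) DM./ K
  r = (m * K) DM.% K
  r< : r ℕ.< suc k
  r< = DM.n%d<d (m * K) K
  eq : m * K ≡ + r + q * K
  eq = DM.a≡a%n+[a/n]*n (m * K) K
  e2 : ∀ x → q - m ≡ x → + r ≡ - x * K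
  e2 x refl = trans (alg₁ (+ r) q K) (trans (cong (λ z → z - q * K) (sym eq)) (alg₂ m q K))
    where
    alg₁ : ∀ r q K → r ≡ r + q * K - q * K
    alg₁ = solve-∀
    alg₂ : ∀ m q K → m * K - q * K ≡ - (q - m) * K
    alg₂ = solve-∀
  uniq : ∀ x r' → r' ℕ.< suc k → m ≡ q
  uniq x r' lt = go (q - m) refl
    where
    go : ∀ x → q - m ≡ x → m ≡ q
    go (+ zero) p = sym (ℤP.i-j≡0⇒i≡j q m p)
    go (+ suc x) p with () ← trans (e2 _ p) refl
    go (-[1+ x ]) p = ⊥-elim (ℕP.<-irrefl refl (ℕP.<-≤-trans r< (ℤP.drop‿+≤+ (subst (K ≤_) (trans (ℤP.pos-* (suc x) (suc k)) (sym (e2 _ p))) (+≤+ (ℕP.m≤m+n (suc k) (x ℕ.* suc k)))))))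

≤0∧≢0⇒≤-1 : ∀ y → y ≤ 0ℤ → y ≢ 0ℤ → y ≤ - 1ℤ
≤0∧≢0⇒≤-1 (+ zero) _ q = ⊥-elim (q refl)
≤0∧≢0⇒≤-1 (+ suc y) (+≤+ ()) q
≤0∧≢0⇒≤-1 -[1+ y ] _ q = ℤ.-≤- ℕ.z≤n

-- Finite sums

sumFin-cong : ∀ {n} {f g : Fin n → ℤ} → (∀ i → f i ≡ g i) → sumFin f ≡ sumFin g
sumFin-cong {zero} h = refl
sumFin-cong {suc n} h = cong₂ _+_ (h F.zero) (sumFin-cong (λ i → h (F.suc i)))

sumFin-0 : ∀ n → sumFin {n} (λ _ → 0ℤ) ≡ 0ℤ
sumFin-0 zero = refl
sumFin-0 (suc n) = trans (ℤP.+-identityˡ _) (sumFin-0 n)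

sumFin-+ : ∀ {n} (f g : Fin n → ℤ) → sumFin (λ i → f i + g i) ≡ sumFin f + sumFin g
sumFin-+ {zero} f g = refl
sumFin-+ {suc n} f g = trans (cong (_+_ (f F.zero + g F.zero)) (sumFin-+ (λ i → f (F.suc i)) (λ i → g (F.suc i))))
  (alg (f F.zero) (g F.zero) (sumFin (λ i → f (F.suc i))) (sumFin (λ i → g (F.suc i))))
  where
  alg : ∀ a b c d → a + b + (c + d) ≡ a + c + (b + d)
  alg = solve-∀

sumFin-* : ∀ {n} c (f : Fin n → ℤ) → sumFin (λ i → c * f i) ≡ c * sumFin f
sumFin-* {zero} c f = sym (ℤP.*-zeroʳ c)
sumFin-* {suc n} c f = trans (cong (_+_ (c * f F.zero)) (sumFin-* c (λ i → f (F.suc i)))) (sym (ℤP.*-distribˡ-+ c (f F.zero) (sumFin (λ i → f (F.suc i)))))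

sumFin-swap : ∀ {m n} (f : Fin m → Fin n → ℤ) → sumFin (λ i → sumFin (f i)) ≡ sumFin (λ j → sumFin (λ i → f i j))
sumFin-swap {zero} {n} f = sym (sumFin-0 n)
sumFin-swap {suc m} f = trans (cong (_+_ (sumFin (f F.zero))) (sumFin-swap (λ i → f (F.suc i)))) (sym (sumFin-+ (f F.zero) (λ j → sumFin (λ i → f (F.suc i) j))))

sumFin-nonneg : ∀ {n} {f : Fin n → ℤ} → (∀ i → 0ℤ ≤ f i) → 0ℤ ≤ sumFin f
sumFin-nonneg {zero} h = ℤP.≤-refl
sumFin-nonneg {suc n} h = 0≤-+ (h F.zero) (sumFin-nonneg (λ i → h (F.suc i)))

sumFin-nonneg-zero : ∀ {n} {f : Fin n → ℤ} → (∀ i → 0ℤ ≤ f i) → sumFin f ≤ 0ℤ → ∀ i → f i ≡ 0ℤ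
sumFin-nonneg-zero {suc n} {f} h p F.zero = ℤP.≤-antisym
  (ℤP.≤-trans (subst (_≤ sumFin f) (ℤP.+-identityʳ _) (ℤP.+-monoʳ-≤ (f F.zero) (sumFin-nonneg (λ i → h (F.suc i))))) p) (h F.zero)
sumFin-nonneg-zero {suc n} {f} h p (F.suc i) = sumFin-nonneg-zero (λ i → h (F.suc i))
  (ℤP.≤-trans (subst (_≤ sumFin f) (ℤP.+-identityˡ _) (ℤP.+-monoˡ-≤ (sumFin (λ i → f (F.suc i))) (h F.zero))) p) i

sumFin-pos-term : ∀ {n} {f : Fin n → ℤ} → 0ℤ < sumFin f → ∃ λ i → 0ℤ < f i
sumFin-pos-term {zero} (+<+ ())
sumFin-pos-term {suc n} {f} p with 0ℤ ℤ.<? f F.zero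
... | yes q = F.zero , q
... | no q with sumFin-pos-term {n} {λ i → f (F.suc i)} (ℤP.<-≤-trans p (subst (sumFin f ≤_) (ℤP.+-identityˡ _) (ℤP.+-monoˡ-≤ _ (ℤP.≮⇒≥ q))))
...   | i , r = F.suc i , r

-- A symmetric double sum is twice its upper triangle plus its diagonal.
sumFin-sym-even : ∀ {n} D (g : Fin n → Fin n → ℤ) → (∀ i j → g i j ≡ g j i)
  → (∀ i → ∃ λ t → g i i ≡ (+ 2 * D) * t) → (∀ i j → ∃ λ t → g i j ≡ D * t)
  → ∃ λ t → sumFin (λ i → sumFin (g i)) ≡ (+ 2 * D) * t
sumFin-sym-even {zero} D g s d o = 0ℤ , sym (ℤP.*-zeroʳ (+ 2 * D))
sumFin-sym-even {suc n} D g s d o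
  with d F.zero | sumFin-sym-even D (λ i j → g (F.suc i) (F.suc j)) (λ i j → s (F.suc i) (F.suc j)) (λ i → d (F.suc i)) (λ i j → o (F.suc i) (F.suc j))
... | t₀ , p₀ | t₁ , p₁ = t₀ + row + t₁ , (begin
    g F.zero F.zero + sumFin (λ j → g F.zero (F.suc j)) + sumFin (λ i → g (F.suc i) F.zero + sumFin (λ j → g (F.suc i) (F.suc j)))
      ≡⟨ cong₂ _+_ (cong₂ _+_ p₀ r₁) (trans (sumFin-+ (λ i → g (F.suc i) F.zero) (λ i → sumFin (λ j → g (F.suc i) (F.suc j)))) (cong₂ _+_ (trans (sumFin-cong (λ i → s (F.suc i) F.zero)) r₁) p₁)) ⟩
    + 2 * D * t₀ + D * row + (D * row + + 2 * D * t₁) ≡⟨ alg D t₀ row t₁ ⟩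
    + 2 * D * (t₀ + row + t₁) ∎)
  where
  open ≡-Reasoning
  rowf : Fin n → ℤ
  rowf j = proj₁ (o F.zero (F.suc j))
  row = sumFin rowf
  r₁ : sumFin (λ j → g F.zero (F.suc j)) ≡ D * row
  r₁ = trans (sumFin-cong (λ j → proj₂ (o F.zero (F.suc j)))) (sumFin-* D rowf)
  alg : ∀ D a r b → + 2 * D * a + D * r + (D * r + + 2 * D * b) ≡ + 2 * D * (a + r + b)
  alg = solve-∀

-- Integer vectors

zeroV : ∀ {n} → Vec ℤ n
zeroV {n} = V.replicate n 0ℤ

vec-ext : ∀ {n} {u v : Vec ℤ n} → (∀ i → lookup u i ≡ lookup v i) → u ≡ v
vec-ext {u = u} {v} h = trans (sym (VP.tabulate∘lookup u)) (trans (VP.tabulate-cong h) (VP.tabulate∘lookup v))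

_≟V_ : ∀ {n} (u v : Vec ℤ n) → Dec (u ≡ v)
_≟V_ = VP.≡-dec ℤ._≟_

lookup-⊕ : ∀ {n} (u v : Vec ℤ n) i → lookup (u ⊕ v) i ≡ lookup u i + lookup v i
lookup-⊕ u v i = VP.lookup-zipWith _+_ i u v

lookup-⊖ : ∀ {n} (u v : Vec ℤ n) i → lookup (u ⊖ v) i ≡ lookup u i - lookup v i
lookup-⊖ u v i = VP.lookup-zipWith _-_ i u v

lookup-• : ∀ {n} c (v : Vec ℤ n) i → lookup (c • v) i ≡ c * lookup v i
lookup-• c v i = VP.lookup-map i (c *_) v

lookup-neg : ∀ {n} (v : Vec ℤ n) i → lookup (neg v) i ≡ - lookup v i
lookup-neg v i = VP.lookup-map i (λ x → - x) v

lookup-0 : ∀ {n} (i : Fin n) → lookup zeroV i ≡ 0ℤ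
lookup-0 i = VP.lookup-replicate i 0ℤ

lookup-e-same : ∀ {n} (i : Fin n) → lookup (e i) i ≡ 1ℤ
lookup-e-same F.zero = refl
lookup-e-same (F.suc i) = lookup-e-same i

lookup-e-diff : ∀ {n} {i j : Fin n} → i ≢ j → lookup (e i) j ≡ 0ℤ
lookup-e-diff {i = F.zero} {F.zero} p = ⊥-elim (p refl)
lookup-e-diff {i = F.zero} {F.suc j} p = VP.lookup∘tabulate (λ _ → 0ℤ) j
lookup-e-diff {i = F.suc i} {F.zero} p = refl
lookup-e-diff {i = F.suc i} {F.suc j} p = lookup-e-diff {i = i} {j} (λ q → p (cong F.suc q))

e≢0 : ∀ {n} (i : Fin n) → e i ≢ zeroV
e≢0 i p with () ← trans (sym (lookup-e-same i)) (trans (cong (λ v → lookup v i) p) (lookup-0 i))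

0≤lookup-e : ∀ {n} (i j : Fin n) → 0ℤ ≤ lookup (e i) j
0≤lookup-e i j with i F.≟ j
... | yes refl = subst (0ℤ ≤_) (sym (lookup-e-same i)) (+≤+ ℕ.z≤n)
... | no p = subst (0ℤ ≤_) (sym (lookup-e-diff p)) ℤP.≤-refl

record LinFun {n} (f : Vec ℤ n → ℤ) : Set where
  field
    add : ∀ u v → f (u ⊕ v) ≡ f u + f v
    scl : ∀ c v → f (c • v) ≡ c * f v
open LinFun

∷-split : ∀ {n} x (v : Vec ℤ n) → (x V.∷ v) ≡ (x • e F.zero) ⊕ (0ℤ V.∷ v)
∷-split x v = cong₂ V._∷_ (sym (trans (ℤP.+-identityʳ _) (ℤP.*-identityʳ x)))
  (vec-ext λ i → sym (trans (lookup-⊕ (x • tabulate (λ _ → 0ℤ)) v i)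
    (trans (cong (λ z → z + lookup v i) (trans (lookup-• x (tabulate (λ _ → 0ℤ)) i) (trans (cong (x *_) (VP.lookup∘tabulate (λ _ → 0ℤ) i)) (ℤP.*-zeroʳ x)))) (ℤP.+-identityˡ _))))

linFun-expand : ∀ {n} {f : Vec ℤ n → ℤ} → LinFun f → ∀ v → f v ≡ sumFin (λ i → lookup v i * f (e i))
linFun-expand {zero} {f} lf V.[] = scl lf 0ℤ V.[]
linFun-expand {suc n} {f} lf (x V.∷ v) = trans (cong f (∷-split x v)) (trans (add lf _ _)
  (cong₂ _+_ (scl lf x _) (linFun-expand tail v)))
  where
  tail : LinFun (λ v → f (0ℤ V.∷ v))
  tail .add u v = add lf (0ℤ V.∷ u) (0ℤ V.∷ v)
  tail .scl c v = trans (cong (λ z → f (z V.∷ (c • v))) (sym (ℤP.*-zeroʳ c))) (scl lf c (0ℤ V.∷ v))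

record Lin {n} (T : Vec ℤ n → Vec ℤ n) : Set where
  field
    add : ∀ u v → T (u ⊕ v) ≡ T u ⊕ T v
    scl : ∀ c v → T (c • v) ≡ c • T v

lookup-LinFun : ∀ {n} {T : Vec ℤ n → Vec ℤ n} → Lin T → ∀ k → LinFun (λ v → lookup (T v) k)
lookup-LinFun {T = T} lt k .add u v = trans (cong (λ z → lookup z k) (Lin.add lt u v)) (lookup-⊕ (T u) (T v) k)
lookup-LinFun {T = T} lt k .scl c v = trans (cong (λ z → lookup z k) (Lin.scl lt c v)) (lookup-• c (T v) k)

lin-expand : ∀ {n} {T : Vec ℤ n → Vec ℤ n} → Lin T → ∀ v k → lookup (T v) k ≡ sumFin (λ i → lookup v i * lookup (T (e i)) k)
lin-expand lt v k = linFun-expand (lookup-LinFun lt k) v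

lin-ext : ∀ {n} {T U : Vec ℤ n → Vec ℤ n} → Lin T → Lin U → (∀ i → T (e i) ≡ U (e i)) → ∀ v → T v ≡ U v
lin-ext lt lu h v = vec-ext λ k → trans (lin-expand lt v k) (trans (sumFin-cong (λ i → cong (λ z → lookup v i * lookup z k) (h i))) (sym (lin-expand lu v k)))

app-tabulate : ∀ {n} {T : Vec ℤ n → Vec ℤ n} → Lin T → ∀ v → app (tabulate λ i → T (e i)) v ≡ T v
app-tabulate {T = T} lt v = vec-ext λ k → trans (VP.lookup∘tabulate _ k)
  (trans (sumFin-cong (λ i → cong (λ z → lookup v i * lookup z k) (VP.lookup∘tabulate (λ i → T (e i)) i))) (sym (lin-expand lt v k)))

⊖-as-⊕ : ∀ {n} (u v : Vec ℤ n) → u ⊖ v ≡ u ⊕ neg v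
⊖-as-⊕ u v = vec-ext λ i → trans (lookup-⊖ u v i) (sym (trans (lookup-⊕ u (neg v) i) (cong (_+_ (lookup u i)) (lookup-neg v i))))

neg-as-• : ∀ {n} (v : Vec ℤ n) → neg v ≡ (- 1ℤ) • v
neg-as-• v = vec-ext λ i → trans (lookup-neg v i) (trans (sym (ℤP.-1*i≡-i _)) (sym (lookup-• (- 1ℤ) v i)))

neg-neg : ∀ {n} (v : Vec ℤ n) → neg (neg v) ≡ v
neg-neg v = vec-ext λ i → trans (lookup-neg (neg v) i) (trans (cong -_ (lookup-neg v i)) (ℤP.neg-involutive _))

lookup-⊕• : ∀ {n} (u : Vec ℤ n) c v i → lookup (u ⊖ (c • v)) i ≡ lookup u i - c * lookup v i
lookup-⊕• u c v i = trans (lookup-⊖ u (c • v) i) (cong (_-_ (lookup u i)) (lookup-• c v i))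

module _ {n : ℕ} {f : Vec ℤ n → ℤ} (lf : LinFun f) where
  linFun-neg : ∀ v → f (neg v) ≡ - f v
  linFun-neg v = trans (cong f (neg-as-• v)) (trans (scl lf (- 1ℤ) v) (ℤP.-1*i≡-i _))

  linFun-⊖ : ∀ u v → f (u ⊖ v) ≡ f u - f v
  linFun-⊖ u v = trans (cong f (⊖-as-⊕ u v)) (trans (add lf u (neg v)) (cong (_+_ (f u)) (linFun-neg v)))

  linFun-⊖• : ∀ u c v → f (u ⊖ (c • v)) ≡ f u - c * f v
  linFun-⊖• u c v = trans (linFun-⊖ u (c • v)) (cong (_-_ (f u)) (scl lf c v))

  linFun-0 : f zeroV ≡ 0ℤ
  linFun-0 = trans (cong f 0-as) (scl lf 0ℤ zeroV)
    where
    0-as : zeroV ≡ 0ℤ • zeroV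
    0-as = vec-ext λ i → trans (lookup-0 i) (sym (lookup-• 0ℤ zeroV i))

module _ {n : ℕ} {T : Vec ℤ n → Vec ℤ n} (lt : Lin T) where
  lin-neg : ∀ v → T (neg v) ≡ neg (T v)
  lin-neg v = trans (cong T (neg-as-• v)) (trans (Lin.scl lt (- 1ℤ) v) (sym (neg-as-• (T v))))

  lin-⊖ : ∀ u v → T (u ⊖ v) ≡ T u ⊖ T v
  lin-⊖ u v = trans (cong T (⊖-as-⊕ u v)) (trans (Lin.add lt u (neg v)) (trans (cong (T u ⊕_) (lin-neg v)) (sym (⊖-as-⊕ (T u) (T v)))))

  lin-⊖• : ∀ u c v → T (u ⊖ (c • v)) ≡ T u ⊖ (c • T v)
  lin-⊖• u c v = trans (lin-⊖ u (c • v)) (cong (T u ⊖_) (Lin.scl lt c v))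

-- Sign conditions on vectors

Pos Neg : ∀ {n} → Vec ℤ n → Set
Pos v = ∀ i → 0ℤ ≤ lookup v i
Neg v = ∀ i → lookup v i ≤ 0ℤ

Pos? : ∀ {n} (v : Vec ℤ n) → Dec (Pos v)
Pos? v = FP.all? λ i → 0ℤ ℤ.≤? lookup v i

Pos-neg : ∀ {n} (v : Vec ℤ n) → Pos v → Neg (neg v)
Pos-neg v p i = subst (_≤ 0ℤ) (sym (lookup-neg v i)) (0≤⇒-≤0 (p i))

Neg-neg : ∀ {n} (v : Vec ℤ n) → Neg v → Pos (neg v)
Neg-neg v p i = subst (0ℤ ≤_) (sym (lookup-neg v i)) (≤0⇒0≤- (p i))

Pos∧Neg⇒0 : ∀ {n} {v : Vec ℤ n} → Pos v → Neg v → v ≡ zeroV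
Pos∧Neg⇒0 p q = vec-ext λ i → trans (ℤP.≤-antisym (q i) (p i)) (sym (lookup-0 i))

Pos-e : ∀ {n} (i : Fin n) → Pos (e i)
Pos-e i j = 0≤lookup-e i j

Pos-⊕ : ∀ {n} (u v : Vec ℤ n) → Pos u → Pos v → Pos (u ⊕ v)
Pos-⊕ u v p q i = subst (0ℤ ≤_) (sym (lookup-⊕ u v i)) (0≤-+ (p i) (q i))

-- The hypothesis is confined to the support of `v` because for elements of W⁰ only the simple roots
-- in Π(0) are known to stay positive.
lin-Pos : ∀ {n} {T : Vec ℤ n → Vec ℤ n} → Lin T → ∀ v → (∀ i → 0ℤ ≤ lookup v i) → (∀ i → lookup v i ≢ 0ℤ → Pos (T (e i))) → Pos (T v)
lin-Pos {T = T} lt v p h k = subst (0ℤ ≤_) (sym (lin-expand lt v k)) (sumFin-nonneg λ i → term i)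
  where
  term : ∀ i → 0ℤ ≤ lookup v i * lookup (T (e i)) k
  term i with lookup v i ℤ.≟ 0ℤ
  ... | yes z = subst (λ x → 0ℤ ≤ x * lookup (T (e i)) k) (sym z) (ℤP.≤-reflexive refl)
  ... | no nz = 0≤-* (p i) (h i nz k)

sumFin-e : ∀ {n} (i : Fin n) (g : Fin n → ℤ) → sumFin (λ j → lookup (e i) j * g j) ≡ g i
sumFin-e {suc n} F.zero g = trans (cong₂ _+_ (ℤP.*-identityˡ (g F.zero))
  (trans (sumFin-cong (λ j → trans (cong (λ z → z * g (F.suc j)) (VP.lookup∘tabulate (λ _ → 0ℤ) j)) (ℤP.*-zeroˡ (g (F.suc j))))) (sumFin-0 n)))
  (ℤP.+-identityʳ (g F.zero))
sumFin-e (F.suc i) g = trans (cong₂ _+_ (ℤP.*-zeroˡ (g F.zero)) (sumFin-e i (λ j → g (F.suc j)))) (ℤP.+-identityˡ (g (F.suc i)))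

linFun-sum : ∀ {n} (c : Fin n → ℤ) → LinFun (λ v → sumFin (λ j → c j * lookup v j))
linFun-sum c .LinFun.add u v = trans (sumFin-cong (λ j → trans (cong (c j *_) (lookup-⊕ u v j)) (ℤP.*-distribˡ-+ (c j) (lookup u j) (lookup v j))))
  (sumFin-+ (λ j → c j * lookup u j) (λ j → c j * lookup v j))
linFun-sum c .LinFun.scl k v = trans (sumFin-cong (λ j → trans (cong (c j *_) (lookup-• k v j)) (alg (c j) k (lookup v j))))
  (sumFin-* k (λ j → c j * lookup v j))
  where
  alg : ∀ a k x → a * (k * x) ≡ k * (a * x)
  alg = solve-∀

linFun-cong : ∀ {n} {f g : Vec ℤ n → ℤ} → (∀ v → f v ≡ g v) → LinFun g → LinFun f
linFun-cong h l .LinFun.add u v = trans (h (u ⊕ v)) (trans (LinFun.add l u v) (sym (cong₂ _+_ (h u) (h v))))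
linFun-cong h l .LinFun.scl c v = trans (h (c • v)) (trans (LinFun.scl l c v) (sym (cong (c *_) (h v))))

-- The root system: reflections, sign coherence and the exchange condition.

module Roots {n : ℕ} (C : CartanData n) (sc : IsSimpleCartan C) where
  open CartanData C

  n≥1 : 1 ℕ.≤ n
  n≥1 = proj₁ sc
  a-diag : ∀ i → a i i ≡ + 2
  a-diag = proj₁ (proj₂ sc)
  a-off : ∀ i j → i ≢ j → a i j ≤ 0ℤ
  a-off = proj₁ (proj₂ (proj₂ sc))
  d≥1 : ∀ i → 1 ℕ.≤ d i
  d≥1 = proj₁ (proj₂ (proj₂ (proj₂ sc)))
  a-sym : ∀ i j → + d i * a i j ≡ + d j * a j i
  a-sym = proj₁ (proj₂ (proj₂ (proj₂ (proj₂ sc))))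
  form-posdef : ∀ x → x ≢ zeroV → 0ℤ < form C x x
  form-posdef = proj₁ (proj₂ (proj₂ (proj₂ (proj₂ (proj₂ sc)))))
  connected : ∀ (S : Fin n → Bool) → (∃ λ i → S i ≡ true) → (∃ λ j → S j ≡ false) → ∃₂ λ i j → S i ≡ true × S j ≡ false × a i j ≢ 0ℤ
  connected = proj₂ (proj₂ (proj₂ (proj₂ (proj₂ (proj₂ sc)))))

  ⟨_,_⟩ : Vec ℤ n → Vec ℤ n → ℤ
  ⟨ x , y ⟩ = form C x y

  D : Fin n → ℤ
  D i = + d i

  D>0 : ∀ i → 0ℤ < D i
  D>0 i = +<+ (d≥1 i)

  a-zero-sym : ∀ i j → a i j ≡ 0ℤ → a j i ≡ 0ℤ
  a-zero-sym i j p = *-cancel (a j i) 0ℤ (D>0 j) (trans (sym (a-sym i j)) (trans (cong (D i *_) p) (trans (ℤP.*-zeroʳ (D i)) (sym (ℤP.*-zeroʳ (D j))))))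

  -- The pairing ⟨α_i^∨, v⟩ with a simple coroot.
  cor : Fin n → Vec ℤ n → ℤ
  cor i v = sumFin (λ j → a i j * lookup v j)

  cor-lin : ∀ i → LinFun (cor i)
  cor-lin i = linFun-sum (a i)

  cor-e : ∀ i j → cor i (e j) ≡ a i j
  cor-e i j = trans (sumFin-cong (λ k → ℤP.*-comm (a i k) (lookup (e j) k))) (sumFin-e j (a i))

  form-cor : ∀ x y → ⟨ x , y ⟩ ≡ sumFin (λ i → lookup x i * (D i * cor i y))
  form-cor x y = sumFin-cong λ i → trans (sumFin-cong (λ j → alg (lookup x i) (D i) (a i j) (lookup y j)))
    (trans (sumFin-* (lookup x i * D i) (λ j → a i j * lookup y j)) (ℤP.*-assoc (lookup x i) (D i) (cor i y)))
    where
    alg : ∀ x d a y → x * (d * a) * y ≡ x * d * (a * y)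
    alg = solve-∀

  form-sym : ∀ x y → ⟨ x , y ⟩ ≡ ⟨ y , x ⟩
  form-sym x y = trans (sumFin-swap (λ i j → lookup x i * (D i * a i j) * lookup y j))
    (sumFin-cong λ j → sumFin-cong λ i → trans (cong (λ z → lookup x i * z * lookup y j) (a-sym i j)) (alg (lookup x i) (D j * a j i) (lookup y j)))
    where
    alg : ∀ x d y → x * d * y ≡ y * d * x
    alg = solve-∀

  form-linˡ : ∀ y → LinFun (λ x → ⟨ x , y ⟩)
  form-linˡ y = linFun-cong (λ x → trans (form-cor x y) (sumFin-cong λ i → ℤP.*-comm (lookup x i) (D i * cor i y))) (linFun-sum (λ i → D i * cor i y))

  form-linʳ : ∀ x → LinFun (λ y → ⟨ x , y ⟩)
  form-linʳ x = linFun-cong (form-sym x) (form-linˡ x)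

  form-e : ∀ i y → ⟨ e i , y ⟩ ≡ D i * cor i y
  form-e i y = trans (form-cor (e i) y) (sumFin-e i (λ i → D i * cor i y))

  form-ee : ∀ i → ⟨ e i , e i ⟩ ≡ + 2 * D i
  form-ee i = trans (form-e i (e i)) (trans (cong (D i *_) (trans (cor-e i i) (a-diag i))) (ℤP.*-comm (D i) (+ 2)))

  form-nonneg-zero : ∀ x → ⟨ x , x ⟩ ≤ 0ℤ → x ≡ zeroV
  form-nonneg-zero x p with x ≟V zeroV
  ... | yes q = q
  ... | no q = ⊥-elim (<⇒≱ (form-posdef x q) p)

  s : Fin n → Vec ℤ n → Vec ℤ n
  s = sRefl C

  s-lin : ∀ i → Lin (s i)
  s-lin i .Lin.add u v = vec-ext λ k → trans (lookup-⊕• (u ⊕ v) (cor i (u ⊕ v)) (e i) k)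
    (trans (cong₂ _-_ (lookup-⊕ u v k) (cong (λ z → z * lookup (e i) k) (LinFun.add (cor-lin i) u v)))
    (trans (alg (lookup u k) (lookup v k) (cor i u) (cor i v) (lookup (e i) k))
    (sym (trans (lookup-⊕ (s i u) (s i v) k) (cong₂ _+_ (lookup-⊕• u (cor i u) (e i) k) (lookup-⊕• v (cor i v) (e i) k))))))
    where
    alg : ∀ u v a b x → (u + v) - (a + b) * x ≡ (u - a * x) + (v - b * x)
    alg = solve-∀
  s-lin i .Lin.scl c v = vec-ext λ k → trans (lookup-⊕• (c • v) (cor i (c • v)) (e i) k)
    (trans (cong₂ _-_ (lookup-• c v k) (cong (λ z → z * lookup (e i) k) (LinFun.scl (cor-lin i) c v)))
    (trans (alg c (lookup v k) (cor i v) (lookup (e i) k))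
    (sym (trans (lookup-• c (s i v) k) (cong (c *_) (lookup-⊕• v (cor i v) (e i) k))))))
    where
    alg : ∀ c v a x → c * v - (c * a) * x ≡ c * (v - a * x)
    alg = solve-∀

  lookup-s-diff : ∀ i v k → i ≢ k → lookup (s i v) k ≡ lookup v k
  lookup-s-diff i v k p = trans (lookup-⊕• v (cor i v) (e i) k) (trans (cong (λ z → lookup v k - cor i v * z) (lookup-e-diff p)) (alg (lookup v k) (cor i v)))
    where
    alg : ∀ v c → v - c * 0ℤ ≡ v
    alg = solve-∀

  lookup-s-same : ∀ i v → lookup (s i v) i ≡ lookup v i - cor i v
  lookup-s-same i v = trans (lookup-⊕• v (cor i v) (e i) i) (cong (_-_ (lookup v i)) (trans (cong (cor i v *_) (lookup-e-same i)) (ℤP.*-identityʳ (cor i v))))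

  cor-s : ∀ i j v → cor i (s j v) ≡ cor i v - cor j v * a i j
  cor-s i j v = trans (linFun-⊖• (cor-lin i) v (cor j v) (e j)) (cong (λ z → cor i v - cor j v * z) (cor-e i j))

  cor-s-self : ∀ i v → cor i (s i v) ≡ - cor i v
  cor-s-self i v = trans (cor-s i i v) (trans (cong (λ z → cor i v - cor i v * z) (a-diag i)) (alg (cor i v)))
    where
    alg : ∀ c → c - c * + 2 ≡ - c
    alg = solve-∀

  s-invol : ∀ i v → s i (s i v) ≡ v
  s-invol i v = vec-ext λ k → trans (lookup-⊕• (s i v) (cor i (s i v)) (e i) k)
    (trans (cong₂ (λ x y → x - y * lookup (e i) k) (lookup-⊕• v (cor i v) (e i) k) (cor-s-self i v)) (alg (lookup v k) (cor i v) (lookup (e i) k)))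
    where
    alg : ∀ v c x → (v - c * x) - (- c) * x ≡ v
    alg = solve-∀

  s-e-self : ∀ i → s i (e i) ≡ neg (e i)
  s-e-self i = vec-ext λ k → trans (lookup-⊕• (e i) (cor i (e i)) (e i) k)
    (trans (cong (λ z → lookup (e i) k - z * lookup (e i) k) (trans (cor-e i i) (a-diag i))) (trans (alg (lookup (e i) k)) (sym (lookup-neg (e i) k))))
    where
    alg : ∀ x → x - + 2 * x ≡ - x
    alg = solve-∀

  form-s : ∀ i u v → ⟨ s i u , s i v ⟩ ≡ ⟨ u , v ⟩
  form-s i u v = trans (linFun-⊖• (form-linˡ (s i v)) u (cor i u) (e i))
    (trans (cong₂ (λ x y → x - cor i u * y) (trans (linFun-⊖• (form-linʳ u) v (cor i v) (e i)) (cong (λ z → ⟨ u , v ⟩ - cor i v * z) (trans (form-sym u (e i)) (form-e i u))))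
       (trans (form-e i (s i v)) (cong (D i *_) (cor-s-self i v))))
    (alg ⟨ u , v ⟩ (cor i u) (cor i v) (D i)))
    where
    alg : ∀ f a b d → (f - b * (d * a)) - a * (d * - b) ≡ f
    alg = solve-∀

  W : List (Fin n) → Vec ℤ n → Vec ℤ n
  W = act C

  W-lin : ∀ w → Lin (W w)
  W-lin [] .Lin.add u v = refl
  W-lin [] .Lin.scl c v = refl
  W-lin (i ∷ w) .Lin.add u v = trans (cong (s i) (Lin.add (W-lin w) u v)) (Lin.add (s-lin i) (W w u) (W w v))
  W-lin (i ∷ w) .Lin.scl c v = trans (cong (s i) (Lin.scl (W-lin w) c v)) (Lin.scl (s-lin i) c (W w v))

  W-++ : ∀ u w v → W (u ++ w) v ≡ W u (W w v)
  W-++ [] w v = refl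
  W-++ (i ∷ u) w v = cong (s i) (W-++ u w v)

  W-form : ∀ w u v → ⟨ W w u , W w v ⟩ ≡ ⟨ u , v ⟩
  W-form [] u v = refl
  W-form (i ∷ w) u v = trans (form-s i (W w u) (W w v)) (W-form w u v)

  inv : List (Fin n) → List (Fin n)
  inv = reverse

  W-inv : ∀ w v → W (inv w) (W w v) ≡ v
  W-inv [] v = refl
  W-inv (i ∷ w) v = trans (cong (λ z → W z (s i (W w v))) (LP.unfold-reverse i w))
    (trans (W-++ (inv w) (i ∷ []) (s i (W w v))) (trans (cong (W (inv w)) (s-invol i (W w v))) (W-inv w v)))

  W-inv′ : ∀ w v → W w (W (inv w) v) ≡ v
  W-inv′ w v = trans (cong (λ z → W z (W (inv w) v)) (sym (LP.reverse-involutive w))) (W-inv (inv w) v)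

  W-adj : ∀ w u v → ⟨ W w u , v ⟩ ≡ ⟨ u , W (inv w) v ⟩
  W-adj w u v = trans (cong (λ z → ⟨ W w u , z ⟩) (sym (W-inv′ w v))) (W-form w u (W (inv w) v))

  W-inj : ∀ w {u v} → W w u ≡ W w v → u ≡ v
  W-inj w {u} {v} p = trans (sym (W-inv w u)) (trans (cong (W (inv w)) p) (W-inv w v))

  -- Roots

  Root : Vec ℤ n → Set
  Root = IsRoot C

  root-e : ∀ i → Root (e i)
  root-e i = [] , i , refl

  root-W : ∀ {v} u → Root v → Root (W u v)
  root-W u (w , i , refl) = u ++ w , i , W-++ u w (e i)

  root-W⁻ : ∀ {v} u → Root (W u v) → Root v
  root-W⁻ {v} u r = subst Root (W-inv u v) (root-W (inv u) r)

  root-neg : ∀ {v} → Root v → Root (neg v)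
  root-neg (w , i , refl) = w ++ i ∷ [] , i , trans (W-++ w (i ∷ []) (e i)) (trans (cong (W w) (s-e-self i)) (lin-neg (W-lin w) (e i)))

  root-neg⁻ : ∀ {v} → Root (neg v) → Root v
  root-neg⁻ {v} r = subst Root (neg-neg v) (root-neg r)

  root-≢0 : ∀ {v} → Root v → v ≢ zeroV
  root-≢0 (w , i , p) q = e≢0 i (W-inj w (trans p (trans q (sym (vec-ext λ k → trans (linFun-0 (lookup-LinFun (W-lin w) k)) (sym (lookup-0 k)))))))

  -- Half the squared length, read off the simple root to which the witness conjugates `v`.
  rootD : ∀ {v} → Root v → ℤ
  rootD (w , i , p) = D i

  rootD>0 : ∀ {v} (r : Root v) → 0ℤ < rootD r
  rootD>0 (w , i , p) = D>0 i

  root-norm : ∀ {v} (r : Root v) → ⟨ v , v ⟩ ≡ + 2 * rootD r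
  root-norm (w , i , refl) = trans (W-form w (e i) (e i)) (form-ee i)

  -- The Cartan integer ⟨v^∨, x⟩. Transporting `x` to the simple root of the witness makes it
  -- integral by construction, without a division by (v,v).
  rootM : ∀ {v} → Root v → Vec ℤ n → ℤ
  rootM (w , i , p) x = cor i (W (inv w) x)

  root-form : ∀ {v} (r : Root v) x → ⟨ v , x ⟩ ≡ rootD r * rootM r x
  root-form (w , i , refl) x = trans (W-adj w (e i) x) (form-e i (W (inv w) x))

  -- The reflection in v = w(α_i), written as the conjugate of s_i by w.
  rootWord : ∀ {v} → Root v → List (Fin n)
  rootWord (w , i , p) = w ++ i ∷ inv w

  W-rootWord : ∀ {v} (r : Root v) x → W (rootWord r) x ≡ x ⊖ (rootM r x • v)
  W-rootWord (w , i , refl) x = trans (W-++ w (i ∷ inv w) x) (trans (lin-⊖• (W-lin w) (W (inv w) x) (cor i (W (inv w) x)) (e i))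
    (cong (λ z → z ⊖ (cor i (W (inv w) x) • W w (e i))) (W-inv′ w x)))

  root-refl : ∀ {v} (r : Root v) {x} → Root x → Root (x ⊖ (rootM r x • v))
  root-refl r {x} rx = subst Root (W-rootWord r x) (root-W (rootWord r) rx)

  private
    ⊖1• : ∀ (x v : Vec ℤ n) → x ⊖ (1ℤ • v) ≡ x ⊖ v
    ⊖1• x v = vec-ext λ k → trans (lookup-⊕• x 1ℤ v k) (trans (cong (_-_ (lookup x k)) (ℤP.*-identityˡ (lookup v k))) (sym (lookup-⊖ x v k)))

    neg-⊖ : ∀ (x v : Vec ℤ n) → neg (x ⊖ v) ≡ v ⊖ x
    neg-⊖ x v = vec-ext λ k → trans (lookup-neg (x ⊖ v) k) (trans (cong -_ (lookup-⊖ x v k)) (trans (alg (lookup x k) (lookup v k)) (sym (lookup-⊖ v x k))))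
      where
      alg : ∀ x v → - (x - v) ≡ v - x
      alg = solve-∀

  ⊖≡0 : ∀ {x v : Vec ℤ n} → x ⊖ v ≡ zeroV → x ≡ v
  ⊖≡0 {x} {v} p = vec-ext λ k → ℤP.i-j≡0⇒i≡j (lookup x k) (lookup v k) (trans (sym (lookup-⊖ x v k)) (trans (cong (λ z → lookup z k) p) (lookup-0 k)))

  form-⊖⊖ : ∀ x y → ⟨ x ⊖ y , x ⊖ y ⟩ ≡ ⟨ x , x ⟩ + ⟨ y , y ⟩ - + 2 * ⟨ x , y ⟩
  form-⊖⊖ x y = trans (linFun-⊖ (form-linˡ (x ⊖ y)) x y) (trans (cong₂ _-_ (linFun-⊖ (form-linʳ x) x y) (linFun-⊖ (form-linʳ y) x y))
    (trans (cong (λ z → ⟨ x , x ⟩ - ⟨ x , y ⟩ - (z - ⟨ y , y ⟩)) (form-sym y x)) (alg ⟨ x , x ⟩ ⟨ x , y ⟩ ⟨ y , y ⟩)))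
    where
    alg : ∀ a b c → a - b - (b - c) ≡ a + c - + 2 * b
    alg = solve-∀

  -- One of the two Cartan integers of an acute pair is 1: if both were ≥ 2, then (α-β,α-β) ≤ 0.
  root-⊖ : ∀ {α β} → Root α → Root β → 0ℤ < ⟨ α , β ⟩ → α ≢ β → Root (α ⊖ β)
  root-⊖ {α} {β} rα rβ pos ne = go (rootM rα β) (rootM rβ α) refl refl
    where
    open ℤP.≤-Reasoning
    fα : ⟨ α , β ⟩ ≡ rootD rα * rootM rα β
    fα = root-form rα β
    fβ : ⟨ α , β ⟩ ≡ rootD rβ * rootM rβ α
    fβ = trans (form-sym α β) (root-form rβ α)
    m>0 : 0ℤ < rootM rα β
    m>0 = pos-cancelˡ (rootD>0 rα) (subst (0ℤ <_) fα pos)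
    m'>0 : 0ℤ < rootM rβ α
    m'>0 = pos-cancelˡ (rootD>0 rβ) (subst (0ℤ <_) fβ pos)
    go : ∀ m m' → rootM rα β ≡ m → rootM rβ α ≡ m' → Root (α ⊖ β)
    go m m' p p' with m' ℤ.≟ 1ℤ
    ... | yes refl = subst Root (trans (cong (λ z → α ⊖ (z • β)) p') (⊖1• α β)) (root-refl rβ rα)
    ... | no q' with m ℤ.≟ 1ℤ
    ...   | yes refl = subst Root (neg-⊖ β α) (root-neg (subst Root (trans (cong (λ z → β ⊖ (z • α)) p) (⊖1• β α)) (root-refl rα rβ)))
    ...   | no q = ⊥-elim (ne (⊖≡0 (form-nonneg-zero (α ⊖ β) (begin
              ⟨ α ⊖ β , α ⊖ β ⟩ ≡⟨ form-⊖⊖ α β ⟩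
              ⟨ α , α ⟩ + ⟨ β , β ⟩ - + 2 * ⟨ α , β ⟩ ≡⟨ alg ⟨ α , α ⟩ ⟨ β , β ⟩ ⟨ α , β ⟩ ⟩
              (⟨ α , α ⟩ - ⟨ α , β ⟩) + (⟨ β , β ⟩ - ⟨ α , β ⟩) ≤⟨ ℤP.+-mono-≤ le le' ⟩
              0ℤ ∎))))
      where
      alg : ∀ a b c → a + b - + 2 * c ≡ (a - c) + (b - c)
      alg = solve-∀
      two≤ : ∀ k → 0ℤ < k → k ≢ 1ℤ → + 2 ≤ k
      two≤ (+ zero) (+<+ ()) _
      two≤ (+ suc zero) _ x = ⊥-elim (x refl)
      two≤ (+ suc (suc k)) _ _ = +≤+ (ℕ.s≤s (ℕ.s≤s ℕ.z≤n))
      bound : ∀ {v} (r : Root v) k x → ⟨ α , β ⟩ ≡ rootD r * k → 0ℤ < k → k ≢ 1ℤ → ⟨ v , v ⟩ ≡ x → x - ⟨ α , β ⟩ ≤ 0ℤ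
      bound {v} r k x f k>0 k≢1 refl = ℤP.i≤j⇒i-j≤0 (begin
        ⟨ v , v ⟩ ≡⟨ root-norm r ⟩
        + 2 * rootD r ≡⟨ ℤP.*-comm (+ 2) (rootD r) ⟩
        rootD r * + 2 ≤⟨ ℤP.*-monoˡ-≤-nonNeg (rootD r) {{ℤ.nonNegative (ℤP.<⇒≤ (rootD>0 r))}} (two≤ k k>0 k≢1) ⟩
        rootD r * k ≡⟨ sym f ⟩
        ⟨ α , β ⟩ ∎)
      le = bound rα m ⟨ α , α ⟩ (trans fα (cong (rootD rα *_) p)) (subst (0ℤ <_) p m>0) q refl
      le' = bound rβ m' ⟨ β , β ⟩ (trans fβ (cong (rootD rβ *_) p')) (subst (0ℤ <_) p' m'>0) q' refl

  -- Sign coherence.  If v ∈ W α_i, then its coroot has integral coordinates z in the simple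
  -- coroots, i.e. v_j d_j = d_i z_j.  Nonzero vectors with this property have norm ≥ 2 d_i, and
  -- the property passes to the positive and negative parts p, q of v.  As (p,q) ≤ 0, if both
  -- were nonzero, then (v,v) ≥ (p,p) + (q,q) ≥ 4 d_i > 2 d_i = (v,v).

  CorootIntegral : Fin n → Vec ℤ n → Set
  CorootIntegral i v = ∀ j → ∃ λ z → lookup v j * D j ≡ D i * z

  e-D : ∀ k j → lookup (e k) j * D j ≡ lookup (e k) j * D k
  e-D k j with k F.≟ j
  ... | yes refl = refl
  ... | no p = trans (cong (_* D j) (lookup-e-diff p)) (sym (cong (_* D k) (lookup-e-diff p)))

  -- The coordinates `z` of the coroot change by the dual reflection: `S` is the pairing of the
  -- coroot with α_k, and symmetry of d_k a_kl turns the pairing of `v` with α_k^∨ into it.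
  corootIntegral-s : ∀ i k v → CorootIntegral i v → CorootIntegral i (s k v)
  corootIntegral-s i k v h j = z j - lookup (e k) j * S , (begin
    lookup (s k v) j * D j ≡⟨ cong (_* D j) (lookup-⊕• v (cor k v) (e k) j) ⟩
    (lookup v j - cor k v * lookup (e k) j) * D j ≡⟨ alg₁ (lookup v j) (cor k v) (lookup (e k) j) (D j) ⟩
    lookup v j * D j - cor k v * (lookup (e k) j * D j) ≡⟨ cong₂ (λ x y → x - cor k v * y) (proj₂ (h j)) (e-D k j) ⟩
    D i * z j - cor k v * (lookup (e k) j * D k) ≡⟨ alg₂ (D i * z j) (cor k v) (lookup (e k) j) (D k) ⟩
    D i * z j - lookup (e k) j * (D k * cor k v) ≡⟨ cong (λ x → D i * z j - lookup (e k) j * x) key ⟩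
    D i * z j - lookup (e k) j * (D i * S) ≡⟨ alg₃ (D i) (z j) (lookup (e k) j) S ⟩
    D i * (z j - lookup (e k) j * S) ∎)
    where
    open ≡-Reasoning
    z : Fin n → ℤ
    z j = proj₁ (h j)
    S : ℤ
    S = sumFin (λ l → a l k * z l)
    alg₁ : ∀ v c x d → (v - c * x) * d ≡ v * d - c * (x * d)
    alg₁ = solve-∀
    alg₂ : ∀ u c x d → u - c * (x * d) ≡ u - x * (d * c)
    alg₂ = solve-∀
    alg₃ : ∀ d z x s → d * z - x * (d * s) ≡ d * (z - x * s)
    alg₃ = solve-∀
    alg₄ : ∀ d a v → d * a * v ≡ a * (v * d)
    alg₄ = solve-∀
    alg₅ : ∀ d a z → a * (d * z) ≡ d * (a * z)
    alg₅ = solve-∀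
    key : D k * cor k v ≡ D i * S
    key = trans (sym (sumFin-* (D k) (λ l → a k l * lookup v l))) (trans (sumFin-cong λ l → begin
      D k * (a k l * lookup v l) ≡⟨ sym (ℤP.*-assoc (D k) (a k l) (lookup v l)) ⟩
      D k * a k l * lookup v l ≡⟨ cong (_* lookup v l) (a-sym k l) ⟩
      D l * a l k * lookup v l ≡⟨ alg₄ (D l) (a l k) (lookup v l) ⟩
      a l k * (lookup v l * D l) ≡⟨ cong (a l k *_) (proj₂ (h l)) ⟩
      a l k * (D i * z l) ≡⟨ alg₅ (D i) (a l k) (z l) ⟩
      D i * (a l k * z l) ∎) (sumFin-* (D i) (λ l → a l k * z l)))

  corootIntegral-W : ∀ w i → CorootIntegral i (W w (e i))
  corootIntegral-W [] i j = lookup (e i) j , trans (e-D i j) (ℤP.*-comm (lookup (e i) j) (D i))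
  corootIntegral-W (k ∷ w) i = corootIntegral-s i k (W w (e i)) (corootIntegral-W w i)

  -- The terms are x_j d_j a_jk x_k = d_i z_j a_jk x_k, hence multiples of d_i. Those off the
  -- diagonal occur twice, and those on it contain a_jj = 2.
  corootIntegral-norm : ∀ i x → CorootIntegral i x → ∃ λ K → ⟨ x , x ⟩ ≡ (+ 2 * D i) * K
  corootIntegral-norm i x h = sumFin-sym-even (D i) (λ j k → lookup x j * (D j * a j k) * lookup x k)
    (λ j k → trans (cong (λ t → lookup x j * t * lookup x k) (a-sym j k)) (alg₀ (lookup x j) (D k * a k j) (lookup x k)))
    (λ j → proj₁ (h j) * lookup x j , trans (cong (λ t → lookup x j * (D j * t) * lookup x j) (a-diag j))
       (trans (alg₁ (lookup x j) (D j)) (trans (cong (λ t → + 2 * t * lookup x j) (proj₂ (h j))) (alg₂ (D i) (proj₁ (h j)) (lookup x j)))))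
    (λ j k → proj₁ (h j) * a j k * lookup x k , trans (alg₃ (lookup x j) (D j) (a j k) (lookup x k))
       (trans (cong (λ t → t * a j k * lookup x k) (proj₂ (h j))) (alg₄ (D i) (proj₁ (h j)) (a j k) (lookup x k))))
    where
    alg₀ : ∀ x t y → x * t * y ≡ y * t * x
    alg₀ = solve-∀
    alg₁ : ∀ x d → x * (d * + 2) * x ≡ + 2 * (x * d) * x
    alg₁ = solve-∀
    alg₂ : ∀ d z x → + 2 * (d * z) * x ≡ (+ 2 * d) * (z * x)
    alg₂ = solve-∀
    alg₃ : ∀ x d a y → x * (d * a) * y ≡ (x * d) * a * y
    alg₃ = solve-∀
    alg₄ : ∀ d z a y → (d * z) * a * y ≡ d * (z * a * y)
    alg₄ = solve-∀

  2D>0 : ∀ i → 0ℤ < + 2 * D i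
  2D>0 i = 0<-* {+ 2} {D i} (+<+ (ℕ.s≤s ℕ.z≤n)) (D>0 i)

  corootIntegral-norm≥ : ∀ i x → CorootIntegral i x → x ≢ zeroV → + 2 * D i ≤ ⟨ x , x ⟩
  corootIntegral-norm≥ i x h nz with corootIntegral-norm i x h
  ... | K , p = subst₂ _≤_ (ℤP.*-identityʳ (+ 2 * D i)) (sym p)
    (ℤP.*-monoˡ-≤-nonNeg (+ 2 * D i) {{ℤ.nonNegative (ℤP.<⇒≤ (2D>0 i))}} (0<⇒1≤ (pos-cancelˡ (2D>0 i) (subst (0ℤ <_) p (form-posdef x nz)))))

  pos⁺ neg⁺ : ℤ → ℤ
  pos⁺ (+ k) = + k
  pos⁺ -[1+ k ] = 0ℤ
  neg⁺ (+ k) = 0ℤ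
  neg⁺ -[1+ k ] = + suc k

  coherent : ∀ {v} → Root v → Pos v ⊎ Neg v
  coherent {v} (w , i , refl) with p ≟V zeroV | q ≟V zeroV
    where
    p = V.map pos⁺ v
    q = V.map neg⁺ v
  ... | yes z | _ = inj₂ λ j → lem (lookup v j) (trans (sym (VP.lookup-map j pos⁺ v)) (trans (cong (λ u → lookup u j) z) (lookup-0 j)))
    where
    lem : ∀ x → pos⁺ x ≡ 0ℤ → x ≤ 0ℤ
    lem (+ k) h = ℤP.≤-reflexive h
    lem -[1+ k ] h = -≤+
  ... | no _ | yes z = inj₁ λ j → lem (lookup v j) (trans (sym (VP.lookup-map j neg⁺ v)) (trans (cong (λ u → lookup u j) z) (lookup-0 j)))
    where
    lem : ∀ x → neg⁺ x ≡ 0ℤ → 0ℤ ≤ x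
    lem (+ k) h = +≤+ ℕ.z≤n
    lem -[1+ k ] ()
  ... | no p≢0 | no q≢0 = ⊥-elim (<⇒≱ (2D>0 i) (0≤-⇒≤0 (subst (0ℤ ≤_) final
        (0≤-+ (0≤-+ (≤⇒0≤- (corootIntegral-norm≥ i p p-int p≢0)) (≤⇒0≤- (corootIntegral-norm≥ i q q-int q≢0)))
          (0≤-* {+ 2} { - ⟨ p , q ⟩ } (+≤+ ℕ.z≤n) (≤0⇒0≤- pq≤0))))))
    where
    p = V.map pos⁺ v
    q = V.map neg⁺ v
    split : ∀ x → x ≡ pos⁺ x - neg⁺ x
    split (+ k) = sym (ℤP.+-identityʳ (+ k))
    split -[1+ k ] = refl
    v≡ : v ≡ p ⊖ q
    v≡ = vec-ext λ j → trans (split (lookup v j)) (sym (trans (lookup-⊖ p q j) (cong₂ _-_ (VP.lookup-map j pos⁺ v) (VP.lookup-map j neg⁺ v))))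
    v-int = corootIntegral-W w i
    p-int : CorootIntegral i p
    p-int j with lookup v j in eq | v-int j
    ... | + k | z , h = z , trans (cong (_* D j) (trans (VP.lookup-map j pos⁺ v) (cong pos⁺ eq))) h
    ... | -[1+ k ] | z , h = 0ℤ , trans (cong (_* D j) (trans (VP.lookup-map j pos⁺ v) (cong pos⁺ eq))) (sym (ℤP.*-zeroʳ (D i)))
    q-int : CorootIntegral i q
    q-int j with lookup v j in eq | v-int j
    ... | + k | z , h = 0ℤ , trans (cong (_* D j) (trans (VP.lookup-map j neg⁺ v) (cong neg⁺ eq))) (sym (ℤP.*-zeroʳ (D i)))
    ... | -[1+ k ] | z , h = - z , trans (cong (_* D j) (trans (VP.lookup-map j neg⁺ v) (cong neg⁺ eq)))
            (trans (sym (ℤP.neg-distribˡ-* -[1+ k ] (D j))) (trans (cong -_ h) (ℤP.neg-distribʳ-* (D i) z)))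
    pq-diag : ∀ x d → pos⁺ x * d * neg⁺ x ≡ 0ℤ
    pq-diag (+ k) d = ℤP.*-zeroʳ (+ k * d)
    pq-diag -[1+ k ] d = trans (cong (_* + suc k) (ℤP.*-zeroˡ d)) refl
    pos⁺≥0 : ∀ x → 0ℤ ≤ pos⁺ x
    pos⁺≥0 (+ k) = +≤+ ℕ.z≤n
    pos⁺≥0 -[1+ k ] = +≤+ ℕ.z≤n
    neg⁺≥0 : ∀ x → 0ℤ ≤ neg⁺ x
    neg⁺≥0 (+ k) = +≤+ ℕ.z≤n
    neg⁺≥0 -[1+ k ] = +≤+ ℕ.z≤n
    term : ∀ j k → 0ℤ ≤ - (lookup p j * (D j * a j k) * lookup q k)
    term j k with j F.≟ k
    ... | yes refl = subst (0ℤ ≤_) (cong -_ (sym (trans (cong₂ (λ x y → x * (D j * a j j) * y) (VP.lookup-map j pos⁺ v) (VP.lookup-map j neg⁺ v)) (pq-diag (lookup v j) (D j * a j j))))) ℤP.≤-refl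
    ... | no ne = subst (0ℤ ≤_) (alg (lookup p j) (D j) (a j k) (lookup q k))
          (0≤-* (0≤-* (subst (0ℤ ≤_) (sym (VP.lookup-map j pos⁺ v)) (pos⁺≥0 (lookup v j))) (0≤-* (ℤP.<⇒≤ (D>0 j)) (≤0⇒0≤- (a-off j k ne))))
             (subst (0ℤ ≤_) (sym (VP.lookup-map k neg⁺ v)) (neg⁺≥0 (lookup v k))))
      where
      alg : ∀ x d a y → x * (d * - a) * y ≡ - (x * (d * a) * y)
      alg = solve-∀
    pq≤0 : ⟨ p , q ⟩ ≤ 0ℤ
    pq≤0 = 0≤-⇒≤0 (subst (0ℤ ≤_) (sumneg₂ (λ j k → lookup p j * (D j * a j k) * lookup q k)) (sumFin-nonneg λ j → sumFin-nonneg λ k → term j k))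
      where
      sumneg : ∀ {m} (g : Fin m → ℤ) → sumFin (λ j → - g j) ≡ - sumFin g
      sumneg g = trans (sumFin-cong (λ j → sym (ℤP.-1*i≡-i (g j)))) (trans (sumFin-* (- 1ℤ) g) (ℤP.-1*i≡-i (sumFin g)))
      sumneg₂ : (g : Fin n → Fin n → ℤ) → sumFin (λ j → sumFin (λ k → - g j k)) ≡ - sumFin (λ j → sumFin (g j))
      sumneg₂ g = trans (sumFin-cong (λ j → sumneg (g j))) (sumneg (λ j → sumFin (g j)))
    norm : ⟨ p , p ⟩ + ⟨ q , q ⟩ - + 2 * ⟨ p , q ⟩ ≡ + 2 * D i
    norm = trans (sym (form-⊖⊖ p q)) (trans (cong (λ z → ⟨ z , z ⟩) (sym v≡)) (root-norm {v} (w , i , refl)))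
    final : (⟨ p , p ⟩ - + 2 * D i) + (⟨ q , q ⟩ - + 2 * D i) + + 2 * - ⟨ p , q ⟩ ≡ - (+ 2 * D i)
    final = trans (alg ⟨ p , p ⟩ ⟨ q , q ⟩ ⟨ p , q ⟩ (+ 2 * D i)) (trans (cong (λ z → z - + 2 * D i - + 2 * D i) norm) (alg₂ (+ 2 * D i)))
      where
      alg : ∀ p q r d → (p - d) + (q - d) + + 2 * - r ≡ (p + q - + 2 * r) - d - d
      alg = solve-∀
      alg₂ : ∀ d → d - d - d ≡ - d
      alg₂ = solve-∀

  Pos∧Neg⇒⊥ : ∀ {v} → Root v → Pos v → Neg v → ⊥
  Pos∧Neg⇒⊥ r p q = root-≢0 r (Pos∧Neg⇒0 p q)

  ¬Pos⇒Neg : ∀ {v} → Root v → ¬ Pos v → Neg v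
  ¬Pos⇒Neg r np with coherent r
  ... | inj₁ p = ⊥-elim (np p)
  ... | inj₂ q = q

  Neg-of-neg : ∀ (v : Vec ℤ n) → Pos (neg v) → Neg v
  Neg-of-neg v p i = 0≤-⇒≤0 (subst (0ℤ ≤_) (lookup-neg v i) (p i))

  Pos-of-neg : ∀ (v : Vec ℤ n) → Neg (neg v) → Pos v
  Pos-of-neg v p = subst Pos (neg-neg v) (Neg-neg (neg v) p)

  -- s_j changes only the j-th coordinate, so all the others are both nonnegative and nonpositive
  -- and β = c α_j. The element of W that takes β back to its simple root exhibits c as a divisor of
  -- 1.
  Pos-flip : ∀ {β} j → Root β → Pos β → Neg (s j β) → β ≡ e j
  Pos-flip {β} j (w , i , eq) p q = trans β≡c (trans (cong (_• e j) c≡1) (vec-ext λ k → trans (lookup-• 1ℤ (e j) k) (ℤP.*-identityˡ (lookup (e j) k))))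
    where
    c = lookup β j
    β≡c : β ≡ c • e j
    β≡c = vec-ext λ k → trans (coord k) (sym (lookup-• c (e j) k))
      where
      coord : ∀ k → lookup β k ≡ c * lookup (e j) k
      coord k with j F.≟ k
      ... | yes refl = sym (trans (cong (c *_) (lookup-e-same j)) (ℤP.*-identityʳ c))
      ... | no ne = trans (ℤP.≤-antisym (subst (_≤ 0ℤ) (lookup-s-diff j β k ne) (q k)) (p k)) (sym (trans (cong (c *_) (lookup-e-diff ne)) (ℤP.*-zeroʳ c)))
    y = lookup (W (inv w) (e j)) i
    1≡ : c * y ≡ 1ℤ
    1≡ = trans (sym (lookup-• c (W (inv w) (e j)) i)) (trans (cong (λ z → lookup z i) (trans (sym (Lin.scl (W-lin (inv w)) c (e j)))
           (trans (cong (W (inv w)) (trans (sym β≡c) (sym eq))) (W-inv w (e i))))) (lookup-e-same i))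
    c≡1 : c ≡ 1ℤ
    c≡1 = unit c y (p j) 1≡
      where
      unit : ∀ c y → 0ℤ ≤ c → c * y ≡ 1ℤ → c ≡ 1ℤ
      unit (+ c) y _ h = cong +_ (ℕP.m*n≡1⇒m≡1 c ℤ.∣ y ∣ (trans (sym (ℤP.abs-* (+ c) y)) (cong ℤ.∣_∣ h)))

  -- As `u` is an isometry, α_i and α_j have the same length, so that not only the roots but also
  -- their coroots correspond.
  W-s-conj : ∀ u i j → W u (e i) ≡ e j → ∀ v → W u (s i v) ≡ s j (W u v)
  W-s-conj u i j eq v = trans (lin-⊖• (W-lin u) v (cor i v) (e i)) (cong₂ (λ x y → W u v ⊖ (x • y)) c≡ eq)
    where
    Di≡Dj : D i ≡ D j
    Di≡Dj = *-cancel {+ 2} (D i) (D j) (+<+ (ℕ.s≤s ℕ.z≤n)) (trans (sym (form-ee i)) (trans (sym (W-form u (e i) (e i))) (trans (cong (λ z → ⟨ z , z ⟩) eq) (form-ee j))))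
    c≡ : cor i v ≡ cor j (W u v)
    c≡ = *-cancel (cor i v) (cor j (W u v)) (D>0 i) (trans (sym (form-e i v)) (trans (sym (W-form u (e i) v))
           (trans (cong (λ z → ⟨ z , W u v ⟩) eq) (trans (form-e j (W u v)) (cong (_* cor j (W u v)) (sym Di≡Dj))))))

  -- The exchange condition. At some letter `j` the image of α_i passes from positive to negative;
  -- there it equals α_j, so s_i can be moved to the left up to this letter, which it cancels.
  exchange : ∀ w i → Neg (W w (e i)) → ∃ λ w' → length w ≡ suc (length w') × (∀ v → W w' v ≡ W w (s i v))
  exchange [] i q = ⊥-elim (Pos∧Neg⇒⊥ (root-e i) (Pos-e i) q)
  exchange (j ∷ u) i q with coherent (root-W u (root-e i))
  ... | inj₂ q' = let (u' , l , h) = exchange u i q' in j ∷ u' , cong suc l , λ v → cong (s j) (h v)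
  ... | inj₁ p = u , refl , λ v → sym (trans (cong (s j) (W-s-conj u i j (Pos-flip j (root-W u (root-e i)) p q) v)) (s-invol j (W u v)))

  private
    -- For w = u s_i, positivity of w(α_i) = - u(α_i) makes u(α_i) negative, and the exchange
    -- condition rewrites u s_i with two letters fewer than `w`.
    W-id-fuel : ∀ k w → length w ℕ.≤ k → (∀ i → Pos (W w (e i))) → ∀ v → W w v ≡ v
    W-id-fuel k w le h v with L.initLast w
    ... | [] = refl
    W-id-fuel zero .(u L.∷ʳ i) le h v | u L.∷ʳ′ i with () ← subst (ℕ._≤ 0) (trans (LP.length-++ u) (ℕP.+-comm (length u) 1)) le
    W-id-fuel (suc k) .(u L.∷ʳ i) le h v | u L.∷ʳ′ i with exchange u i neg-ui
      where
      neg-ui : Neg (W u (e i))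
      neg-ui = Neg-of-neg (W u (e i)) (subst Pos (trans (W-++ u (i ∷ []) (e i)) (trans (cong (W u) (s-e-self i)) (lin-neg (W-lin u) (e i)))) (h i))
    ... | u' , l , g = trans (sym (same v)) (W-id-fuel k u' le' (λ j → subst Pos (sym (same (e j))) (h j)) v)
      where
      same : ∀ x → W u' x ≡ W (u L.∷ʳ i) x
      same x = trans (g x) (sym (W-++ u (i ∷ []) x))
      le' : length u' ℕ.≤ k
      le' = ℕP.≤-pred (ℕP.≤-trans (ℕP.≤-reflexive (sym l)) (ℕP.≤-trans (ℕP.n≤1+n (length u)) (ℕP.≤-trans (ℕP.≤-reflexive (sym (trans (LP.length-++ u) (ℕP.+-comm (length u) 1)))) le)))

  W-id : ∀ w → (∀ i → Pos (W w (e i))) → ∀ v → W w v ≡ v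
  W-id w = W-id-fuel (length w) w ℕP.≤-refl

  -- Agreement on positive roots extends to negative ones by negation. Therefore u and w agree in
  -- sign on w⁻¹(α_i), so u w⁻¹ keeps every simple root positive and is the identity.
  W-determined : ∀ u w → (∀ γ → Root γ → Pos γ → (Pos (W u γ) → Pos (W w γ)) × (Pos (W w γ) → Pos (W u γ))) → ∀ v → W u v ≡ W w v
  W-determined u w h v = trans (cong (W u) (sym (W-inv w v))) (trans (sym (W-++ u (inv w) (W w v))) (W-id (u ++ inv w) pos (W w v)))
    where
    pos : ∀ i → Pos (W (u ++ inv w) (e i))
    pos i = subst Pos (sym (W-++ u (inv w) (e i))) (go (coherent rγ))
      where
      γ = W (inv w) (e i)
      rγ : Root γ
      rγ = root-W (inv w) (root-e i)
      wγ : W w γ ≡ e i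
      wγ = W-inv′ w (e i)
      go : Pos γ ⊎ Neg γ → Pos (W u γ)
      go (inj₁ p) = proj₂ (h γ rγ p) (subst Pos (sym wγ) (Pos-e i))
      go (inj₂ q) with coherent (root-W u rγ)
      ... | inj₁ p = p
      ... | inj₂ q' = ⊥-elim (Pos∧Neg⇒⊥ (root-e i) (Pos-e i) (Neg-of-neg (e i) (subst Pos (trans (lin-neg (W-lin w) γ) (cong neg wγ))
             (proj₁ (h (neg γ) (root-neg rγ) (Neg-neg γ q)) (subst Pos (sym (lin-neg (W-lin u) γ)) (Neg-neg (W u γ) q'))))))

  s-Pos : ∀ {β} j → Root β → Pos β → β ≢ e j → Pos (s j β)
  s-Pos j r p ne with coherent (root-W (j ∷ []) r)
  ... | inj₁ q = q
  ... | inj₂ q = ⊥-elim (ne (Pos-flip j r p q))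

  -- As (β,β) = Σ β_i (α_i,β) > 0, some simple root in the support of β has (α_i,β) > 0.
  nonsimple-⊖ : ∀ {β} → Root β → Pos β → (∀ i → β ≢ e i) → ∃ λ i → Root (β ⊖ e i) × Pos (β ⊖ e i)
  nonsimple-⊖ {β} r p ns with sumFin-pos-term (subst (0ℤ <_) (form-cor β β) (form-posdef β (root-≢0 r)))
  ... | i , pos = i , rr , pp
    where
    βi>0 : 0ℤ < lookup β i
    βi>0 with ℤP.≤∧≢⇒< (p i)
    ... | f with lookup β i ℤ.≟ 0ℤ
    ...   | no ne = f (λ z → ne (sym z))
    ...   | yes z = ⊥-elim (ℤP.<-irrefl refl (subst (0ℤ <_) (trans (cong (_* (D i * cor i β)) z) (ℤP.*-zeroˡ (D i * cor i β))) pos))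
    rr : Root (β ⊖ e i)
    rr = root-⊖ r (root-e i) (subst (0ℤ <_) (trans (sym (form-e i β)) (form-sym (e i) β)) (pos-cancelˡ βi>0 pos)) (ns i)
    pp : Pos (β ⊖ e i)
    pp with coherent rr
    ... | inj₁ q = q
    ... | inj₂ q = ⊥-elim (ns i (vec-ext eqv))
      where
      le : ∀ k → lookup β k - lookup (e i) k ≤ 0ℤ
      le k = subst (_≤ 0ℤ) (lookup-⊖ β (e i) k) (q k)
      eqv : ∀ k → lookup β k ≡ lookup (e i) k
      eqv k with i F.≟ k
      ... | yes refl = ℤP.≤-antisym (ℤP.i-j≤0⇒i≤j (le k)) (subst (_≤ lookup β i) (sym (lookup-e-same i)) (0<⇒1≤ βi>0))
      ... | no ne = ℤP.≤-antisym (ℤP.i-j≤0⇒i≤j (le k)) (subst (_≤ lookup β k) (sym (lookup-e-diff ne)) (p k))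

-- Conjugacy of all Coxeter elements on a tree.

iter : ∀ {A : Set} → ℕ → (A → A) → A → A
iter zero f x = x
iter (suc k) f x = f (iter k f x)

iter-cong : ∀ {A : Set} k {f g : A → A} → (∀ x → f x ≡ g x) → ∀ x → iter k f x ≡ iter k g x
iter-cong zero h x = refl
iter-cong (suc k) {f} {g} h x = trans (h (iter k f x)) (cong g (iter-cong k h x))

iter-slide : ∀ {A : Set} k (f g : A → A) x → g (iter k (λ y → f (g y)) x) ≡ iter k (λ y → g (f y)) (g x)
iter-slide zero f g x = refl
iter-slide (suc k) f g x = cong (λ y → g (f y)) (iter-slide k f g x)

unique-drop : ∀ {A : Set} (p : List A) {v q} → Unique (p ++ v ∷ q) → Unique (p ++ q)
unique-drop [] (_ ∷ u) = u
unique-drop (x ∷ p) (h ∷ u) = AllP.++⁺ (AllP.++⁻ˡ p h) (All.tail (AllP.++⁻ʳ p h)) ∷ unique-drop p u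

module CoxeterWords {n : ℕ} (C : CartanData n) (sc : IsSimpleCartan C) where
  open CartanData C
  open Roots C sc

  -- As a_vv = 2 is not zero, a vertex counts as its own neighbour when it occurs in the list. Hence
  -- a leaf is recognised by the bound 2 in lists containing it and by the bound 1 in the others.
  nbrs : Fin n → List (Fin n) → List (Fin n)
  nbrs v = filter (λ j → ¬? (a v j ℤ.≟ 0ℤ))

  Leaf : Fin n → List (Fin n) → Set
  Leaf v us = length (nbrs v us) ℕ.≤ 1

  Leaf-↭ : ∀ {v us ws} → us ↭ ws → Leaf v us → Leaf v ws
  Leaf-↭ {v} p = subst (ℕ._≤ 1) (PP.↭-length (PP.filter-↭ (λ j → ¬? (a v j ℤ.≟ 0ℤ)) p))

  data LeafOrder : List (Fin n) → Set where
    [] : LeafOrder []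
    _∷_ : ∀ {v us} → Leaf v us → LeafOrder us → LeafOrder (v ∷ us)

  -- Every set of vertices contains a leaf: if each of its vertices had two neighbours in it,
  -- then its indicator vector would have norm ≤ 0.

  asum : Fin n → List (Fin n) → ℤ
  asum v [] = 0ℤ
  asum v (x ∷ xs) = a v x + asum v xs

  asum≤-∉ : ∀ v xs → All (v ≢_) xs → asum v xs ≤ - (+ length (nbrs v xs))
  asum≤-∉ v [] _ = ℤP.≤-refl
  asum≤-∉ v (x ∷ xs) (ne All.∷ h) with a v x ℤ.≟ 0ℤ
  ... | yes z = subst (λ y → y + asum v xs ≤ - (+ length (nbrs v xs))) (sym z) (subst (_≤ - (+ length (nbrs v xs))) (sym (ℤP.+-identityˡ (asum v xs))) (asum≤-∉ v xs h))
  ... | no nz = subst (a v x + asum v xs ≤_) (sym (ℤP.neg-distrib-+ 1ℤ (+ length (nbrs v xs)))) (ℤP.+-mono-≤ (≤0∧≢0⇒≤-1 (a v x) (a-off v x ne) nz) (asum≤-∉ v xs h))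

  -- The constant is 2 for the diagonal entry plus 1 because `v` is counted in `nbrs v xs`; every
  -- true neighbour contributes at most -1.
  asum≤-∈ : ∀ v xs → Unique xs → v ∈ xs → asum v xs ≤ + 3 - (+ length (nbrs v xs))
  asum≤-∈ v (x ∷ xs) (h ∷ u) (here refl) with a v v ℤ.≟ 0ℤ
  ... | yes z with () ← trans (sym z) (a-diag v)
  ... | no nz = subst₂ _≤_ (cong (_+ asum v xs) (sym (a-diag v))) (alg (+ length (nbrs v xs))) (ℤP.+-monoʳ-≤ (+ 2) (asum≤-∉ v xs h))
    where
    alg : ∀ k → + 2 + - k ≡ + 3 - (1ℤ + k)
    alg = solve-∀
  asum≤-∈ v (x ∷ xs) (h ∷ u) (there m) with a v x ℤ.≟ 0ℤ
  ... | yes z = subst (λ y → y + asum v xs ≤ + 3 - (+ length (nbrs v xs))) (sym z) (subst (_≤ + 3 - (+ length (nbrs v xs))) (sym (ℤP.+-identityˡ (asum v xs))) (asum≤-∈ v xs u m))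
  ... | no nz = subst (a v x + asum v xs ≤_) (alg (+ length (nbrs v xs))) (ℤP.+-mono-≤ (≤0∧≢0⇒≤-1 (a v x) (a-off v x (λ q → All.lookup h m (sym q))) nz) (asum≤-∈ v xs u m))
    where
    alg : ∀ k → - 1ℤ + (+ 3 - k) ≡ + 3 - (1ℤ + k)
    alg = solve-∀

  indicator : List (Fin n) → Vec ℤ n
  indicator [] = zeroV
  indicator (x ∷ xs) = e x ⊕ indicator xs

  Pos-indicator : ∀ xs → Pos (indicator xs)
  Pos-indicator [] i = ℤP.≤-reflexive (sym (lookup-0 i))
  Pos-indicator (x ∷ xs) = Pos-⊕ (e x) (indicator xs) (Pos-e x) (Pos-indicator xs)

  indicator≢0 : ∀ x xs → indicator (x ∷ xs) ≢ zeroV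
  indicator≢0 x xs p = <⇒≱ (+<+ (ℕ.s≤s ℕ.z≤n)) (subst (1ℤ ≤_) (trans (sym (lookup-⊕ (e x) (indicator xs) x)) (trans (cong (λ z → lookup z x) p) (lookup-0 x)))
    (subst (λ z → 1ℤ ≤ z + lookup (indicator xs) x) (sym (lookup-e-same x)) (ℤP.+-monoʳ-≤ 1ℤ (Pos-indicator xs x))))

  cor-indicator : ∀ v xs → cor v (indicator xs) ≡ asum v xs
  cor-indicator v [] = linFun-0 (cor-lin v)
  cor-indicator v (x ∷ xs) = trans (LinFun.add (cor-lin v) (e x) (indicator xs)) (cong₂ _+_ (cor-e v x) (cor-indicator v xs))

  form-indicator≤0 : ∀ ys x → (∀ v → v ∈ ys → cor v x ≤ 0ℤ) → ⟨ indicator ys , x ⟩ ≤ 0ℤ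
  form-indicator≤0 [] x h = ℤP.≤-reflexive (linFun-0 (form-linˡ x))
  form-indicator≤0 (y ∷ ys) x h = subst (_≤ 0ℤ) (sym (trans (LinFun.add (form-linˡ x) (e y) (indicator ys)) (cong (_+ ⟨ indicator ys , x ⟩) (form-e y x))))
    (ℤP.+-mono-≤ {D y * cor y x} {0ℤ} {⟨ indicator ys , x ⟩} {0ℤ}
      (0≤-⇒≤0 (subst (0ℤ ≤_) (sym (ℤP.neg-distribʳ-* (D y) (cor y x))) (0≤-* (ℤP.<⇒≤ (D>0 y)) (≤0⇒0≤- (h y (here refl))))))
      (form-indicator≤0 ys x (λ v m → h v (there m))))

  ∃leaf : ∀ x xs → Unique (x ∷ xs) → ∃ λ v → v ∈ (x ∷ xs) × length (nbrs v (x ∷ xs)) ℕ.≤ 2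
  ∃leaf x xs u with Any.any? (λ v → length (nbrs v (x ∷ xs)) ℕ.≤? 2) (x ∷ xs)
  ... | yes p = let (v , m , q) = find p in v , m , q
  ... | no np = ⊥-elim (indicator≢0 x xs (form-nonneg-zero _ (form-indicator≤0 (x ∷ xs) (indicator (x ∷ xs)) λ v m →
      subst (_≤ 0ℤ) (sym (cor-indicator v (x ∷ xs))) (ℤP.≤-trans (asum≤-∈ v (x ∷ xs) u m)
        (ℤP.i≤j⇒i-j≤0 (+≤+ (ℕP.≰⇒> (λ q → np (lose m q)))))))))

  private
    leafOrder-fuel : ∀ k xs → length xs ≡ k → Unique xs → ∃ λ ys → LeafOrder ys × xs ↭ ys
    leafOrder-fuel zero [] _ _ = [] , [] , ↭-refl
    leafOrder-fuel (suc k) (x ∷ xs) l u with ∃leaf x xs u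
    ... | v , m , le with ∈P.∈-∃++ m
    ...   | p , q , eq with leafOrder-fuel k (p ++ q) len (unique-drop p (subst Unique eq u))
      where
      len : length (p ++ q) ≡ k
      len = ℕP.suc-injective (trans (sym (PP.↭-length (PP.shift v p q))) (trans (cong length (sym eq)) l))
    ...     | ys , lo , perm = v ∷ ys , leaf ∷ lo , ↭-trans (subst (_↭ v ∷ p ++ q) (sym eq) (PP.shift v p q)) (prep v perm)
      where
      leaf' : length (nbrs v (v ∷ p ++ q)) ℕ.≤ 2
      leaf' = subst (ℕ._≤ 2) (PP.↭-length (PP.filter-↭ (λ j → ¬? (a v j ℤ.≟ 0ℤ)) (subst (_↭ v ∷ p ++ q) (sym eq) (PP.shift v p q)))) le
      leaf : Leaf v ys
      leaf = Leaf-↭ perm (ℕP.≤-pred (subst (ℕ._≤ 2) (cong length (LP.filter-accept (λ j → ¬? (a v j ℤ.≟ 0ℤ)) {v} {p ++ q} av≢0)) leaf'))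
        where
        av≢0 : a v v ≢ 0ℤ
        av≢0 z with () ← trans (sym z) (a-diag v)

  leafOrder : ∀ xs → Unique xs → ∃ λ ys → LeafOrder ys × xs ↭ ys
  leafOrder xs = leafOrder-fuel (length xs) xs refl

  -- Commutations of orthogonal letters and rotations; on a forest they relate all orderings of
  -- the vertices, since a leaf can be moved past its only neighbour by going round the circle.

  data _~_ : List (Fin n) → List (Fin n) → Set where
    refl~ : ∀ {u} → u ~ u
    sym~ : ∀ {u w} → u ~ w → w ~ u
    trans~ : ∀ {u w x} → u ~ w → w ~ x → u ~ x
    swap~ : ∀ p {i j} q → a i j ≡ 0ℤ → (p ++ i ∷ j ∷ q) ~ (p ++ j ∷ i ∷ q)
    rot~ : ∀ i w → (i ∷ w) ~ (w ++ i ∷ [])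

  ~⇒↭ : ∀ {u w} → u ~ w → u ↭ w
  ~⇒↭ refl~ = ↭-refl
  ~⇒↭ (sym~ r) = ↭-sym (~⇒↭ r)
  ~⇒↭ (trans~ r t) = ↭-trans (~⇒↭ r) (~⇒↭ t)
  ~⇒↭ (swap~ p {i} {j} q _) = PP.++⁺ˡ p (swap i j ↭-refl)
  ~⇒↭ (rot~ i w) = PP.++-comm (i ∷ []) w

  ≡⇒~ : ∀ {u w} → u ≡ w → u ~ w
  ≡⇒~ refl = refl~

  slide : ∀ r p {v} q → All (λ x → a v x ≡ 0ℤ) p → (r ++ p ++ v ∷ q) ~ (r ++ v ∷ p ++ q)
  slide r [] q _ = refl~
  slide r (x ∷ p) {v} q (z All.∷ h) = trans~ (≡⇒~ (sym (LP.++-assoc r (x ∷ []) (p ++ v ∷ q))))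
    (trans~ (slide (r ++ x ∷ []) p q h) (trans~ (≡⇒~ (LP.++-assoc r (x ∷ []) (v ∷ p ++ q))) (swap~ r (p ++ q) (a-zero-sym v x z))))

  no-nbrs : ∀ v xs → length (nbrs v xs) ≡ 0 → All (λ x → a v x ≡ 0ℤ) xs
  no-nbrs v [] _ = All.[]
  no-nbrs v (x ∷ xs) h with a v x ℤ.≟ 0ℤ
  ... | yes z = z All.∷ no-nbrs v xs h
  no-nbrs v (x ∷ xs) () | no _

  -- If `p` contains no neighbour of `v`, then `v` commutes to the front. Otherwise the only
  -- neighbour is in `p`, so `v` commutes with `q` to the end, and a rotation carries it to the
  -- front.
  moveFront : ∀ p {v} q → Leaf v (p ++ q) → (p ++ v ∷ q) ~ (v ∷ p ++ q)
  moveFront p {v} q leaf with length (nbrs v p) in eq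
  ... | zero = slide [] p q (no-nbrs v p eq)
  ... | suc k = trans~ (≡⇒~ (cong (λ z → p ++ v ∷ z) (sym (LP.++-identityʳ q))))
        (trans~ (sym~ (slide p q [] (no-nbrs v q (ℕP.n≤0⇒n≡0 (ℕP.≤-pred (ℕP.≤-trans le leaf'))))))
        (trans~ (≡⇒~ (sym (LP.++-assoc p q (v ∷ [])))) (sym~ (rot~ v (p ++ q)))))
    where
    leaf' : length (nbrs v p) ℕ.+ length (nbrs v q) ℕ.≤ 1
    leaf' = subst (ℕ._≤ 1) (trans (cong length (LP.filter-++ (λ j → ¬? (a v j ℤ.≟ 0ℤ)) p q)) (LP.length-++ (nbrs v p))) leaf
    le : suc (length (nbrs v q)) ℕ.≤ length (nbrs v p) ℕ.+ length (nbrs v q)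
    le = subst (λ z → suc (length (nbrs v q)) ℕ.≤ z ℕ.+ length (nbrs v q)) (sym eq) (ℕ.s≤s (ℕP.m≤n+m (length (nbrs v q)) k))

  -- The only case with content is a rotation of the tail: rotating `v` and `i` to the end leaves
  -- `v` between `w` and `i`, and the leaf property brings it back to the front.
  cons~ : ∀ {v us ws} → Leaf v us → us ~ ws → (v ∷ us) ~ (v ∷ ws)
  cons~ l refl~ = refl~
  cons~ l (sym~ r) = sym~ (cons~ (Leaf-↭ (↭-sym (~⇒↭ r)) l) r)
  cons~ l (trans~ r t) = trans~ (cons~ l r) (cons~ (Leaf-↭ (~⇒↭ r) l) t)
  cons~ {v} l (swap~ p q z) = swap~ (v ∷ p) q z
  cons~ {v} l (rot~ i w) = trans~ (rot~ v (i ∷ w)) (trans~ (rot~ i (w ++ v ∷ []))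
    (trans~ (≡⇒~ (LP.++-assoc w (v ∷ []) (i ∷ []))) (moveFront w (i ∷ []) (Leaf-↭ (~⇒↭ (rot~ i w)) l))))

  orderings~ : ∀ {xs} → LeafOrder xs → ∀ ys → ys ↭ xs → ys ~ xs
  orderings~ [] ys p = ≡⇒~ (PP.↭-empty-inv p)
  orderings~ {v ∷ us} (l ∷ lo) ys p with ∈P.∈-∃++ (PP.∈-resp-↭ (↭-sym p) (here refl))
  ... | h , t , refl = trans~ (moveFront h t l') (cons~ l' (orderings~ lo (h ++ t) p'))
    where
    p' : h ++ t ↭ us
    p' = PP.drop-mid h [] p
    l' : Leaf v (h ++ t)
    l' = Leaf-↭ (↭-sym p') l

  PowId : ℕ → List (Fin n) → Set
  PowId k w = ∀ v → iter k (W w) v ≡ v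

  -- A commutation leaves the group element unchanged and a rotation conjugates it, so the exponents
  -- that kill it are the same.
  PowId-~ : ∀ {u w} k → u ~ w → (PowId k u → PowId k w) × (PowId k w → PowId k u)
  PowId-~ k refl~ = (λ h → h) , (λ h → h)
  PowId-~ k (sym~ r) = proj₂ (PowId-~ k r) , proj₁ (PowId-~ k r)
  PowId-~ k (trans~ r t) = (λ h → proj₁ (PowId-~ k t) (proj₁ (PowId-~ k r) h)) , (λ h → proj₂ (PowId-~ k r) (proj₂ (PowId-~ k t) h))
  PowId-~ k (swap~ p {i} {j} q z) = (λ h v → trans (sym (iter-cong k same v)) (h v)) , (λ h v → trans (iter-cong k same v) (h v))
    where
    s-comm : ∀ v → s i (s j v) ≡ s j (s i v)
    s-comm v = vec-ext λ x → trans (coords i j v x z) (sym (trans (coords j i v x (a-zero-sym i j z)) (alg (lookup v x) (cor j v) (cor i v) (lookup (e j) x) (lookup (e i) x))))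
      where
      coords : ∀ i j v x → a i j ≡ 0ℤ → lookup (s i (s j v)) x ≡ lookup v x - cor j v * lookup (e j) x - cor i v * lookup (e i) x
      coords i j v x z = trans (lookup-⊕• (s j v) (cor i (s j v)) (e i) x) (cong₂ (λ y w → y - w * lookup (e i) x) (lookup-⊕• v (cor j v) (e j) x)
        (trans (cor-s i j v) (trans (cong (λ y → cor i v - cor j v * y) z) (alg₀ (cor i v) (cor j v)))))
        where
        alg₀ : ∀ x y → x - y * 0ℤ ≡ x
        alg₀ = solve-∀
      alg : ∀ v cj ci ej ei → v - ci * ei - cj * ej ≡ v - cj * ej - ci * ei
      alg = solve-∀
    same : ∀ v → W (p ++ i ∷ j ∷ q) v ≡ W (p ++ j ∷ i ∷ q) v
    same v = trans (W-++ p (i ∷ j ∷ q) v) (trans (cong (W p) (s-comm (W q v))) (sym (W-++ p (j ∷ i ∷ q) v)))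
  PowId-~ k (rot~ i w) =
    (λ h v → trans (iter-cong k (λ y → W-++ w (i ∷ []) y) v) (W-inj (i ∷ []) (trans (iter-slide k (W w) (s i) v) (h (s i v))))) ,
    (λ h v → W-inj w (trans (iter-slide k (s i) (W w) v) (trans (sym (iter-cong k (λ y → W-++ w (i ∷ []) y) (W w v))) (h (W w v)))))

  iter-lin : ∀ k {T : Vec ℤ n → Vec ℤ n} → Lin T → Lin (iter k T)
  iter-lin zero l .Lin.add u v = refl
  iter-lin zero l .Lin.scl c v = refl
  iter-lin (suc k) {T} l .Lin.add u v = trans (cong T (Lin.add (iter-lin k l) u v)) (Lin.add l (iter k T u) (iter k T v))
  iter-lin (suc k) {T} l .Lin.scl c v = trans (cong T (Lin.scl (iter-lin k l) c v)) (Lin.scl l c (iter k T v))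

  id-lin : Lin {n} (λ v → v)
  id-lin .Lin.add u v = refl
  id-lin .Lin.scl c v = refl

  app-matOf : ∀ w v → app (matOf C w) v ≡ W w v
  app-matOf w v = app-tabulate (W-lin w) v

  coxPow-iter : ∀ k → coxPow C k ≡ tabulate (λ i → iter k (W (allFin n)) (e i))
  coxPow-iter zero = refl
  coxPow-iter (suc k) = VP.tabulate-cong λ i → trans (app-matOf (allFin n) (lookup (coxPow C k) i))
    (cong (W (allFin n)) (trans (cong (λ z → lookup z i) (coxPow-iter k)) (VP.lookup∘tabulate _ i)))

  coxPow⇒PowId : ∀ k → coxPow C k ≡ idMat → PowId k (allFin n)
  coxPow⇒PowId k h = lin-ext (iter-lin k (W-lin (allFin n))) id-lin λ i →
    trans (sym (VP.lookup∘tabulate (λ i → iter k (W (allFin n)) (e i)) i)) (trans (cong (λ z → lookup z i) (trans (sym (coxPow-iter k)) h)) (VP.lookup∘tabulate e i))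

  PowId⇒coxPow : ∀ k → PowId k (allFin n) → coxPow C k ≡ idMat
  PowId⇒coxPow k h = trans (coxPow-iter k) (VP.tabulate-cong λ i → h (e i))

  Proper : List (Fin n) → (Fin n → Bool) → Set
  Proper xs col = ∀ i j → i ∈ xs → j ∈ xs → i ≢ j → a i j ≢ 0ℤ → col i ≡ not (col j)

  -- A leaf receives the colour opposite to that of its only neighbour among the vertices already
  -- coloured.
  colouring : ∀ {xs} → LeafOrder xs → ∃ (Proper xs)
  colouring [] = (λ _ → true) , λ i j ()
  colouring {v ∷ us} (l ∷ lo) with colouring lo
  ... | col' , pr = col , proper
    where
    c : List (Fin n) → Bool
    -- A vertex without neighbours among those already coloured may take either colour.
    c [] = true
    c (u ∷ _) = not (col' u)
    col : Fin n → Bool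
    col x with x F.≟ v
    ... | yes _ = c (nbrs v us)
    ... | no _ = col' x
    sel : ∀ xs {j} → length xs ℕ.≤ 1 → j ∈ xs → c xs ≡ not (col' j)
    sel (x ∷ []) _ (here refl) = refl
    sel (x ∷ []) _ (there ())
    sel (x ∷ y ∷ xs) (ℕ.s≤s ()) _
    tl : ∀ {x} → x ∈ v ∷ us → x ≢ v → x ∈ us
    tl (here p) q = ⊥-elim (q p)
    tl (there m) q = m
    proper : Proper (v ∷ us) col
    proper i j mi mj ne nz with i F.≟ v | j F.≟ v
    ... | yes refl | yes refl = ⊥-elim (ne refl)
    ... | yes refl | no q = sel (nbrs v us) l (∈P.∈-filter⁺ (λ j → ¬? (a v j ℤ.≟ 0ℤ)) (tl mj q) nz)
    ... | no q | yes refl = sym (trans (cong not (sel (nbrs v us) l (∈P.∈-filter⁺ (λ j → ¬? (a v j ℤ.≟ 0ℤ)) (tl mi q) (λ z → nz (a-zero-sym v i z))))) (BP.not-involutive (col' i)))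
    ... | no q | no q' = pr i j (tl mi q) (tl mj q') ne nz

-- The bipartite Coxeter element and the alternating products of its two factors.

flip : ℕ → Bool → Bool
flip zero b = b
flip (suc m) b = not (flip m b)

flip-not : ∀ m b → flip m (not b) ≡ not (flip m b)
flip-not zero b = refl
flip-not (suc m) b = cong not (flip-not m b)

flip-flip : ∀ m b → flip m (flip m b) ≡ b
flip-flip zero b = refl
flip-flip (suc m) b = trans (cong not (flip-not m (flip m b))) (trans (BP.not-involutive (flip m (flip m b))) (flip-flip m b))

flip-+ : ∀ k m b → flip (k ℕ.+ m) b ≡ flip k (flip m b)
flip-+ zero m b = refl
flip-+ (suc k) m b = cong not (flip-+ k m b)

flip-double : ∀ k b → flip (k ℕ.* 2) b ≡ b
flip-double zero b = refl
flip-double (suc k) b = trans (BP.not-involutive (flip (k ℕ.* 2) b)) (flip-double k b)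

colour-split : ∀ {A : Set} (col : A → Bool) xs → filter (λ i → col i BP.≟ false) xs ++ filter (λ i → col i BP.≟ true) xs ↭ xs
colour-split col [] = ↭-refl
colour-split col (x ∷ xs) with col x
... | false = prep x (colour-split col xs)
... | true = ↭-trans (PP.shift x (filter (λ i → col i BP.≟ false) xs) (filter (λ i → col i BP.≟ true) xs)) (prep x (colour-split col xs))

module _ {n : ℕ} where
  vsum : (Fin n → ℤ) → (Fin n → Vec ℤ n) → Vec ℤ n
  vsum c g = tabulate λ k → sumFin λ i → c i * lookup (g i) k

  lookup-vsum : ∀ c g k → lookup (vsum c g) k ≡ sumFin (λ i → c i * lookup (g i) k)
  lookup-vsum c g k = VP.lookup∘tabulate _ k

  linFun-vsum : ∀ {f : Vec ℤ n → ℤ} → LinFun f → ∀ c g → f (vsum c g) ≡ sumFin (λ i → c i * f (g i))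
  linFun-vsum {f} l c g = begin
    f (vsum c g) ≡⟨ linFun-expand l (vsum c g) ⟩
    sumFin (λ k → lookup (vsum c g) k * f (e k)) ≡⟨ sumFin-cong (λ k → trans (cong (_* f (e k)) (lookup-vsum c g k)) (trans (ℤP.*-comm (sumFin (λ i → c i * lookup (g i) k)) (f (e k)))
         (trans (sym (sumFin-* (f (e k)) (λ i → c i * lookup (g i) k))) (sumFin-cong (λ i → alg (f (e k)) (c i) (lookup (g i) k)))))) ⟩
    sumFin (λ k → sumFin (λ i → c i * (lookup (g i) k * f (e k)))) ≡⟨ sumFin-swap (λ k i → c i * (lookup (g i) k * f (e k))) ⟩
    sumFin (λ i → sumFin (λ k → c i * (lookup (g i) k * f (e k)))) ≡⟨ sumFin-cong (λ i → trans (sumFin-* (c i) (λ k → lookup (g i) k * f (e k))) (cong (c i *_) (sym (linFun-expand l (g i))))) ⟩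
    sumFin (λ i → c i * f (g i)) ∎
    where
    open ≡-Reasoning
    alg : ∀ f c x → f * (c * x) ≡ c * (x * f)
    alg = solve-∀

  lin-vsum : ∀ {T : Vec ℤ n → Vec ℤ n} → Lin T → ∀ c g → T (vsum c g) ≡ vsum c (λ i → T (g i))
  lin-vsum {T} l c g = vec-ext λ k → trans (linFun-vsum (lookup-LinFun l k) c g) (sym (lookup-vsum c (λ i → T (g i)) k))

  sumFin-single : ∀ (i : Fin n) g → (∀ j → j ≢ i → g j ≡ 0ℤ) → sumFin g ≡ g i
  sumFin-single i g h = trans (sumFin-cong pt) (sumFin-e i g)
    where
    pt : ∀ j → g j ≡ lookup (e i) j * g j
    pt j with i F.≟ j
    ... | yes refl = sym (trans (cong (_* g j) (lookup-e-same i)) (ℤP.*-identityˡ (g j)))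
    ... | no ne = trans (h j (λ p → ne (sym p))) (sym (trans (cong (_* g j) (lookup-e-diff ne)) (ℤP.*-zeroˡ (g j))))

  ⊕-comm : ∀ (u v : Vec ℤ n) → u ⊕ v ≡ v ⊕ u
  ⊕-comm u v = vec-ext λ k → trans (lookup-⊕ u v k) (trans (ℤP.+-comm (lookup u k) (lookup v k)) (sym (lookup-⊕ v u k)))

module Bipartite {n : ℕ} (C : CartanData n) (sc : IsSimpleCartan C) (col : Fin n → Bool)
  (proper : ∀ (i j : Fin n) → i ≢ j → CartanData.a C i j ≢ 0ℤ → col i ≡ not (col j)) where
  open CartanData C
  open Roots C sc
  open CoxeterWords C sc

  same-colour : ∀ i j → i ≢ j → col i ≡ col j → a i j ≡ 0ℤ
  same-colour i j ne p with a i j ℤ.≟ 0ℤ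
  ... | yes z = z
  ... | no nz = ⊥-elim (BP.not-¬ p (proper i j ne nz))

  Orth : List (Fin n) → Set
  Orth xs = ∀ {i j} → i ∈ xs → j ∈ xs → i ≢ j → a i j ≡ 0ℤ

  W-∉ : ∀ xs v i → i ∉ xs → lookup (W xs v) i ≡ lookup v i
  W-∉ [] v i m = refl
  W-∉ (x ∷ xs) v i m = trans (lookup-s-diff x (W xs v) i (λ p → m (here (sym p)))) (W-∉ xs v i (λ q → m (there q)))

  cor-W-orth : ∀ i xs v → (∀ {j} → j ∈ xs → a i j ≡ 0ℤ) → cor i (W xs v) ≡ cor i v
  cor-W-orth i [] v h = refl
  cor-W-orth i (x ∷ xs) v h = trans (cor-s i x (W xs v)) (trans (cong (λ z → cor i (W xs v) - cor x (W xs v) * z) (h (here refl)))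
    (trans (alg (cor i (W xs v)) (cor x (W xs v))) (cor-W-orth i xs v (λ m → h (there m)))))
    where
    alg : ∀ x y → x - y * 0ℤ ≡ x
    alg = solve-∀

  W-∈ : ∀ xs v i → Unique xs → Orth xs → i ∈ xs → lookup (W xs v) i ≡ lookup v i - cor i v
  W-∈ (x ∷ xs) v i (h ∷ u) o (here refl) = trans (lookup-s-same i (W xs v)) (cong₂ _-_ (W-∉ xs v i (λ m → All.lookup h m refl))
    (cor-W-orth i xs v (λ m → o (here refl) (there m) (All.lookup h m))))
  W-∈ (x ∷ xs) v i (h ∷ u) o (there m) = trans (lookup-s-diff x (W xs v) i (All.lookup h m)) (W-∈ xs v i u (λ p q → o (there p) (there q)) m)

  cor-W-∈ : ∀ xs v i → Unique xs → Orth xs → i ∈ xs → cor i (W xs v) ≡ - cor i v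
  cor-W-∈ (x ∷ xs) v i (h ∷ u) o (here refl) = trans (cor-s-self i (W xs v)) (cong -_ (cor-W-orth i xs v (λ m → o (here refl) (there m) (All.lookup h m))))
  cor-W-∈ (x ∷ xs) v i (h ∷ u) o (there m) = trans (cor-s i x (W xs v)) (trans (cong (λ z → cor i (W xs v) - cor x (W xs v) * z) (o (there m) (here refl) (λ p → All.lookup h m (sym p))))
    (trans (alg (cor i (W xs v)) (cor x (W xs v))) (cor-W-∈ xs v i u (λ p q → o (there p) (there q)) m)))
    where
    alg : ∀ x y → x - y * 0ℤ ≡ x
    alg = solve-∀

  letters : Bool → List (Fin n)
  letters b = filter (λ i → col i BP.≟ b) (allFin n)

  letters-col : ∀ {b i} → i ∈ letters b → col i ≡ b
  letters-col {b} m = proj₂ (∈P.∈-filter⁻ (λ i → col i BP.≟ b) {xs = allFin n} m)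

  ∈letters : ∀ {b i} → col i ≡ b → i ∈ letters b
  ∈letters {b} {i} p = ∈P.∈-filter⁺ (λ i → col i BP.≟ b) (∈P.∈-allFin i) p

  letters-unique : ∀ b → Unique (letters b)
  letters-unique b = UP.filter⁺ (λ i → col i BP.≟ b) (UP.allFin⁺ n)

  letters-orth : ∀ b → Orth (letters b)
  letters-orth b {i} {j} p q ne = same-colour i j ne (trans (letters-col p) (sym (letters-col q)))

  S : Bool → Vec ℤ n → Vec ℤ n
  S b = W (letters b)

  S-in : ∀ b v i → col i ≡ b → lookup (S b v) i ≡ lookup v i - cor i v
  S-in b v i p = W-∈ (letters b) v i (letters-unique b) (letters-orth b) (∈letters p)

  S-out : ∀ b v i → col i ≢ b → lookup (S b v) i ≡ lookup v i
  S-out b v i p = W-∉ (letters b) v i (λ m → p (letters-col m))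

  S-invol : ∀ b v → S b (S b v) ≡ v
  S-invol b v = vec-ext coord
    where
    alg : ∀ x c → x - c - - c ≡ x
    alg = solve-∀
    coord : ∀ i → lookup (S b (S b v)) i ≡ lookup v i
    coord i with col i BP.≟ b
    ... | yes p = trans (S-in b (S b v) i p) (trans (cong₂ _-_ (S-in b v i p) (cor-W-∈ (letters b) v i (letters-unique b) (letters-orth b) (∈letters p))) (alg (lookup v i) (cor i v)))
    ... | no p = trans (S-out b (S b v) i p) (S-out b v i p)

  Supp : Bool → Vec ℤ n → Set
  Supp b v = ∀ i → col i ≢ b → lookup v i ≡ 0ℤ

  cor-supp : ∀ {b v} → Supp b v → ∀ i → col i ≡ b → cor i v ≡ + 2 * lookup v i
  cor-supp {b} {v} h i p = trans (sumFin-single i (λ j → a i j * lookup v j) other) (cong (_* lookup v i) (a-diag i))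
    where
    other : ∀ j → j ≢ i → a i j * lookup v j ≡ 0ℤ
    other j ne with col j BP.≟ b
    ... | yes q = trans (cong (_* lookup v j) (same-colour i j (λ x → ne (sym x)) (trans p (sym q)))) (ℤP.*-zeroˡ (lookup v j))
    ... | no q = trans (cong (a i j *_) (h j q)) (ℤP.*-zeroʳ (a i j))

  S-supp : ∀ {b v} → Supp b v → S b v ≡ neg v
  S-supp {b} {v} h = vec-ext coord
    where
    alg : ∀ x → x - + 2 * x ≡ - x
    alg = solve-∀
    coord : ∀ i → lookup (S b v) i ≡ lookup (neg v) i
    coord i with col i BP.≟ b
    ... | yes p = trans (S-in b v i p) (trans (cong (_-_ (lookup v i)) (cor-supp {b} {v} h i p)) (trans (alg (lookup v i)) (sym (lookup-neg v i))))
    ... | no p = trans (S-out b v i p) (trans (h i p) (sym (trans (lookup-neg v i) (cong -_ (h i p)))))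

  Supp-e : ∀ {b} j → col j ≡ b → Supp b (e j)
  Supp-e j p i q = lookup-e-diff (λ r → q (trans (cong col (sym r)) p))

  -- The reflections S true and S false applied m times alternately, S b being applied first.

  altWord : Bool → ℕ → List (Fin n)
  altWord b zero = []
  altWord b (suc m) = letters (flip m b) ++ altWord b m

  alt : Bool → ℕ → Vec ℤ n → Vec ℤ n
  alt b m = W (altWord b m)

  alt-suc : ∀ b m v → alt b (suc m) v ≡ S (flip m b) (alt b m v)
  alt-suc b m v = W-++ (letters (flip m b)) (altWord b m) v

  alt-lin : ∀ b m → Lin (alt b m)
  alt-lin b m = W-lin (altWord b m)

  alt-shift : ∀ b m v → alt b (suc m) v ≡ alt (not b) m (S b v)
  alt-shift b zero v = alt-suc b 0 v
  alt-shift b (suc m) v = trans (alt-suc b (suc m) v) (trans (cong₂ S (sym (flip-not m b)) (alt-shift b m v)) (sym (alt-suc (not b) m (S b v))))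

  alt-+ : ∀ b k m v → alt b (k ℕ.+ m) v ≡ alt (flip m b) k (alt b m v)
  alt-+ b zero m v = refl
  alt-+ b (suc k) m v = trans (alt-suc b (k ℕ.+ m) v) (trans (cong₂ S (flip-+ k m b) (alt-+ b k m v)) (sym (alt-suc (flip m b) k (alt b m v))))

  alt-inverse : ∀ b m v → alt (flip m b) (suc m) (alt b (suc m) v) ≡ v
  alt-inverse b m v = trans (cong (alt (flip m b) (suc m)) (alt-suc b m v)) (trans (alt-shift (flip m b) m (S (flip m b) (alt b m v)))
    (trans (cong (alt (not (flip m b)) m) (S-invol (flip m b) (alt b m v))) (rest m)))
    where
    rest : ∀ m → alt (not (flip m b)) m (alt b m v) ≡ v
    rest zero = refl
    rest (suc m) = trans (cong (λ c → alt c (suc m) (alt b (suc m) v)) (BP.not-involutive (flip m b))) (alt-inverse b m v)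

  -- The alternation starts with the colour opposite to that of `j`, since the product of its own
  -- colour merely negates α_j. The vectors with a fixed `m` form one layer of the enumeration of
  -- roots.
  f : ℕ → Fin n → Vec ℤ n
  f m j = alt (not (col j)) m (e j)

  f-root : ∀ m j → Root (f m j)
  f-root m j = root-W (altWord (not (col j)) m) (root-e j)

  f-suc : ∀ m j → f (suc m) j ≡ S (flip (suc m) (col j)) (f m j)
  f-suc m j = trans (alt-suc (not (col j)) m (e j)) (cong (λ b → S b (f m j)) (flip-not m (col j)))

  alt-own : ∀ m j → alt (col j) (suc m) (e j) ≡ neg (f m j)
  alt-own m j = trans (alt-shift (col j) m (e j)) (trans (cong (alt (not (col j)) m) (S-supp (Supp-e j refl))) (lin-neg (alt-lin (not (col j)) m) (e j)))

  adj : Fin n → Fin n → ℤ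
  adj i j with i F.≟ j
  ... | yes _ = 0ℤ
  ... | no _ = - a i j

  adj-nonneg : ∀ i j → 0ℤ ≤ adj i j
  adj-nonneg i j with i F.≟ j
  ... | yes _ = ℤP.≤-refl
  ... | no ne = ≤0⇒0≤- (a-off i j ne)

  adj-zero-or-opposite : ∀ i j → adj i j ≡ 0ℤ ⊎ col i ≡ not (col j)
  adj-zero-or-opposite i j with i F.≟ j
  ... | yes _ = inj₁ refl
  ... | no ne with a i j ℤ.≟ 0ℤ
  ...   | yes z = inj₁ (cong -_ z)
  ...   | no nz = inj₂ (proper i j ne nz)

  SS : Vec ℤ n → Vec ℤ n
  SS v = S true v ⊕ S false v

  SS-eq : ∀ c v → SS v ≡ S c v ⊕ S (not c) v
  SS-eq true v = refl
  SS-eq false v = ⊕-comm (S true v) (S false v)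

  SS-e : ∀ j → vsum (λ i → adj i j) e ≡ SS (e j)
  SS-e j = vec-ext λ x → trans (lookup-vsum (λ i → adj i j) e x) (trans (sumFin-cong (λ i → trans (ℤP.*-comm (adj i j) (lookup (e i) x)) (cong (_* adj i j) (e-symm i x))))
      (trans (sumFin-e x (λ i → adj i j)) (trans (coord x) (sym (trans (cong (λ z → lookup z x) (trans (SS-eq (col j) (e j)) (cong (_⊕ S (not (col j)) (e j)) (S-supp (Supp-e j refl)))))
        (trans (lookup-⊕ (neg (e j)) (S (not (col j)) (e j)) x) (cong (_+ lookup (S (not (col j)) (e j)) x) (lookup-neg (e j) x))))))))
    where
    e-symm : ∀ i x → lookup (e {n} i) x ≡ lookup (e x) i
    e-symm i x with i F.≟ x
    ... | yes refl = refl
    ... | no ne = trans (lookup-e-diff ne) (sym (lookup-e-diff (λ p → ne (sym p))))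
    coord : ∀ x → adj x j ≡ - lookup (e j) x + lookup (S (not (col j)) (e j)) x
    coord x with col x BP.≟ not (col j)
    coord x | yes p with x F.≟ j
    ... | yes refl = ⊥-elim (BP.not-¬ refl p)
    ... | no ne = sym (trans (cong (_+_ (- lookup (e j) x)) (trans (S-in (not (col j)) (e j) x p) (cong (_-_ (lookup (e j) x)) (cor-e x j)))) (alg (lookup (e j) x) (a x j)))
      where
      alg : ∀ y c → - y + (y - c) ≡ - c
      alg = solve-∀
    coord x | no p = trans (zero' (adj-zero-or-opposite x j)) (sym (trans (cong (_+_ (- lookup (e j) x)) (S-out (not (col j)) (e j) x p)) (ℤP.+-inverseˡ (lookup (e j) x))))
      where
      zero' : adj x j ≡ 0ℤ ⊎ col x ≡ not (col j) → adj x j ≡ 0ℤ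
      zero' (inj₁ z) = z
      zero' (inj₂ q) = ⊥-elim (p q)

  -- The right side is f (k+1) j + f (k-1) j, with f (-1) j read as - α_j, so this has the shape of
  -- the mesh relations of Auslander-Reiten theory. The induction rests on S c ∘ SS = SS ∘ S (not c)
  -- and on neighbours of `j` having the opposite colour, so that their next factor is S c.
  mesh : ∀ k j → vsum (λ i → adj i j) (f k) ≡ SS (f k j)
  mesh zero j = SS-e j
  mesh (suc k) j = begin
    vsum (λ i → adj i j) (f (suc k)) ≡⟨ VP.tabulate-cong (λ x → sumFin-cong (λ i → term i x)) ⟩
    vsum (λ i → adj i j) (λ i → S c (f k i)) ≡⟨ sym (lin-vsum (W-lin (letters c)) (λ i → adj i j) (f k)) ⟩
    S c (vsum (λ i → adj i j) (f k)) ≡⟨ cong (S c) (trans (mesh k j) (SS-eq c F)) ⟩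
    S c (S c F ⊕ S (not c) F) ≡⟨ Lin.add (W-lin (letters c)) (S c F) (S (not c) F) ⟩
    S c (S c F) ⊕ S c (S (not c) F) ≡⟨ cong (_⊕ S c (S (not c) F)) (trans (S-invol c F) (sym (S-invol (not c) F))) ⟩
    S (not c) (S (not c) F) ⊕ S c (S (not c) F) ≡⟨ ⊕-comm _ _ ⟩
    S c (S (not c) F) ⊕ S (not c) (S (not c) F) ≡⟨ sym (SS-eq c (S (not c) F)) ⟩
    SS (S (not c) F) ≡⟨ cong SS (sym (f-suc k j)) ⟩
    SS (f (suc k) j) ∎
    where
    open ≡-Reasoning
    c = flip k (col j)
    F = f k j
    term : ∀ i x → adj i j * lookup (f (suc k) i) x ≡ adj i j * lookup (S c (f k i)) x
    term i x with adj-zero-or-opposite i j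
    ... | inj₁ z = trans (cong (_* lookup (f (suc k) i) x) z) (sym (cong (_* lookup (S c (f k i)) x) z))
    ... | inj₂ p = cong (λ z → adj i j * lookup z x) (trans (f-suc k i) (cong (λ b → S b (f k i))
          (trans (cong (λ b → not (flip k b)) p) (trans (cong not (flip-not k (col j))) (BP.not-involutive (flip k (col j)))))))

  -- If f (k+1) j is the first to become negative, then f k j is supported on one colour class,
  -- hence SS (f k j) on the other one; by mesh so are the f k i for all neighbours i of j,
  -- and they become negative as well.
  neg-neighbour : ∀ k → (∀ j → Pos (f k j)) → ∀ j i → Neg (f (suc k) j) → i ≢ j → a i j ≢ 0ℤ → Neg (f (suc k) i)
  neg-neighbour k pos j i ng ne nz = subst Neg (sym fi) (Pos-neg (f k i) (pos i))
    where
    b = flip (suc k) (col j)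
    v = f k j
    col-i : flip (suc k) (col i) ≡ not b
    col-i = trans (cong (flip (suc k)) (proper i j ne nz)) (flip-not (suc k) (col j))
    supp-v : Supp b v
    supp-v x p = ℤP.≤-antisym (subst (_≤ 0ℤ) (trans (cong (λ z → lookup z x) (f-suc k j)) (S-out b v x p)) (ng x)) (pos j x)
    SS-zero : ∀ x → col x ≡ b → lookup (SS v) x ≡ 0ℤ
    SS-zero x p = trans (cong (λ z → lookup z x) (SS-eq b v)) (trans (lookup-⊕ (S b v) (S (not b) v) x)
      (trans (cong₂ _+_ (trans (cong (λ z → lookup z x) (S-supp {b} {v} supp-v)) (lookup-neg v x)) (S-out (not b) v x (BP.not-¬ p))) (ℤP.+-inverseˡ (lookup v x))))
    adj≡ : adj i j ≡ - a i j
    adj≡ with i F.≟ j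
    ... | yes p = ⊥-elim (ne p)
    ... | no _ = refl
    supp-fi : Supp (not b) (f k i)
    supp-fi x p = ℤP.*-cancelˡ-≡ (adj i j) (lookup (f k i) x) 0ℤ {{ℤ.≢-nonZero adj≢0}} (trans
      (sumFin-nonneg-zero {f = λ i → adj i j * lookup (f k i) x} (λ l → 0≤-* (adj-nonneg l j) (pos l x))
        (ℤP.≤-reflexive (trans (sym (lookup-vsum (λ i → adj i j) (f k) x)) (trans (cong (λ z → lookup z x) (mesh k j)) (SS-zero x (trans (BP.¬-not p) (BP.not-involutive b)))))) i)
      (sym (ℤP.*-zeroʳ (adj i j))))
      where
      adj≢0 : adj i j ≢ 0ℤ
      adj≢0 z = nz (trans (sym (ℤP.neg-involutive (a i j))) (cong -_ (trans (sym adj≡) z)))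
    fi : f (suc k) i ≡ neg (f k i)
    fi = trans (f-suc k i) (trans (cong (λ c → S c (f k i)) col-i) (S-supp {not b} {f k i} supp-fi))

  -- If some vertex were still positive, connectedness of the diagram would give an edge between a
  -- positive and a negative vertex, against `neg-neighbour`.
  all-neg : ∀ k → (∀ j → Pos (f k j)) → ∀ j → Neg (f (suc k) j) → ∀ i → Neg (f (suc k) i)
  all-neg k pos j ng i = ¬Pos⇒Neg (f-root (suc k) i) λ pi → absurd
      (connected (λ x → does (Pos? (f (suc k) x))) (i , dec-true (Pos? (f (suc k) i)) pi)
        (j , dec-false (Pos? (f (suc k) j)) (λ q → Pos∧Neg⇒⊥ (f-root (suc k) j) q ng)))
    where
    holds : ∀ {A : Set} (A? : Dec A) → does A? ≡ true → A
    holds (yes p) _ = p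
    fails : ∀ {A : Set} (A? : Dec A) → does A? ≡ false → ¬ A
    fails (no p) _ = p
    absurd : (∃₂ λ i j → does (Pos? (f (suc k) i)) ≡ true × does (Pos? (f (suc k) j)) ≡ false × a i j ≢ 0ℤ) → ⊥
    absurd (i , j , p , q , nz) = Pos∧Neg⇒⊥ (f-root (suc k) i) pi
      (neg-neighbour k pos j i (¬Pos⇒Neg (f-root (suc k) j) npj) (λ { refl → npj pi }) nz)
      where
      pi : Pos (f (suc k) i)
      pi = holds (Pos? (f (suc k) i)) p
      npj : ¬ Pos (f (suc k) j)
      npj = fails (Pos? (f (suc k) j)) q

  record Level (h : ℕ) : Set where
    field
      level≥1 : 1 ℕ.≤ h
      below : ∀ m → m ℕ.< h → ∀ j → Pos (f m j)
      at : ∀ j → Neg (f h j)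

  find-level : ∀ k → (∀ m → m ℕ.≤ k → ∀ j → Pos (f m j)) ⊎ ∃ Level
  find-level zero = inj₁ λ { zero _ j → Pos-e j }
  find-level (suc k) with find-level k
  ... | inj₂ l = inj₂ l
  ... | inj₁ pos with FP.all? (λ j → Pos? (f (suc k) j))
  ...   | yes p = inj₁ λ m le j → case-≤ m le j
    where
    case-≤ : ∀ m → m ℕ.≤ suc k → ∀ j → Pos (f m j)
    case-≤ m le j with ℕP.m≤n⇒m<n∨m≡n le
    ... | inj₁ lt = pos m (ℕP.≤-pred lt) j
    ... | inj₂ refl = p j
  ...   | no np with FP.¬∀⟶∃¬ n (λ j → Pos (f (suc k) j)) (λ j → Pos? (f (suc k) j)) np
  ...     | j , q = inj₂ (suc k , record { level≥1 = ℕ.s≤s ℕ.z≤n ; below = λ m lt → pos m (ℕP.≤-pred lt)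
             ; at = all-neg k (pos k ℕP.≤-refl) j (¬Pos⇒Neg (f-root (suc k) j) q) })

  vertex : Fin n
  vertex = F.fromℕ< n≥1

  module WithLevel {h' : ℕ} (lvl : Level h') where
    open Level lvl

    neg-lin : ∀ {T : Vec ℤ n → Vec ℤ n} → Lin T → Lin (λ v → neg (T v))
    neg-lin {T} l .Lin.add u v = trans (cong neg (Lin.add l u v)) (vec-ext λ k → trans (lookup-neg (T u ⊕ T v) k) (trans (cong -_ (lookup-⊕ (T u) (T v) k))
      (trans (ℤP.neg-distrib-+ (lookup (T u) k) (lookup (T v) k)) (sym (trans (lookup-⊕ (neg (T u)) (neg (T v)) k) (cong₂ _+_ (lookup-neg (T u) k) (lookup-neg (T v) k)))))))
    neg-lin {T} l .Lin.scl c v = trans (cong neg (Lin.scl l c v)) (vec-ext λ k → trans (lookup-neg (c • T v) k) (trans (cong -_ (lookup-• c (T v) k))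
      (trans (ℤP.neg-distribʳ-* c (lookup (T v) k)) (sym (trans (lookup-• c (neg (T v)) k) (cong (c *_) (lookup-neg (T v) k)))))))

    -- So the alternating product of `h'` factors is the longest element of W, whichever colour
    -- comes first.
    alt-e-neg : ∀ b j → Neg (alt b h' (e j))
    alt-e-neg b j with col j BP.≟ b
    ... | no p = subst (λ c → Neg (alt c h' (e j))) (trans (cong not (BP.¬-not p)) (BP.not-involutive b)) (at j)
    -- Beginning with the colour of `j` spends one factor on a sign: the result is - f (h'-1) j,
    -- still below the level.
    ... | yes refl = own h' level≥1 below
      where
      own : ∀ h → 1 ℕ.≤ h → (∀ m → m ℕ.< h → ∀ j → Pos (f m j)) → Neg (alt (col j) h (e j))
      own (suc h) _ bl = subst Neg (sym (alt-own h j)) (Pos-neg (f h j) (bl h ℕP.≤-refl j))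

    alt-Pos⇒Neg : ∀ b v → Pos v → Neg (alt b h' v)
    alt-Pos⇒Neg b v p = Neg-of-neg (alt b h' v) (lin-Pos (neg-lin (alt-lin b h')) v p (λ i _ → Neg-neg (alt b h' (e i)) (alt-e-neg b i)))

    alt-Neg⇒Pos : ∀ b v → Neg v → Pos (alt b h' v)
    alt-Neg⇒Pos b v p = Pos-of-neg (alt b h' v) (subst Neg (lin-neg (alt-lin b h') v) (alt-Pos⇒Neg b (neg v) (Neg-neg v p)))

    alt-2h' : ∀ v → alt true (h' ℕ.* 2) v ≡ v
    alt-2h' = W-id (altWord true (h' ℕ.* 2)) λ i → subst Pos (sym (trans (cong (λ z → alt true z (e i)) (trans (ℕP.*-comm h' 2) (cong (h' ℕ.+_) (ℕP.+-identityʳ h')))) (alt-+ true h' h' (e i))))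
      (alt-Neg⇒Pos (flip h' true) (alt true h' (e i)) (alt-e-neg true i))

    -- The colour of the factor applied last in reaching `f k j`; for k = 0, the colour of the
    -- simple root itself.
    top : ℕ → Fin n → Bool
    top k j = flip k (col j)

    simple≢f : ∀ l i j → suc l ℕ.< h' → col i ≡ top (suc l) j → e i ≢ f (suc l) j
    simple≢f l i j lt t p = Pos∧Neg⇒⊥ (f-root l j) (below l (ℕP.<-trans ℕP.≤-refl lt) j)
      (subst Neg (trans (sym (S-supp (Supp-e i t))) (trans (cong (S (top (suc l) j)) (trans p (f-suc l j))) (S-invol (top (suc l) j) (f l j)))) (Pos-neg (e i) (Pos-e i)))

    -- Equal last colours allow the same factor to be stripped from both sides, until one side is
    -- simple; `simple≢f` then compares the signs. The condition on `top` is essential: below the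
    -- level each positive root occurs once with either last colour.
    f-injective : ∀ k i l j → k ℕ.< h' → l ℕ.< h' → top k i ≡ top l j → f k i ≡ f l j → k ≡ l × i ≡ j
    f-injective zero i zero j _ _ _ p with i F.≟ j
    ... | yes q = refl , q
    ... | no q with () ← trans (sym (lookup-e-same i)) (trans (cong (λ z → lookup z i) p) (lookup-e-diff (λ x → q (sym x))))
    f-injective zero i (suc l) j _ lt t p = ⊥-elim (simple≢f l i j lt t p)
    f-injective (suc k) i zero j lt _ t p = ⊥-elim (simple≢f k j i lt (sym t) (sym p))
    f-injective (suc k) i (suc l) j lt lt' t p with f-injective k i l j (ℕP.<-trans ℕP.≤-refl lt) (ℕP.<-trans ℕP.≤-refl lt') (BP.not-injective t)
        (trans (sym (S-invol (top (suc k) i) (f k i))) (trans (cong (S (top (suc k) i)) (trans (sym (f-suc k i)) (trans p (f-suc l j))))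
          (trans (cong (λ b → S b (S (top (suc l) j) (f l j))) t) (S-invol (top (suc l) j) (f l j)))))
    ... | refl , q = refl , q

    supp-root-simple : ∀ {b v} → Root v → Pos v → Supp b v → ∃ λ j → col j ≡ b × v ≡ e j
    supp-root-simple {b} {v} r p sp with FP.¬∀⟶∃¬ n (λ j → lookup v j ≡ 0ℤ) (λ j → lookup v j ℤ.≟ 0ℤ) (λ h → root-≢0 r (vec-ext λ k → trans (h k) (sym (lookup-0 k))))
    ... | j , nz with col j BP.≟ b
    ...   | no q = ⊥-elim (nz (sp j q))
    ...   | yes q = j , q , Pos-flip j r p (¬Pos⇒Neg (root-W (j ∷ []) r) λ ps → nz (ℤP.≤-antisym
              (0≤-⇒≤0 (subst (0ℤ ≤_) (trans (lookup-s-same j v) (trans (cong (_-_ (lookup v j)) (cor-supp {b} {v} sp j q)) (alg (lookup v j)))) (ps j))) (p j)))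
      where
      alg : ∀ x → x - + 2 * x ≡ - x
      alg = solve-∀

    -- Applied to `v` one after the other, the factors make it negative at some first stage. Just
    -- before, it is supported on one colour class and hence simple; undoing the factors exhibits
    -- `v` as some `f k j`.
    f-complete : ∀ m b v → Root v → Pos v → Neg (alt b m v) → ∃₂ λ k j → k ℕ.< m × top k j ≡ b × f k j ≡ v
    f-complete zero b v r p ng = ⊥-elim (Pos∧Neg⇒⊥ r p ng)
    f-complete (suc m) b v r p ng with coherent (root-W (letters b) r)
    ... | inj₁ q with f-complete m (not b) (S b v) (root-W (letters b) r) q (subst Neg (alt-shift b m v) ng)
    ...   | k , j , lt , t , eq = suc k , j , ℕ.s≤s lt , t' , trans (f-suc k j) (trans (cong₂ S t' eq) (S-invol b v))
      where
      t' : not (top k j) ≡ b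
      t' = trans (cong not t) (BP.not-involutive b)
    f-complete (suc m) b v r p ng | inj₂ q with supp-root-simple {b} r p (λ i ne → ℤP.≤-antisym (subst (_≤ 0ℤ) (S-out b v i ne) (q i)) (p i))
    ... | j , cj , eq = 0 , j , ℕ.s≤s ℕ.z≤n , cj , sym eq

    signed : Bool → Vec ℤ n → Vec ℤ n
    signed true v = v
    signed false v = neg v

    -- Positive roots are listed by the alternating words ending in S true, negative roots by the others.
    g : Fin h' → Fin n → Vec ℤ n
    g k j = signed (top (F.toℕ k) j) (f (F.toℕ k) j)

    g-injective : ∀ {k l i j} → g k i ≡ g l j → k ≡ l × i ≡ j
    g-injective {k} {l} {i} {j} eq with top (F.toℕ k) i in t | top (F.toℕ l) j in t'
    ... | true | true = let (p , q) = f-injective _ i _ j (FP.toℕ<n k) (FP.toℕ<n l) (trans t (sym t')) eq in FP.toℕ-injective p , q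
    ... | false | false = let (p , q) = f-injective _ i _ j (FP.toℕ<n k) (FP.toℕ<n l) (trans t (sym t'))
                                (trans (sym (neg-neg _)) (trans (cong neg eq) (neg-neg _))) in FP.toℕ-injective p , q
    ... | true | false = ⊥-elim (Pos∧Neg⇒⊥ (f-root (F.toℕ k) i) (below _ (FP.toℕ<n k) i) (subst Neg (sym eq) (Pos-neg (f (F.toℕ l) j) (below _ (FP.toℕ<n l) j))))
    ... | false | true = ⊥-elim (Pos∧Neg⇒⊥ (f-root (F.toℕ l) j) (below _ (FP.toℕ<n l) j) (subst Neg eq (Pos-neg (f (F.toℕ k) i) (below _ (FP.toℕ<n k) i))))

    g-norm : ∀ k j → ⟨ g k j , g k j ⟩ ≡ ⟨ e j , e j ⟩
    g-norm k j with top (F.toℕ k) j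
    ... | true = W-form (altWord (not (col j)) (F.toℕ k)) (e j) (e j)
    ... | false = trans (form-neg-neg (f (F.toℕ k) j)) (W-form (altWord (not (col j)) (F.toℕ k)) (e j) (e j))
      where
      form-neg-neg : ∀ v → ⟨ neg v , neg v ⟩ ≡ ⟨ v , v ⟩
      form-neg-neg v = trans (linFun-neg (form-linˡ (neg v)) v) (trans (cong -_ (linFun-neg (form-linʳ v) v)) (ℤP.neg-involutive ⟨ v , v ⟩))

    g-root : ∀ k j → Root (g k j)
    g-root k j with top (F.toℕ k) j
    ... | true = f-root (F.toℕ k) j
    ... | false = root-neg (f-root (F.toℕ k) j)

    g-complete : ∀ v → Root v → ∃₂ λ k j → g k j ≡ v
    g-complete v r with coherent r
    ... | inj₁ p with f-complete h' true v r p (alt-Pos⇒Neg true v p)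
    ...   | k , j , lt , t , eq = F.fromℕ< lt , j , trans (cong (λ z → signed (top z j) (f z j)) (FP.toℕ-fromℕ< lt)) (trans (cong (λ b → signed b (f k j)) t) eq)
    g-complete v r | inj₂ p with f-complete h' false (neg v) (root-neg r) (Neg-neg v p) (alt-Pos⇒Neg false (neg v) (Neg-neg v p))
    ...   | k , j , lt , t , eq = F.fromℕ< lt , j , trans (cong (λ z → signed (top z j) (f z j)) (FP.toℕ-fromℕ< lt)) (trans (cong (λ b → signed b (f k j)) t) (trans (cong neg eq) (neg-neg v)))

  iter-alt : ∀ k v → iter k (W (letters false ++ letters true)) v ≡ alt true (k ℕ.* 2) v
  iter-alt zero v = refl
  iter-alt (suc k) v = trans (W-++ (letters false) (letters true) _) (trans (cong (λ z → S false (S true z)) (iter-alt k v))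
    (sym (trans (alt-suc true (suc (k ℕ.* 2)) v) (cong₂ (λ b z → S (not b) z) (flip-double k true) (trans (alt-suc true (k ℕ.* 2) v) (cong (λ b → S b (alt true (k ℕ.* 2) v)) (flip-double k true)))))))

  module WithOrder {h : ℕ} (h≥1 : 1 ℕ.≤ h) (pid : PowId h (letters false ++ letters true)) where

    alt-2h : ∀ b v → alt b (h ℕ.* 2) v ≡ v
    alt-2h true v = trans (sym (iter-alt h v)) (pid v)
    alt-2h false v = trans (cong (alt false (h ℕ.* 2)) (sym (S-invol true v))) (trans (sym (alt-shift true (h ℕ.* 2) (S true v)))
      (trans (alt-suc true (h ℕ.* 2) (S true v)) (trans (cong₂ S (flip-double h true) (alt-2h true (S true v))) (S-invol true v))))

    level : ∃ Level
    level = go h h≥1 alt-2h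
      where
      go : ∀ h → 1 ℕ.≤ h → (∀ b v → alt b (h ℕ.* 2) v ≡ v) → ∃ Level
      -- The bound searched is 2h - 1: the product of 2h factors that begins with the colour of `j`
      -- is the identity and also sends α_j to - f (2h-1) j, so this root is negative.
      go (suc h₀) _ id2h with find-level (suc (h₀ ℕ.* 2))
      ... | inj₂ l = l
      ... | inj₁ pos = ⊥-elim (Pos∧Neg⇒⊥ (root-e j) (Pos-e j) (subst Neg (trans (sym (alt-own (suc (h₀ ℕ.* 2)) j)) (id2h (col j) (e j))) (Pos-neg (f (suc (h₀ ℕ.* 2)) j) (pos _ ℕP.≤-refl j))))
        where
        j = vertex

    -- Let u = f h j. The second half of an alternating product of 2h factors takes `u` back to α_j,
    -- and inverting that half gives u = - f (h-1) j. Below the level both f h j and f (h-1) j would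
    -- be positive.
    level≤order : ∀ {h'} → Level h' → ¬ (h ℕ.< h')
    level≤order {h'} lvl lt = go h h≥1 alt-2h lt
      where
      open Level lvl
      j = vertex
      go : ∀ h → 1 ℕ.≤ h → (∀ b v → alt b (h ℕ.* 2) v ≡ v) → h ℕ.< h' → ⊥
      go (suc h₀) _ id2h lt = Pos∧Neg⇒⊥ (f-root (suc h₀) j) (below (suc h₀) lt j) (subst Neg (sym u≡) (Pos-neg (f h₀ j) (below h₀ (ℕP.<-trans ℕP.≤-refl lt) j)))
        where
        b = not (col j)
        b' = flip (suc h₀) b
        u = f (suc h₀) j
        back : alt b' (suc h₀) u ≡ e j
        back = trans (sym (alt-+ b (suc h₀) (suc h₀) (e j))) (trans (cong (λ z → alt b z (e j)) (sym (trans (ℕP.*-comm (suc h₀) 2) (cong (suc h₀ ℕ.+_) (ℕP.+-identityʳ (suc h₀)))))) (id2h b (e j)))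
        b'' : flip h₀ b' ≡ col j
        b'' = trans (flip-not h₀ (flip h₀ b)) (trans (cong not (flip-flip h₀ b)) (BP.not-involutive (col j)))
        u≡ : u ≡ neg (f h₀ j)
        u≡ = trans (sym (alt-inverse b' h₀ u)) (trans (cong₂ (λ c z → alt c (suc h₀) z) b'' back) (alt-own h₀ j))

-- All h n roots in h layers, each matching the simple roots with lengths preserved; restricting the
-- second index to long simple roots gives the long ones. It is also the source of every decision
-- about roots later on.
record RootEnumeration {n} (C : CartanData n) (h : ℕ) : Set where
  field
    root : Fin h → Fin n → Vec ℤ n
    root-injective : ∀ {k l i j} → root k i ≡ root l j → k ≡ l × i ≡ j
    root-norm-e : ∀ k j → form C (root k j) (root k j) ≡ form C (e j) (e j)
    root-isRoot : ∀ k j → IsRoot C (root k j)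
    root-complete : ∀ v → IsRoot C v → ∃₂ λ k j → root k j ≡ v

rootEnumeration : ∀ {n} (C : CartanData n) → IsSimpleCartan C → ∀ h → IsCoxeterNumber C h → RootEnumeration C h
rootEnumeration {n} C sc h (h≥1 , cox-h , minimal) = result
  where
  open Roots C sc
  open CoxeterWords C sc
  lo = leafOrder (allFin n) (UP.allFin⁺ n)
  ys = proj₁ lo
  perm : allFin n ↭ ys
  perm = proj₂ (proj₂ lo)
  colours = colouring (proj₁ (proj₂ lo))
  col = proj₁ colours
  open Bipartite C sc col (λ i j → proj₂ colours i j (PP.∈-resp-↭ perm (∈P.∈-allFin i)) (PP.∈-resp-↭ perm (∈P.∈-allFin j)))
  conj : allFin n ~ (letters false ++ letters true)
  conj = trans~ (orderings~ (proj₁ (proj₂ lo)) (allFin n) perm) (sym~ (orderings~ (proj₁ (proj₂ lo)) (letters false ++ letters true) (↭-trans (colour-split col (allFin n)) perm)))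
  open WithOrder {h} h≥1 (proj₁ (PowId-~ h conj) (coxPow⇒PowId h cox-h))
  h' = proj₁ level
  lvl = proj₂ level
  h'≡h : h' ≡ h
  -- The level cannot exceed the order by `level≤order`. Conversely 2h' alternating factors form the
  -- h'-th power of the Coxeter element and give the identity, so minimality of `h` applies.
  h'≡h = ℕP.≤-antisym (ℕP.≮⇒≥ (level≤order lvl)) (ℕP.≮⇒≥ λ lt → minimal h' (Level.level≥1 lvl) lt
    (PowId⇒coxPow h' (proj₂ (PowId-~ h' conj) λ v → trans (iter-alt h' v) (WithLevel.alt-2h' lvl v))))
  result : RootEnumeration C h
  result = subst (RootEnumeration C) h'≡h record { root = g ; root-injective = g-injective ; root-norm-e = g-norm ; root-isRoot = g-root ; root-complete = g-complete }
    where open WithLevel lvl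

-- Counting with duplicate-free lists, and the height.

unique-⊆⇒length≤ : ∀ {A : Set} {xs ys : List A} → Unique xs → (∀ {x} → x ∈ xs → x ∈ ys) → length xs ℕ.≤ length ys
unique-⊆⇒length≤ {xs = []} _ _ = ℕ.z≤n
unique-⊆⇒length≤ {xs = x ∷ xs} (h ∷ u) sub with ∈P.∈-∃++ (sub (here refl))
... | p , q , refl = subst (suc (length xs) ℕ.≤_) (sym (PP.↭-length (PP.shift x p q))) (ℕ.s≤s (unique-⊆⇒length≤ u λ m → rest m))
  where
  rest : ∀ {y} → y ∈ xs → y ∈ p ++ q
  rest m with PP.∈-resp-↭ (PP.shift x p q) (sub (there m))
  ... | here refl = ⊥-elim (All.lookup h m refl)
  ... | there m' = m'

unique-⊆-full : ∀ {A : Set} {xs ys : List A} → (∀ y → Dec (y ∈ xs)) → Unique xs → (∀ {x} → x ∈ xs → x ∈ ys) → length ys ℕ.≤ length xs → ∀ {y} → y ∈ ys → y ∈ xs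
unique-⊆-full {xs = xs} dec u sub le {y} m with dec y
... | yes p = p
... | no p = ⊥-elim (ℕP.<⇒≱ (unique-⊆⇒length≤ {xs = y ∷ xs} (All.tabulate (λ { q refl → p q }) ∷ u) λ { (here refl) → m ; (there q) → sub q }) le)

length-filter-split : ∀ {A : Set} {P : A → Set} (P? : ∀ x → Dec (P x)) xs → length (filter P? xs) ℕ.+ length (filter (λ x → ¬? (P? x)) xs) ≡ length xs
length-filter-split P? [] = refl
length-filter-split P? (x ∷ xs) with P? x
... | yes _ = cong suc (length-filter-split P? xs)
... | no _ = trans (ℕP.+-suc (length (filter P? xs)) _) (cong suc (length-filter-split P? xs))

length-cartesianProductWith : ∀ {A B C : Set} (f : A → B → C) xs ys → length (L.cartesianProductWith f xs ys) ≡ length xs ℕ.* length ys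
length-cartesianProductWith f [] ys = refl
length-cartesianProductWith f (x ∷ xs) ys = trans (LP.length-++ (L.map (f x) ys)) (cong₂ ℕ._+_ (LP.length-map (f x) ys) (length-cartesianProductWith f xs ys))

card-unique : ∀ {A : Set} {P : A → Set} {k m} → Card P k → Card P m → k ≡ m
card-unique (xs , refl , ax , ux , cx) (ys , refl , ay , uy , cy) = ℕP.≤-antisym
  (unique-⊆⇒length≤ ux (λ {x} m → cy x (All.lookup ax m))) (unique-⊆⇒length≤ uy (λ {x} m → cx x (All.lookup ay m)))

allPairs-map : ∀ {A B : Set} {R : B → B → Set} {f : A → B} {xs} → (∀ {x y} → x ∈ xs → y ∈ xs → x ≢ y → R (f x) (f y)) → Unique xs → AllPairs R (L.map f xs)
allPairs-map {xs = []} r [] = []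
allPairs-map {xs = x ∷ xs} r (h ∷ u) = AllP.map⁺ (All.tabulate λ m → r (here refl) (there m) (All.lookup h m)) ∷ allPairs-map (λ p q → r (there p) (there q)) u

height : ∀ {n} → Vec ℤ n → ℤ
height v = sumFin (λ i → lookup v i)

height-lin : ∀ {n} → LinFun (height {n})
height-lin = linFun-cong (λ v → sumFin-cong λ i → sym (ℤP.*-identityˡ (lookup v i))) (linFun-sum (λ _ → 1ℤ))

height-e : ∀ {n} (i : Fin n) → height (e i) ≡ 1ℤ
height-e i = trans (sumFin-cong (λ j → sym (ℤP.*-identityʳ (lookup (e i) j)))) (sumFin-e i (λ _ → 1ℤ))

height-nonneg : ∀ {n} {v : Vec ℤ n} → Pos v → 0ℤ ≤ height v
height-nonneg p = sumFin-nonneg p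

-- Biconvex sets of positive roots as inversion sets.

module Biconvexity {n : ℕ} (C : CartanData n) (sc : IsSimpleCartan C) where
  open CartanData C
  open Roots C sc
  open import Data.List.Membership.DecPropositional (_≟V_ {n}) public using (_∈?_)

  SumClosed SumCoclosed AllPos : List (Vec ℤ n) → Set
  SumClosed xs = ∀ β γ → β ∈ xs → γ ∈ xs → Root (β ⊕ γ) → (β ⊕ γ) ∈ xs
  SumCoclosed xs = ∀ β γ → Root β → Pos β → Root γ → Pos γ → Root (β ⊕ γ) → β ∉ xs → γ ∉ xs → (β ⊕ γ) ∉ xs
  AllPos xs = ∀ {x} → x ∈ xs → Root x × Pos x

  Inversions : List (Vec ℤ n) → List (Fin n) → Set
  Inversions xs w = ∀ β → Root β → Pos β → (β ∈ xs → Neg (W w β)) × (β ∉ xs → Pos (W w β))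

  private
    -- Induction on the height: a nonsimple positive root is a lower positive root plus a simple
    -- one, and coclosedness passes from these two to their sum.
    pos-root-∉ : ∀ xs → (∀ β γ → Root β → Pos β → Root γ → Pos γ → Root (β ⊕ γ) → β ∉ xs → γ ∉ xs → (β ⊕ γ) ∉ xs)
      → (∀ i → e i ∉ xs) → ∀ k β → Root β → Pos β → height β ≤ + k → β ∉ xs
    pos-root-∉ xs co ns zero β r p le = ⊥-elim (root-≢0 r (vec-ext λ i → trans (sumFin-nonneg-zero p le i) (sym (lookup-0 i))))
    pos-root-∉ xs co ns (suc k) β r p le = by (FP.any? (λ i → β ≟V e i))
      where
      alg : ∀ x y → x - y + y ≡ x
      alg = solve-∀
      alg₁ : ∀ k → 1ℤ + k - 1ℤ ≡ k
      alg₁ = solve-∀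
      step : (∃ λ i → Root (β ⊖ e i) × Pos (β ⊖ e i)) → β ∉ xs
      step (i , r' , p') = subst (_∉ xs) sum (co (β ⊖ e i) (e i) r' p' (root-e i) (Pos-e i) (subst Root (sym sum) r)
                (pos-root-∉ xs co ns k (β ⊖ e i) r' p' ht) (ns i))
        where
        sum : (β ⊖ e i) ⊕ e i ≡ β
        sum = vec-ext λ k → trans (lookup-⊕ (β ⊖ e i) (e i) k) (trans (cong (_+ lookup (e i) k) (lookup-⊖ β (e i) k)) (alg (lookup β k) (lookup (e i) k)))
        ht≡ : height (β ⊖ e i) ≡ height β - 1ℤ
        ht≡ = trans (linFun-⊖ height-lin β (e i)) (cong (λ z → height β - z) (height-e i))
        ht : height (β ⊖ e i) ≤ + k
        ht = subst₂ _≤_ (sym ht≡) (alg₁ (+ k)) (ℤP.+-monoˡ-≤ (- 1ℤ) {height β} {1ℤ + + k} le)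
      by : Dec (∃ λ i → β ≡ e i) → β ∉ xs
      by (yes (i , eq)) = subst (_∉ xs) (sym eq) (ns i)
      by (no nsβ) = step (nonsimple-⊖ r p (λ i q → nsβ (i , q)))

    module Peel (xs : List (Vec ℤ n)) (pos : AllPos xs) (cl : SumClosed xs) (co : SumCoclosed xs) (i : Fin n) (mi : e i ∈ xs) where
      ne? : ∀ x → Dec (x ≢ e i)
      ne? x = ¬? (x ≟V e i)

      xs' : List (Vec ℤ n)
      xs' = L.map (s i) (filter ne? xs)

      mem⁺ : ∀ {y} → s i y ∈ xs → s i y ≢ e i → y ∈ xs'
      mem⁺ {y} m ne = subst (_∈ xs') (s-invol i y) (∈P.∈-map⁺ (s i) (∈P.∈-filter⁺ ne? m ne))

      mem⁻ : ∀ {y} → y ∈ xs' → s i y ∈ xs × s i y ≢ e i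
      mem⁻ {y} m = subst (_∈ xs) (sym x≡) (proj₁ xm) , λ q → proj₂ xm (trans (sym x≡) q)
        where
        x = proj₁ (∈P.∈-map⁻ (s i) m)
        xm = ∈P.∈-filter⁻ ne? {xs = xs} (proj₁ (proj₂ (∈P.∈-map⁻ (s i) m)))
        x≡ : s i y ≡ x
        x≡ = trans (cong (s i) (proj₂ (proj₂ (∈P.∈-map⁻ (s i) m)))) (s-invol i x)

      not-e : ∀ {y} → Pos y → s i y ≢ e i
      not-e {y} p q = Pos∧Neg⇒⊥ (root-e i) (Pos-e i) (Neg-of-neg (e i) (subst Pos (trans (sym (s-invol i y)) (trans (cong (s i) q) (s-e-self i))) p))

      shorter : length xs' ℕ.< length xs
      shorter = subst (ℕ._< length xs) (sym (LP.length-map (s i) (filter ne? xs))) (LP.filter-notAll ne? xs (lose mi (λ q → q refl)))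

      pos' : AllPos xs'
      pos' {x} m = root-W⁻ (i ∷ []) (proj₁ (pos (proj₁ (mem⁻ m)))) ,
        subst Pos (s-invol i x) (s-Pos i (proj₁ (pos (proj₁ (mem⁻ m)))) (proj₂ (pos (proj₁ (mem⁻ m)))) (proj₂ (mem⁻ m)))

      s-⊕ : ∀ β γ → s i (β ⊕ γ) ≡ s i β ⊕ s i γ
      s-⊕ = Lin.add (s-lin i)

      root-s : ∀ {v} → Root v → Root (s i v)
      root-s = root-W (i ∷ [])

      cl' : SumClosed xs'
      cl' β γ mβ mγ r = mem⁺ (subst (_∈ xs) (sym (s-⊕ β γ)) (cl (s i β) (s i γ) (proj₁ (mem⁻ mβ)) (proj₁ (mem⁻ mγ)) (subst Root (s-⊕ β γ) (root-s r))))
        (not-e (Pos-⊕ β γ (proj₂ (pos' mβ)) (proj₂ (pos' mγ))))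

      -- Coclosedness when one summand is the removed root α_i, where closedness of the old set does
      -- the work: from s_i(α_i + γ) = s_i(γ) - α_i in the old set, adding α_i puts s_i(γ) there,
      -- and thus γ into the new set.
      simple-case : ∀ γ → Root γ → Pos γ → γ ∉ xs' → (e i ⊕ γ) ∉ xs'
      simple-case γ rγ pγ nγ m = nγ (mem⁺ (subst (_∈ xs) sum (cl (s i (e i ⊕ γ)) (e i) (proj₁ (mem⁻ m)) mi (subst Root (sym sum) (root-s rγ)))) (not-e pγ))
        where
        alg : ∀ x y → - x + y + x ≡ y
        alg = solve-∀
        coord : ∀ k → lookup (s i (e i ⊕ γ)) k ≡ - lookup (e i) k + lookup (s i γ) k
        coord k = trans (cong (λ z → lookup z k) (s-⊕ (e i) γ)) (trans (lookup-⊕ (s i (e i)) (s i γ) k)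
          (cong (λ z → z + lookup (s i γ) k) (trans (cong (λ z → lookup z k) (s-e-self i)) (lookup-neg (e i) k))))
        sum : s i (e i ⊕ γ) ⊕ e i ≡ s i γ
        sum = vec-ext λ k → trans (lookup-⊕ (s i (e i ⊕ γ)) (e i) k) (trans (cong (λ z → z + lookup (e i) k) (coord k)) (alg (lookup (e i) k) (lookup (s i γ) k)))

      co' : SumCoclosed xs'
      co' β γ rβ pβ rγ pγ r nβ nγ m = by (β ≟V e i) (γ ≟V e i)
        where
        by : Dec (β ≡ e i) → Dec (γ ≡ e i) → ⊥
        by (yes q) _ = simple-case γ rγ pγ nγ (subst (λ z → (z ⊕ γ) ∈ xs') q m)
        by (no _) (yes q) = simple-case β rβ pβ nβ (subst (_∈ xs') (trans (⊕-comm β γ) (cong (_⊕ β) q)) m)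
        by (no neβ) (no neγ) = co (s i β) (s i γ) (root-s rβ) (s-Pos i rβ pβ neβ) (root-s rγ) (s-Pos i rγ pγ neγ)
          (subst Root (s-⊕ β γ) (root-s r)) (λ q → nβ (mem⁺ q (not-e pβ))) (λ q → nγ (mem⁺ q (not-e pγ)))
          (subst (_∈ xs) (s-⊕ β γ) (proj₁ (mem⁻ m)))

      extend : ∀ w → Inversions xs' w → Inversions xs (w ++ i ∷ [])
      extend w h β r p = by (β ≟V e i)
        where
        Wβ : W (w ++ i ∷ []) β ≡ W w (s i β)
        Wβ = W-++ w (i ∷ []) β
        by : Dec (β ≡ e i) → (β ∈ xs → Neg (W (w ++ i ∷ []) β)) × (β ∉ xs → Pos (W (w ++ i ∷ []) β))
        by (yes q) = (λ _ → subst Neg (sym W≡) (Pos-neg (W w (e i)) (proj₂ (h (e i) (root-e i) (Pos-e i)) e∉))) , (λ nm → ⊥-elim (nm (subst (_∈ xs) (sym q) mi)))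
          where
          W≡ : W (w ++ i ∷ []) β ≡ neg (W w (e i))
          W≡ = trans Wβ (trans (cong (λ z → W w (s i z)) q) (trans (cong (W w) (s-e-self i)) (lin-neg (W-lin w) (e i))))
          e∉ : e i ∉ xs'
          e∉ m = Pos∧Neg⇒⊥ (root-W (i ∷ []) (root-e i)) (proj₂ (pos (proj₁ (mem⁻ m)))) (subst Neg (sym (s-e-self i)) (Pos-neg (e i) (Pos-e i)))
        by (no ne) = (λ m → subst Neg (sym Wβ) (proj₁ h' (mem⁺ (subst (_∈ xs) (sym (s-invol i β)) m) (λ q → ne (trans (sym (s-invol i β)) q))))) ,
                     (λ nm → subst Pos (sym Wβ) (proj₂ h' λ m → nm (subst (_∈ xs) (s-invol i β) (proj₁ (mem⁻ m)))))
          where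
          h' = h (s i β) (root-s r) (s-Pos i r p ne)

    biconvex-fuel : ∀ k xs → length xs ℕ.≤ k → AllPos xs → SumClosed xs → SumCoclosed xs → ∃ (Inversions xs)
    biconvex-fuel k xs le pos cl co = by k le (FP.any? (λ i → e i ∈? xs))
      where
      by : ∀ k → length xs ℕ.≤ k → Dec (∃ λ i → e i ∈ xs) → ∃ (Inversions xs)
      by k le (no none) = [] , λ β r p → (λ m → ⊥-elim (pos-root-∉ xs co (λ i m → none (i , m)) ℤ.∣ height β ∣ β r p
            (ℤP.≤-reflexive (sym (ℤP.0≤i⇒+∣i∣≡i (height-nonneg {v = β} p)))) m)) , (λ _ → p)
      by zero le (yes (i , mi)) = ⊥-elim (ℕP.<⇒≱ (Peel.shorter xs pos cl co i mi) (ℕP.≤-trans le ℕ.z≤n))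
      by (suc k) le (yes (i , mi)) = let (w , h) = biconvex-fuel k xs' (ℕP.≤-pred (ℕP.<-≤-trans shorter le)) pos' cl' co' in w ++ i ∷ [] , extend w h
        where open Peel xs pos cl co i mi

  -- Biconvex sets of positive roots are inversion sets: such a nonempty set contains a simple
  -- root α_i, and s_i maps its other elements onto a smaller biconvex set.
  biconvex⇒inversions : ∀ xs → AllPos xs → SumClosed xs → SumCoclosed xs → ∃ (Inversions xs)
  biconvex⇒inversions xs = biconvex-fuel (length xs) xs ℕP.≤-refl

-- The grading by the highest root and the order on Δ(1).

module Heisenberg {n : ℕ} (C : CartanData n) (sc : IsSimpleCartan C) (θ : Vec ℤ n) (hθ : IsHighestRoot C θ) where
  open CartanData C
  open Roots C sc
  open Biconvexity C sc

  rθ : Root θ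
  rθ = proj₁ hθ

  θ-max : ∀ {β} → Root β → ∀ i → lookup β i ≤ lookup θ i
  θ-max r = proj₂ hθ _ r

  1≤θ : ∀ i → 1ℤ ≤ lookup θ i
  1≤θ i = subst (_≤ lookup θ i) (lookup-e-same i) (θ-max (root-e i) i)

  Pos-θ : Pos θ
  Pos-θ i = ℤP.≤-trans (+≤+ ℕ.z≤n) (1≤θ i)

  θ-dominant : ∀ i → 0ℤ ≤ cor i θ
  θ-dominant i = 0≤-⇒≤ (subst (0ℤ ≤_) (alg (lookup θ i) (cor i θ)) (≤⇒0≤- (subst (_≤ lookup θ i) (lookup-s-same i θ) (θ-max (root-W (i ∷ []) rθ) i))))
    where
    alg : ∀ x c → x - (x - c) ≡ c - 0ℤ
    alg = solve-∀

  T : ℤ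
  T = rootD rθ

  T>0 : 0ℤ < T
  T>0 = rootD>0 rθ

  -- The grading (γ, θ^∨): the roots of level j form Δ(j).
  lev : Vec ℤ n → ℤ
  lev = rootM rθ

  form-lev : ∀ x → ⟨ x , θ ⟩ ≡ T * lev x
  form-lev x = trans (form-sym x θ) (root-form rθ x)

  lev-lin : LinFun lev
  lev-lin .LinFun.add u v = *-cancel (lev (u ⊕ v)) (lev u + lev v) T>0 (trans (sym (form-lev (u ⊕ v))) (trans (LinFun.add (form-linˡ θ) u v)
    (trans (cong₂ _+_ (form-lev u) (form-lev v)) (sym (ℤP.*-distribˡ-+ T (lev u) (lev v))))))
  lev-lin .LinFun.scl c v = *-cancel (lev (c • v)) (c * lev v) T>0 (trans (sym (form-lev (c • v))) (trans (LinFun.scl (form-linˡ θ) c v)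
    (trans (cong (c *_) (form-lev v)) (alg c T (lev v)))))
    where
    alg : ∀ c t l → c * (t * l) ≡ t * (c * l)
    alg = solve-∀

  lev-θ : lev θ ≡ + 2
  lev-θ = *-cancel (lev θ) (+ 2) T>0 (trans (sym (form-lev θ)) (trans (root-norm rθ) (ℤP.*-comm (+ 2) T)))

  form-e-θ≥0 : ∀ i → 0ℤ ≤ D i * cor i θ
  form-e-θ≥0 i = 0≤-* (ℤP.<⇒≤ (D>0 i)) (θ-dominant i)

  lev≥0 : ∀ γ → Pos γ → 0ℤ ≤ lev γ
  lev≥0 γ p = ℤP.*-cancelˡ-≤-pos 0ℤ (lev γ) T {{ℤ.positive T>0}} (subst₂ _≤_ (sym (ℤP.*-zeroʳ T)) (trans (sym (form-cor γ θ)) (form-lev γ))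
    (sumFin-nonneg λ i → 0≤-* (p i) (form-e-θ≥0 i)))

  lev≤0 : ∀ γ → Neg γ → lev γ ≤ 0ℤ
  lev≤0 γ p = 0≤-⇒≤0 (subst (0ℤ ≤_) (linFun-neg lev-lin γ) (lev≥0 (neg γ) (Neg-neg γ p)))

  Π₀ : Fin n → Set
  Π₀ = Π0 C θ

  Π₀? : ∀ i → Dec (Π₀ i)
  Π₀? i = form C (e i) θ ℤ.≟ 0ℤ

  -- Since θ is dominant, all terms of (γ,θ) = Σ γ_i (α_i,θ) are nonnegative, so each one vanishes.
  -- Positive roots of level 0 are thus combinations of Π(0).
  lev0-support : ∀ γ → Pos γ → lev γ ≡ 0ℤ → ∀ i → ¬ Π₀ i → lookup γ i ≡ 0ℤ
  lev0-support γ p l i nz = zero-factor (lookup γ i) (D i * cor i θ) (sumFin-nonneg-zero (λ i → 0≤-* (p i) (form-e-θ≥0 i))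
      (ℤP.≤-reflexive (trans (sym (form-cor γ θ)) (trans (form-lev γ) (trans (cong (T *_) l) (ℤP.*-zeroʳ T))))) i) (λ q → nz (trans (form-e i θ) q))
    where
    zero-factor : ∀ x y → x * y ≡ 0ℤ → y ≢ 0ℤ → x ≡ 0ℤ
    zero-factor x y p ny = either (λ q → q) (λ q → ⊥-elim (ny q)) (ℤP.i*j≡0⇒i≡0∨j≡0 x p)

  -- Maximality of θ applied to the root - s_θ(γ) = lev(γ) θ - γ gives γ ≥ (lev(γ) - 1) θ ≥ θ in
  -- every coordinate.
  lev≥2⇒θ : ∀ {γ} → Root γ → + 2 ≤ lev γ → γ ≡ θ
  lev≥2⇒θ {γ} r l = vec-ext λ i → ℤP.≤-antisym (θ-max r i) (0≤-⇒≤ (subst (0ℤ ≤_) (alg (lookup γ i) (lev γ) (lookup θ i))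
      (0≤-+ (≤⇒0≤- (refl≤ i)) (0≤-* (≤⇒0≤- l) (Pos-θ i)))))
    where
    refl≤ : ∀ i → lev γ * lookup θ i - lookup γ i ≤ lookup θ i
    refl≤ i = subst (_≤ lookup θ i) (trans (lookup-neg (γ ⊖ (lev γ • θ)) i) (trans (cong -_ (lookup-⊕• γ (lev γ) θ i)) (alg₀ (lookup γ i) (lev γ * lookup θ i))))
      (θ-max (root-neg (root-refl rθ r)) i)
      where
      alg₀ : ∀ x y → - (x - y) ≡ y - x
      alg₀ = solve-∀
    alg : ∀ g l t → (t - (l * t - g)) + (l - + 2) * t ≡ g - t
    alg = solve-∀

  Δ₁ : Vec ℤ n → Set
  Δ₁ = Δ1 C θ

  Δ₁-lev : ∀ {γ} → Δ₁ γ → lev γ ≡ 1ℤ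
  Δ₁-lev {γ} (r , p) = *-cancel (lev γ) 1ℤ (0<-* {+ 2} {T} (+<+ (ℕ.s≤s ℕ.z≤n)) T>0) (trans (ℤP.*-assoc (+ 2) T (lev γ))
    (trans (cong (+ 2 *_) (sym (form-lev γ))) (trans p (trans (root-norm rθ) (sym (ℤP.*-identityʳ (+ 2 * T)))))))

  lev-Δ₁ : ∀ {γ} → Root γ → lev γ ≡ 1ℤ → Δ₁ γ
  lev-Δ₁ {γ} r p = r , trans (cong (+ 2 *_) (trans (form-lev γ) (trans (cong (T *_) p) (ℤP.*-identityʳ T)))) (sym (root-norm rθ))

  lev>0⇒Pos : ∀ {γ} → Root γ → 0ℤ < lev γ → Pos γ
  lev>0⇒Pos {γ} r p with coherent r
  ... | inj₁ q = q
  ... | inj₂ q = ⊥-elim (<⇒≱ p (lev≤0 γ q))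

  Δ₁-Pos : ∀ {γ} → Δ₁ γ → Pos γ
  Δ₁-Pos {γ} d = lev>0⇒Pos (proj₁ d) (subst (0ℤ <_) (sym (Δ₁-lev d)) (+<+ (ℕ.s≤s ℕ.z≤n)))

  lev-cases : ∀ {γ} → Root γ → Pos γ → lev γ ≡ 0ℤ ⊎ lev γ ≡ 1ℤ ⊎ γ ≡ θ
  lev-cases {γ} r p = go (lev γ) refl (lev≥0 γ p)
    where
    go : ∀ l → lev γ ≡ l → 0ℤ ≤ l → lev γ ≡ 0ℤ ⊎ lev γ ≡ 1ℤ ⊎ γ ≡ θ
    go (+ 0) q _ = inj₁ q
    go (+ 1) q _ = inj₂ (inj₁ q)
    go (+ suc (suc k)) q _ = inj₂ (inj₂ (lev≥2⇒θ r (subst (+ 2 ≤_) (sym q) (+≤+ (ℕ.s≤s (ℕ.s≤s ℕ.z≤n))))))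

  ⊖⊖ : ∀ (x y : Vec ℤ n) → x ⊖ (x ⊖ y) ≡ y
  ⊖⊖ x y = vec-ext λ i → trans (lookup-⊖ x (x ⊖ y) i) (trans (cong (λ z → lookup x i - z) (lookup-⊖ x y i)) (alg (lookup x i) (lookup y i)))
    where
    alg : ∀ x y → x - (x - y) ≡ y
    alg = solve-∀

  ⊕-⊖ : ∀ (x y : Vec ℤ n) → y ⊕ (x ⊖ y) ≡ x
  ⊕-⊖ x y = vec-ext λ i → trans (lookup-⊕ y (x ⊖ y) i) (trans (cong (λ z → lookup y i + z) (lookup-⊖ x y i)) (alg (lookup x i) (lookup y i)))
    where
    alg : ∀ x y → y + (x - y) ≡ x
    alg = solve-∀

  ⊕⇒⊖ : ∀ {x y z : Vec ℤ n} → x ⊕ y ≡ z → y ≡ z ⊖ x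
  ⊕⇒⊖ {x} {y} {z} p = vec-ext λ i → sym (trans (lookup-⊖ z x i) (trans (cong (λ z → z - lookup x i) (trans (cong (λ z → lookup z i) (sym p)) (lookup-⊕ x y i))) (alg (lookup x i) (lookup y i))))
    where
    alg : ∀ x y → x + y - x ≡ y
    alg = solve-∀

  co : Vec ℤ n → Vec ℤ n
  co γ = θ ⊖ γ

  co-co : ∀ γ → co (co γ) ≡ γ
  co-co = ⊖⊖ θ

  -- θ - γ = -s_θ(γ).
  refl-θ : ∀ {γ} → lev γ ≡ 1ℤ → γ ⊖ (lev γ • θ) ≡ neg (co γ)
  refl-θ {γ} l = vec-ext λ i → trans (lookup-⊕• γ (lev γ) θ i) (trans (cong (λ z → lookup γ i - z * lookup θ i) l)
    (trans (alg (lookup γ i) (lookup θ i)) (sym (trans (lookup-neg (co γ) i) (cong -_ (lookup-⊖ θ γ i))))))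
    where
    alg : ∀ g t → g - 1ℤ * t ≡ - (t - g)
    alg = solve-∀

  co-Δ₁ : ∀ {γ} → Δ₁ γ → Δ₁ (co γ)
  co-Δ₁ {γ} d = lev-Δ₁ (root-neg⁻ (subst Root (refl-θ (Δ₁-lev d)) (root-refl rθ (proj₁ d))))
    (trans (linFun-⊖ lev-lin θ γ) (cong₂ _-_ lev-θ (Δ₁-lev d)))

  root≢θ⇒lev≤1 : ∀ {γ} → Root γ → γ ≢ θ → lev γ ≤ 1ℤ
  root≢θ⇒lev≤1 {γ} r ne = ℤP.≮⇒≥ λ lt → ne (lev≥2⇒θ r (ℤP.i<j⇒suc[i]≤j lt))

  -- The levels add up to 2, and neither exceeds 1: a summand of higher level would be θ and leave
  -- zero for the other.
  sum-θ : ∀ {γ δ} → Root γ → Root δ → γ ⊕ δ ≡ θ → Δ₁ γ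
  sum-θ {γ} {δ} rγ rδ p = lev-Δ₁ rγ (ℤP.≤-antisym (root≢θ⇒lev≤1 rγ neγ) (0≤-⇒≤ (subst (0ℤ ≤_) (trans (cong (λ z → 1ℤ - z) lδ) (alg (lev γ))) (≤⇒0≤- (root≢θ⇒lev≤1 rδ neδ)))))
    where
    lsum : lev γ + lev δ ≡ + 2
    lsum = trans (sym (LinFun.add lev-lin γ δ)) (trans (cong lev p) lev-θ)
    lδ : lev δ ≡ + 2 - lev γ
    lδ = trans (alg₁ (lev γ) (lev δ)) (cong (_- lev γ) lsum)
      where
      alg₁ : ∀ g d → d ≡ g + d - g
      alg₁ = solve-∀
    alg : ∀ g → 1ℤ - (+ 2 - g) ≡ g - 1ℤ
    alg = solve-∀
    θ⊖θ : θ ⊖ θ ≡ zeroV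
    θ⊖θ = vec-ext λ i → trans (lookup-⊖ θ θ i) (trans (ℤP.+-inverseʳ (lookup θ i)) (sym (lookup-0 i)))
    neγ : γ ≢ θ
    neγ q = root-≢0 rδ (trans (⊕⇒⊖ p) (trans (cong (θ ⊖_) q) θ⊖θ))
    neδ : δ ≢ θ
    neδ q = root-≢0 rγ (trans (⊕⇒⊖ (trans (⊕-comm δ γ) p)) (trans (cong (θ ⊖_) q) θ⊖θ))

  sum-θ′ : ∀ {γ δ} → Root γ → Root δ → γ ⊕ δ ≡ θ → Δ₁ δ
  sum-θ′ {γ} {δ} rγ rδ p = sum-θ rδ rγ (trans (⊕-comm δ γ) p)

  infix 4 _≼'_
  _≼'_ : Vec ℤ n → Vec ℤ n → Set
  _≼'_ = _≼_ C θ

  ≼-diff : ∀ {μ γ} → Pos (γ ⊖ μ) → lev (γ ⊖ μ) ≡ 0ℤ → μ ≼' γ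
  ≼-diff {μ} {γ} p l i = p i , lev0-support (γ ⊖ μ) p l i

  ≼-refl : ∀ γ → γ ≼' γ
  ≼-refl γ i = ℤP.≤-reflexive (sym z) , λ _ → z
    where
    z : lookup (γ ⊖ γ) i ≡ 0ℤ
    z = trans (lookup-⊖ γ γ i) (ℤP.+-inverseʳ (lookup γ i))

  ≼-trans : ∀ {x y z} → x ≼' y → y ≼' z → x ≼' z
  ≼-trans {x} {y} {z} p q i = subst (0ℤ ≤_) (sym eq) (0≤-+ (proj₁ (p i)) (proj₁ (q i))) , λ nz → trans eq (cong₂ _+_ (proj₂ (p i) nz) (proj₂ (q i) nz))
    where
    alg : ∀ x y z → z - x ≡ (y - x) + (z - y)
    alg = solve-∀
    eq : lookup (z ⊖ x) i ≡ lookup (y ⊖ x) i + lookup (z ⊖ y) i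
    eq = trans (lookup-⊖ z x i) (trans (alg (lookup x i) (lookup y i) (lookup z i)) (sym (cong₂ _+_ (lookup-⊖ y x i) (lookup-⊖ z y i))))

  ≼-antisym : ∀ {x y} → x ≼' y → y ≼' x → x ≡ y
  ≼-antisym {x} {y} p q = vec-ext λ i → ℤP.≤-antisym (0≤-⇒≤ (subst (0ℤ ≤_) (lookup-⊖ y x i) (proj₁ (p i)))) (0≤-⇒≤ (subst (0ℤ ≤_) (lookup-⊖ x y i) (proj₁ (q i))))

  ≼? : ∀ x y → Dec (x ≼' y)
  ≼? x y = FP.all? λ i → dec× (0ℤ ℤ.≤? lookup (y ⊖ x) i) (dec→ (Π₀? i) (lookup (y ⊖ x) i ℤ.≟ 0ℤ))
    where
    dec× : ∀ {A B : Set} → Dec A → Dec B → Dec (A × B)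
    dec× = _×-dec_
    dec→ : ∀ {A B : Set} → Dec A → Dec B → Dec (¬ A → B)
    dec→ a b = _→-dec_ (¬? a) b

  ≼-co : ∀ {x y} → x ≼' y → co y ≼' co x
  ≼-co {x} {y} p i = subst (0ℤ ≤_) (sym eq) (proj₁ (p i)) , λ nz → trans eq (proj₂ (p i) nz)
    where
    alg : ∀ t x y → (t - x) - (t - y) ≡ y - x
    alg = solve-∀
    eq : lookup (co x ⊖ co y) i ≡ lookup (y ⊖ x) i
    eq = trans (lookup-⊖ (co x) (co y) i) (trans (cong₂ _-_ (lookup-⊖ θ x i) (lookup-⊖ θ y i)) (trans (alg (lookup θ i) (lookup x i) (lookup y i)) (sym (lookup-⊖ y x i))))

  -- Unless γ = δ, the difference is a root, of level 0; its sign decides the direction of the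
  -- comparison.
  acute⇒comparable : ∀ {γ δ} → Δ₁ γ → Δ₁ δ → 0ℤ < ⟨ γ , δ ⟩ → γ ≼' δ ⊎ δ ≼' γ
  acute⇒comparable {γ} {δ} dγ dδ p = by (γ ≟V δ)
    where
    by : Dec (γ ≡ δ) → γ ≼' δ ⊎ δ ≼' γ
    by (yes q) = inj₁ (subst (γ ≼'_) q (≼-refl γ))
    by (no ne) = sign (coherent (root-⊖ (proj₁ dγ) (proj₁ dδ) p ne))
      where
      l0 : ∀ {x y} → Δ₁ x → Δ₁ y → lev (x ⊖ y) ≡ 0ℤ
      l0 {x} {y} dx dy = trans (linFun-⊖ lev-lin x y) (cong₂ _-_ (Δ₁-lev dx) (Δ₁-lev dy))
      neg⊖ : neg (γ ⊖ δ) ≡ δ ⊖ γ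
      neg⊖ = vec-ext λ i → trans (lookup-neg (γ ⊖ δ) i) (trans (cong -_ (lookup-⊖ γ δ i)) (trans (alg (lookup γ i) (lookup δ i)) (sym (lookup-⊖ δ γ i))))
        where
        alg : ∀ x y → - (x - y) ≡ y - x
        alg = solve-∀
      sign : Pos (γ ⊖ δ) ⊎ Neg (γ ⊖ δ) → γ ≼' δ ⊎ δ ≼' γ
      sign (inj₁ q) = inj₂ (≼-diff {δ} {γ} q (l0 dγ dδ))
      sign (inj₂ q) = inj₁ (≼-diff {γ} {δ} (subst Pos neg⊖ (Neg-neg (γ ⊖ δ) q)) (l0 dδ dγ))

  -- Since (γ,δ) + (γ,θ-δ) = (γ,θ) > 0, γ is comparable with δ or with θ-δ.
  no-pairs-in-both : ∀ {I : Vec ℤ n → Set} → (∀ {x y} → Δ₁ x → Δ₁ y → I x → x ≼' y → I y)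
    → ∀ {γ δ} → Δ₁ γ → Δ₁ δ → I γ → I (co γ) → ¬ I δ → ¬ I (co δ) → ⊥
  no-pairs-in-both {I} up {γ} {δ} dγ dδ iγ icγ nδ ncδ = by (0ℤ ℤ.<? ⟨ γ , δ ⟩)
    where
    case : ∀ δ → Δ₁ δ → ¬ I δ → ¬ I (co δ) → 0ℤ < ⟨ γ , δ ⟩ → ⊥
    case δ dδ nδ ncδ p = either (λ q → nδ (up dγ dδ iγ q)) (λ q → ncδ (up (co-Δ₁ dγ) (co-Δ₁ dδ) icγ (≼-co {δ} {γ} q))) (acute⇒comparable dγ dδ p)
    total : ⟨ γ , δ ⟩ + ⟨ γ , co δ ⟩ ≡ T * lev γ
    total = trans (sym (LinFun.add (form-linʳ γ) δ (co δ))) (trans (cong (λ z → ⟨ γ , z ⟩) (⊕-⊖ θ δ)) (form-lev γ))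
    by : Dec (0ℤ < ⟨ γ , δ ⟩) → ⊥
    by (yes p) = case δ dδ nδ ncδ p
    by (no np) = case (co δ) (co-Δ₁ dδ) ncδ (λ i → nδ (subst I (co-co δ) i))
      (ℤP.<-≤-trans (0<-* T>0 (subst (0ℤ <_) (sym (Δ₁-lev dγ)) (+<+ (ℕ.s≤s ℕ.z≤n))))
        (subst₂ _≤_ total (ℤP.+-identityˡ ⟨ γ , co δ ⟩) (ℤP.+-monoˡ-≤ ⟨ γ , co δ ⟩ {⟨ γ , δ ⟩} {0ℤ} (ℤP.≮⇒≥ np))))

  -- The elements of W⁰ and their values at θ.

  W⁰ : List (Fin n) → Set
  W⁰ w = ∀ α → Root α → Pos α → lev α ≡ 0ℤ → Pos (W w α)

  W⁰-neg : ∀ {w} → W⁰ w → ∀ {α} → Root α → Neg α → lev α ≡ 0ℤ → Neg (W w α)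
  W⁰-neg {w} h {α} r p l = Neg-of-neg (W w α) (subst Pos (lin-neg (W-lin w) α) (h (neg α) (root-neg r) (Neg-neg α p) (trans (linFun-neg lev-lin α) (cong -_ l))))

  -- γ - μ is a combination of Π(0), which `w` keeps positive. So the complement of N(w) in Δ(1) is
  -- an upper ideal.
  W⁰-upper : ∀ {w} → W⁰ w → ∀ {μ γ} → μ ≼' γ → Pos (W w μ) → Pos (W w γ)
  W⁰-upper {w} h {μ} {γ} le p = subst Pos (trans (sym (Lin.add (W-lin w) μ (γ ⊖ μ))) (cong (W w) (⊕-⊖ γ μ)))
    (Pos-⊕ (W w μ) (W w (γ ⊖ μ)) p (lin-Pos (W-lin w) (γ ⊖ μ) (λ i → proj₁ (le i)) λ i nz → simple i (nz' i nz)))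
    where
    nz' : ∀ i → lookup (γ ⊖ μ) i ≢ 0ℤ → Π₀ i
    nz' i nz with Π₀? i
    ... | yes p = p
    ... | no np = ⊥-elim (nz (proj₂ (le i) np))
    simple : ∀ i → Π₀ i → Pos (W w (e i))
    simple i z = h (e i) (root-e i) (Pos-e i) (*-cancel (lev (e i)) 0ℤ T>0 (trans (sym (form-lev (e i))) (trans z (sym (ℤP.*-zeroʳ T)))))

  W⁰-determined : ∀ {u w} → W⁰ u → W⁰ w → (∀ γ → Δ₁ γ → (Pos (W u γ) → Pos (W w γ)) × (Pos (W w γ) → Pos (W u γ)))
    → (Pos (W u θ) → Pos (W w θ)) × (Pos (W w θ) → Pos (W u θ)) → ∀ v → W u v ≡ W w v
  W⁰-determined {u} {w} hu hw h₁ h₂ = W-determined u w λ γ r p → by γ r p (lev-cases r p)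
    where
    by : ∀ γ → Root γ → Pos γ → lev γ ≡ 0ℤ ⊎ lev γ ≡ 1ℤ ⊎ γ ≡ θ → (Pos (W u γ) → Pos (W w γ)) × (Pos (W w γ) → Pos (W u γ))
    by γ r p (inj₁ l) = (λ _ → hw γ r p l) , (λ _ → hu γ r p l)
    by γ r p (inj₂ (inj₁ l)) = h₁ γ (lev-Δ₁ r l)
    by γ r p (inj₂ (inj₂ refl)) = h₂

  -- u⁻¹w fixes θ, hence preserves levels. If it made α_i negative, then α_i and its image would
  -- have level 0; `u` would keep that image negative and `w` would keep α_i positive, yet both give
  -- w(α_i).
  W⁰-θ-injective : ∀ {u w} → W⁰ u → W⁰ w → W u θ ≡ W w θ → ∀ v → W u v ≡ W w v
  W⁰-θ-injective {u} {w} hu hw eq v = trans (cong (W u) (sym (trans (sym (W-++ (inv u) w v)) (W-id (inv u ++ w) pos v)))) (W-inv′ u (W w v))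
    where
    pos : ∀ i → Pos (W (inv u ++ w) (e i))
    pos i = subst Pos (sym (W-++ (inv u) w (e i))) (by (coherent rδ))
      where
      δ = W (inv u) (W w (e i))
      rδ : Root δ
      rδ = root-W (inv u) (root-W w (root-e i))
      lδ : lev δ ≡ lev (e i)
      lδ = *-cancel (lev δ) (lev (e i)) T>0 (trans (sym (form-lev δ)) (trans (sym (W-form u δ θ)) (trans (cong₂ ⟨_,_⟩ (W-inv′ u (W w (e i))) eq) (trans (W-form w (e i) θ) (form-lev (e i))))))
      by : Pos δ ⊎ Neg δ → Pos δ
      by (inj₁ p) = p
      by (inj₂ q) = ⊥-elim (Pos∧Neg⇒⊥ (root-W w (root-e i)) (hw (e i) (root-e i) (Pos-e i) l0) (subst Neg (W-inv′ u (W w (e i))) (W⁰-neg {u} hu rδ q (trans lδ l0))))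
        where
        l0 : lev (e i) ≡ 0ℤ
        l0 = ℤP.≤-antisym (subst (_≤ 0ℤ) lδ (lev≤0 δ q)) (lev≥0 (e i) (Pos-e i))

  Long : Vec ℤ n → Set
  Long β = Root β × ⟨ β , β ⟩ ≡ ⟨ θ , θ ⟩

  -- Both θ - β and β pair nonnegatively, so (θ - β, β) ≥ 0; for equal lengths twice this number is
  -- - (θ - β, θ - β).
  dominant-long : ∀ {β} → Long β → (∀ i → 0ℤ ≤ cor i β) → β ≡ θ
  dominant-long {β} (r , nm) dom = sym (⊖≡0 (form-nonneg-zero (θ ⊖ β) (0≤-⇒≤0 (subst (0ℤ ≤_) eq (0≤-+ acute acute)))))
    where
    acute : 0ℤ ≤ ⟨ θ ⊖ β , β ⟩
    acute = subst (0ℤ ≤_) (sym (form-cor (θ ⊖ β) β)) (sumFin-nonneg λ i → 0≤-* (subst (0ℤ ≤_) (sym (lookup-⊖ θ β i)) (≤⇒0≤- (θ-max r i))) (0≤-* (ℤP.<⇒≤ (D>0 i)) (dom i)))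
    alg : ∀ x y → (y - x) + (y - x) ≡ - (x + x - + 2 * y)
    alg = solve-∀
    eq : ⟨ θ ⊖ β , β ⟩ + ⟨ θ ⊖ β , β ⟩ ≡ - ⟨ θ ⊖ β , θ ⊖ β ⟩
    eq = trans (cong (λ z → z + z) (trans (linFun-⊖ (form-linˡ β) θ β) (cong (λ z → ⟨ θ , β ⟩ - z) nm)))
      (trans (alg ⟨ θ , θ ⟩ ⟨ θ , β ⟩) (cong -_ (sym (trans (form-⊖⊖ θ β) (cong (λ z → ⟨ θ , θ ⟩ + z - + 2 * ⟨ θ , β ⟩) nm)))))

  private
    gap≥0 : ∀ {β} → Root β → 0ℤ ≤ height θ - height β
    gap≥0 {β} r = subst (0ℤ ≤_) (linFun-⊖ height-lin θ β) (height-nonneg {v = θ ⊖ β} (λ i → subst (0ℤ ≤_) (sym (lookup-⊖ θ β i)) (≤⇒0≤- (θ-max r i))))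

    -- A simple reflection with negative Cartan integer raises the height, which cannot pass that of
    -- θ. The climb therefore ends at a dominant long root.
    long-conjugate-fuel : ∀ k β → Long β → height θ - height β ≤ + k → ∃ λ w → W w θ ≡ β
    long-conjugate-fuel k β (r , nm) le = by k le (FP.all? (λ i → 0ℤ ℤ.≤? cor i β))
      where
      gap-s : ∀ i → height θ - height (s i β) ≡ height θ - height β + cor i β
      gap-s i = trans (cong (λ z → height θ - z) (trans (linFun-⊖• height-lin β (cor i β) (e i)) (cong (λ z → height β - cor i β * z) (height-e i)))) (alg (height θ) (height β) (cor i β))
        where
        alg : ∀ t b c → t - (b - c * 1ℤ) ≡ t - b + c
        alg = solve-∀
      by : ∀ k → height θ - height β ≤ + k → Dec (∀ i → 0ℤ ≤ cor i β) → ∃ λ w → W w θ ≡ β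
      by k le (yes dom) = [] , sym (dominant-long (r , nm) dom)
      by k le (no nd) = step k le (FP.¬∀⟶∃¬ n (λ i → 0ℤ ≤ cor i β) (λ i → 0ℤ ℤ.≤? cor i β) nd)
        where
        bound : ∀ k i → height θ - height β ≤ + k → ¬ (0ℤ ≤ cor i β) → height θ - height (s i β) ≤ + k - 1ℤ
        bound k i le np = subst (_≤ + k - 1ℤ) (sym (gap-s i)) (ℤP.+-mono-≤ {height θ - height β} {+ k} {cor i β} { - 1ℤ} le
          (0≤-⇒≤ (subst (0ℤ ≤_) (alg (cor i β)) (≤⇒0≤- (0<⇒1≤ (ℤP.neg-mono-< (ℤP.≰⇒> np)))))))
          where
          alg : ∀ c → - c - 1ℤ ≡ - 1ℤ - c
          alg = solve-∀
        step : ∀ k → height θ - height β ≤ + k → (∃ λ i → ¬ (0ℤ ≤ cor i β)) → ∃ λ w → W w θ ≡ β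
        step zero le (i , np) = ⊥-elim (<⇒≱ (ℤ.-<+ {0} {0}) (ℤP.≤-trans (gap≥0 (root-W (i ∷ []) r)) (bound 0 i le np)))
        step (suc k) le (i , np) = let (w , eq) = long-conjugate-fuel k (s i β) (root-W (i ∷ []) r , trans (form-s i β β) nm) (subst (height θ - height (s i β) ≤_) (alg (+ k)) (bound (suc k) i le np))
                                   in i ∷ w , trans (cong (s i) eq) (s-invol i β)
          where
          alg : ∀ k → 1ℤ + k - 1ℤ ≡ k
          alg = solve-∀

    -- Passage to the minimal coset representative: as long as some α_i in Π(0) is made negative,
    -- `w` is replaced by the shorter w s_i, which has the same value at θ because s_i fixes θ.
    W⁰-fuel : ∀ k w → length w ℕ.≤ k → ∃ λ w' → W w' θ ≡ W w θ × (∀ i → Π₀ i → Pos (W w' (e i)))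
    W⁰-fuel k w le = by k le (FP.any? (λ i → _×-dec_ (Π₀? i) (¬? (Pos? (W w (e i))))))
      where
      by : ∀ k → length w ℕ.≤ k → Dec (∃ λ i → Π₀ i × ¬ Pos (W w (e i))) → ∃ λ w' → W w' θ ≡ W w θ × (∀ i → Π₀ i → Pos (W w' (e i)))
      by k le (no none) = w , refl , λ i z → decide i z (Pos? (W w (e i)))
        where
        decide : ∀ i → Π₀ i → Dec (Pos (W w (e i))) → Pos (W w (e i))
        decide i z (yes p) = p
        decide i z (no np) = ⊥-elim (none (i , z , np))
      by zero le (yes (i , z , np)) = ⊥-elim (ℕP.<⇒≱ (subst (0 ℕ.<_) (sym (proj₁ (proj₂ ex))) (ℕ.s≤s ℕ.z≤n)) le)
        where
        ex = exchange w i (¬Pos⇒Neg (root-W w (root-e i)) np)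
      by (suc k) le (yes (i , z , np)) = let (w'' , eq , h) = W⁰-fuel k (proj₁ ex) (ℕP.≤-pred (subst (ℕ._≤ suc k) (proj₁ (proj₂ ex)) le))
                                         in w'' , trans eq (trans (proj₂ (proj₂ ex) θ) (cong (W w) fixed)) , h
        where
        ex = exchange w i (¬Pos⇒Neg (root-W w (root-e i)) np)
        c0 : cor i θ ≡ 0ℤ
        c0 = *-cancel (cor i θ) 0ℤ (D>0 i) (trans (sym (form-e i θ)) (trans z (sym (ℤP.*-zeroʳ (D i)))))
        fixed : s i θ ≡ θ
        fixed = vec-ext λ k → trans (lookup-⊕• θ (cor i θ) (e i) k) (trans (cong (λ c → lookup θ k - c * lookup (e i) k) c0) (alg (lookup θ k) (lookup (e i) k)))
          where
          alg : ∀ t x → t - 0ℤ * x ≡ t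
          alg = solve-∀

  long⇒W⁰ : ∀ {β} → Long β → ∃ λ w → W⁰ w × W w θ ≡ β
  long⇒W⁰ {β} l = w' , h , trans (proj₁ (proj₂ fixedΠ₀)) (proj₂ conj)
    where
    conj = long-conjugate-fuel ℤ.∣ height θ - height β ∣ β l (subst (height θ - height β ≤_) (sym (ℤP.0≤i⇒+∣i∣≡i (gap≥0 (proj₁ l)))) ℤP.≤-refl)
    fixedΠ₀ = W⁰-fuel (length (proj₁ conj)) (proj₁ conj) ℕP.≤-refl
    w' = proj₁ fixedΠ₀
    h : W⁰ w'
    h α r p l0 = lin-Pos (W-lin w') α p λ i nz → proj₂ (proj₂ fixedΠ₀) i (decide i nz (Π₀? i))
      where
      decide : ∀ i → lookup α i ≢ 0ℤ → Dec (Π₀ i) → Π₀ i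
      decide i nz (yes z) = z
      decide i nz (no nΠ) = ⊥-elim (nz (lev0-support α p l0 i nΠ))

-- Ideals, the fibres of τ and the number of antichains.

module Antichains {n : ℕ} (C : CartanData n) (sc : IsSimpleCartan C) (θ : Vec ℤ n) (hθ : IsHighestRoot C θ)
  {h : ℕ} (enum : RootEnumeration C h) where
  open CartanData C
  open Roots C sc
  open CoxeterWords C sc using (app-matOf)
  open Biconvexity C sc
  open Heisenberg C sc θ hθ
  open RootEnumeration enum

  allRoots : List (Vec ℤ n)
  allRoots = L.cartesianProductWith root (allFin h) (allFin n)

  root∈ : ∀ {v} → Root v → v ∈ allRoots
  root∈ {v} r = let (k , j , eq) = root-complete v r in subst (_∈ allRoots) eq (∈P.∈-cartesianProductWith⁺ root (∈P.∈-allFin k) (∈P.∈-allFin j))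

  ∈root : ∀ {v} → v ∈ allRoots → Root v
  ∈root m = let (k , j , _ , _ , eq) = ∈P.∈-cartesianProductWith⁻ root (allFin h) (allFin n) m in subst Root (sym eq) (root-isRoot k j)

  root? : ∀ v → Dec (Root v)
  root? v = map′ ∈root root∈ (v ∈? allRoots)

  longSimple? : ∀ i → Dec (⟨ e i , e i ⟩ ≡ ⟨ θ , θ ⟩)
  longSimple? i = ⟨ e i , e i ⟩ ℤ.≟ ⟨ θ , θ ⟩

  longSimples : List (Fin n)
  longSimples = filter longSimple? (allFin n)

  longSimples-unique : Unique longSimples
  longSimples-unique = UP.filter⁺ longSimple? (UP.allFin⁺ n)

  longs : List (Vec ℤ n)
  longs = L.cartesianProductWith root (allFin h) longSimples

  longs-unique : Unique longs
  longs-unique = UP.cartesianProductWith⁺ root root-injective (UP.allFin⁺ h) longSimples-unique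

  longs-length : length longs ≡ h ℕ.* length longSimples
  longs-length = trans (length-cartesianProductWith root (allFin h) longSimples) (cong (ℕ._* length longSimples) (LP.length-tabulate {n = h} (λ i → i)))

  long∈ : ∀ {v} → Long v → v ∈ longs
  long∈ {v} (r , nm) = let (k , j , eq) = root-complete v r in
    subst (_∈ longs) eq (∈P.∈-cartesianProductWith⁺ root (∈P.∈-allFin k) (∈P.∈-filter⁺ longSimple? (∈P.∈-allFin j)
      (trans (sym (root-norm-e k j)) (trans (cong (λ z → ⟨ z , z ⟩) eq) nm))))

  ∈long : ∀ {v} → v ∈ longs → Long v
  ∈long m = let (k , j , _ , mj , eq) = ∈P.∈-cartesianProductWith⁻ root (allFin h) longSimples m in
    subst Long (sym eq) (root-isRoot k j , trans (root-norm-e k j) (proj₂ (∈P.∈-filter⁻ longSimple? {xs = allFin n} mj)))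

  Δ₁? : ∀ v → Dec (Δ₁ v)
  Δ₁? v = root? v ×-dec (+ 2 * form C v θ ℤ.≟ form C θ θ)

  Δ₁list : List (Vec ℤ n)
  Δ₁list = filter Δ₁? allRoots

  Δ₁list-unique : Unique Δ₁list
  Δ₁list-unique = UP.filter⁺ Δ₁? (UP.cartesianProductWith⁺ root root-injective (UP.allFin⁺ h) (UP.allFin⁺ n))

  Δ₁∈ : ∀ {v} → Δ₁ v → v ∈ Δ₁list
  Δ₁∈ d = ∈P.∈-filter⁺ Δ₁? (root∈ (proj₁ d)) d

  ∈Δ₁ : ∀ {v} → v ∈ Δ₁list → Δ₁ v
  ∈Δ₁ m = proj₂ (∈P.∈-filter⁻ Δ₁? {xs = allRoots} m)

  -- Ideals as complements of inversion sets

  module Ideal (I : Vec ℤ n → Set) (I? : ∀ γ → Dec (I γ)) (up : ∀ {x y} → Δ₁ x → Δ₁ y → I x → x ≼' y → I y) where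
    notI? : ∀ γ → Dec (¬ I γ)
    notI? γ = ¬? (I? γ)

    Lo : List (Vec ℤ n)
    Lo = filter notI? Δ₁list

    Lo⁺ : ∀ {γ} → Δ₁ γ → ¬ I γ → γ ∈ Lo
    Lo⁺ d ni = ∈P.∈-filter⁺ notI? (Δ₁∈ d) ni

    Lo-Δ₁ : ∀ {γ} → γ ∈ Lo → Δ₁ γ
    Lo-Δ₁ m = ∈Δ₁ (proj₁ (∈P.∈-filter⁻ notI? {xs = Δ₁list} m))

    Lo-¬I : ∀ {γ} → γ ∈ Lo → ¬ I γ
    Lo-¬I m = proj₂ (∈P.∈-filter⁻ notI? {xs = Δ₁list} m)

    ∉Lo : ∀ {γ} → γ ∉ Lo → Δ₁ γ → I γ
    ∉Lo {γ} nm d = by (I? γ)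
      where
      by : Dec (I γ) → I γ
      by (yes i) = i
      by (no ni) = ⊥-elim (nm (Lo⁺ d ni))

    Good : List (Fin n) → Set
    Good w = W⁰ w × ∀ γ → Δ₁ γ → (I γ → Pos (W w γ)) × (¬ I γ → Neg (W w γ))

    inversions⇒good : ∀ xs → (∀ {γ} → lev γ ≡ 0ℤ → γ ∉ xs) → (∀ {γ} → Δ₁ γ → γ ∈ xs → γ ∈ Lo) → (∀ {γ} → γ ∈ Lo → γ ∈ xs) → ∃ (Inversions xs) → ∃ Good
    inversions⇒good xs l0 sub sup (w , inv) = w , (λ α r p l → proj₂ (inv α r p) (l0 l)) ,
      λ γ d → (λ i → proj₂ (inv γ (proj₁ d) (Δ₁-Pos d)) (λ m → Lo-¬I (sub d m) i)) , (λ ni → proj₁ (inv γ (proj₁ d) (Δ₁-Pos d)) (sup (Lo⁺ d ni)))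

    1≢0 : ∀ {x : ℤ} → x ≡ 1ℤ → x ≢ 0ℤ
    1≢0 refl ()

    lev-sum : ∀ {β γ k l} → lev (β ⊕ γ) ≡ k → lev β ≡ l → lev γ ≡ k - l
    lev-sum {β} {γ} p q = trans (alg (lev β) (lev γ)) (cong₂ _-_ (trans (sym (LinFun.add lev-lin β γ)) p) q)
      where
      alg : ∀ x y → y ≡ x + y - x
      alg = solve-∀

    -- If the sum has level 1, one summand has level 0 and the other level 1. The latter is in the
    -- ideal and lies below the sum, which would then be in the ideal too. A summand θ would leave
    -- level -1 for the other.
    sum∉Lo : ∀ β γ → Root β → Pos β → Root γ → Pos γ → (Δ₁ β → I β) → (Δ₁ γ → I γ) → (β ⊕ γ) ∉ Lo
    sum∉Lo β γ rβ pβ rγ pγ hβ hγ m = by (lev-cases rβ pβ)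
      where
      dΣ = Lo-Δ₁ m
      ni = Lo-¬I m
      diff : ∀ {x y z : Vec ℤ n} → x ⊕ y ≡ z → Pos x → lev x ≡ 0ℤ → y ≼' z
      diff {x} {y} {z} p px lx = ≼-diff {y} {z} (subst Pos x≡ px) (trans (cong lev (sym x≡)) lx)
        where
        x≡ : x ≡ z ⊖ y
        x≡ = ⊕⇒⊖ (trans (⊕-comm y x) p)
      by : lev β ≡ 0ℤ ⊎ lev β ≡ 1ℤ ⊎ β ≡ θ → ⊥
      by (inj₁ l) = ni (up dγ dΣ (hγ dγ) (diff {β} {γ} refl pβ l))
        where
        dγ = lev-Δ₁ rγ (lev-sum {β} {γ} (Δ₁-lev dΣ) l)
      by (inj₂ (inj₁ l)) = ni (up dβ dΣ (hβ dβ) (diff {γ} {β} (⊕-comm γ β) pγ (lev-sum {β} {γ} (Δ₁-lev dΣ) l)))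
        where
        dβ = lev-Δ₁ rβ l
      by (inj₂ (inj₂ q)) = <⇒≱ (ℤ.-<+ {0} {0}) (subst (0ℤ ≤_) (lev-sum {β} {γ} (Δ₁-lev dΣ) (trans (cong lev q) lev-θ)) (lev≥0 γ pγ))

    Δ₁-sum : ∀ {β γ} → Δ₁ β → Δ₁ γ → Root (β ⊕ γ) → β ⊕ γ ≡ θ
    Δ₁-sum {β} {γ} dβ dγ r = lev≥2⇒θ r (ℤP.≤-reflexive (sym (trans (LinFun.add lev-lin β γ) (cong₂ _+_ (Δ₁-lev dβ) (Δ₁-lev dγ)))))

    θ-sum : ∀ {γ} → Root γ → Pos γ → ¬ Root (θ ⊕ γ)
    θ-sum {γ} r p rs = root-≢0 r (trans (⊕⇒⊖ eq) (vec-ext λ i → trans (lookup-⊖ θ θ i) (trans (ℤP.+-inverseʳ (lookup θ i)) (sym (lookup-0 i)))))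
      where
      eq : θ ⊕ γ ≡ θ
      eq = lev≥2⇒θ rs (subst (+ 2 ≤_) (sym (LinFun.add lev-lin θ γ)) (subst (λ z → + 2 ≤ z + lev γ) (sym lev-θ) (ℤP.+-monoʳ-≤ (+ 2) (lev≥0 γ p))))

    Lo-pos : AllPos Lo
    Lo-pos m = proj₁ (Lo-Δ₁ m) , Δ₁-Pos (Lo-Δ₁ m)

    -- The complement Lo of I is biconvex unless it contains a pair δ, θ-δ; in that case I
    -- contains no such pair, and adjoining θ to Lo makes it biconvex.
    word : ∃ Good
    word = by (Any.any? (λ δ → co δ ∈? Lo) Lo)
      where
      by : Dec (Any (λ δ → co δ ∈ Lo) Lo) → ∃ Good
      by (no none) = inversions⇒good Lo (λ l m → 1≢0 (Δ₁-lev (Lo-Δ₁ m)) l) (λ _ m → m) (λ m → m)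
        (biconvex⇒inversions Lo Lo-pos
          (λ β γ mβ mγ r → ⊥-elim (none (lose mβ (subst (_∈ Lo) (⊕⇒⊖ (Δ₁-sum (Lo-Δ₁ mβ) (Lo-Δ₁ mγ) r)) mγ))))
          (λ β γ rβ pβ rγ pγ r nβ nγ → sum∉Lo β γ rβ pβ rγ pγ (∉Lo nβ) (∉Lo nγ)))
      by (yes pair) = inversions⇒good (θ ∷ Lo) l0 sub there (biconvex⇒inversions (θ ∷ Lo) pos cl cocl)
        where
        δ = proj₁ (find pair)
        mδ = proj₁ (proj₂ (find pair))
        mcδ = proj₂ (proj₂ (find pair))
        l0 : ∀ {γ} → lev γ ≡ 0ℤ → γ ∉ θ ∷ Lo
        l0 l (here refl) with () ← trans (sym lev-θ) l
        l0 l (there m) = 1≢0 (Δ₁-lev (Lo-Δ₁ m)) l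
        sub : ∀ {γ} → Δ₁ γ → γ ∈ θ ∷ Lo → γ ∈ Lo
        sub d (here refl) with () ← trans (sym lev-θ) (Δ₁-lev d)
        sub d (there m) = m
        pos : AllPos (θ ∷ Lo)
        pos (here refl) = rθ , Pos-θ
        pos (there m) = Lo-pos m
        cl : SumClosed (θ ∷ Lo)
        cl β γ (here refl) mγ r = ⊥-elim (θ-sum (proj₁ (pos mγ)) (proj₂ (pos mγ)) r)
        cl β γ (there mβ) (here refl) r = ⊥-elim (θ-sum (proj₁ (Lo-pos mβ)) (proj₂ (Lo-pos mβ)) (subst Root (⊕-comm β θ) r))
        cl β γ (there mβ) (there mγ) r = here (Δ₁-sum (Lo-Δ₁ mβ) (Lo-Δ₁ mγ) r)
        cocl : SumCoclosed (θ ∷ Lo)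
        cocl β γ rβ pβ rγ pγ r nβ nγ (there m) = sum∉Lo β γ rβ pβ rγ pγ (∉Lo (λ q → nβ (there q))) (∉Lo (λ q → nγ (there q))) m
        cocl β γ rβ pβ rγ pγ r nβ nγ (here eq) = no-pairs-in-both {I} up dβ (Lo-Δ₁ mδ) (∉Lo (λ q → nβ (there q)) dβ)
            (subst I (⊕⇒⊖ eq) (∉Lo (λ q → nγ (there q)) (sum-θ′ rβ rγ eq))) (Lo-¬I mδ) (Lo-¬I mcδ)
          where
          dβ = sum-θ rβ rγ eq

  module Minimal (P : Vec ℤ n → Set) (P? : ∀ γ → Dec (P γ)) (P-Δ₁ : ∀ {γ} → P γ → Δ₁ γ) where
    private
      pred-bound : ∀ k {x} → x < + suc k → x ≤ + k
      pred-bound k lt = ℤP.i<j⇒i≤pred[j] lt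

      below-fuel : ∀ k γ → P γ → height γ ≤ + k → ∃ λ g → MinOf C θ P g × g ≼' γ
      below-fuel k γ p le = by k le (Any.any? (λ μ → P? μ ×-dec (≼? μ γ ×-dec ¬? (μ ≟V γ))) Δ₁list)
        where
        lower : ∀ {μ} → P μ → μ ≼' γ → μ ≢ γ → height μ < height γ
        lower {μ} pμ l ne = ℤP.≰⇒> λ q → ne (sym (⊖≡0 (vec-ext λ i → trans (sumFin-nonneg-zero (λ i → proj₁ (l i))
            (subst (_≤ 0ℤ) (sym (linFun-⊖ height-lin γ μ)) (ℤP.i≤j⇒i-j≤0 q)) i) (sym (lookup-0 i)))))
        by : ∀ k → height γ ≤ + k → Dec (Any (λ μ → P μ × μ ≼' γ × μ ≢ γ) Δ₁list) → ∃ λ g → MinOf C θ P g × g ≼' γ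
        by k le (no none) = γ , (p , minimal) , ≼-refl γ
          where
          minimal : ∀ μ → P μ → μ ≼' γ → μ ≡ γ
          minimal μ pμ l = dec (μ ≟V γ)
            where
            dec : Dec (μ ≡ γ) → μ ≡ γ
            dec (yes q) = q
            dec (no ne) = ⊥-elim (none (lose (Δ₁∈ (P-Δ₁ pμ)) (pμ , l , ne)))
        by zero le (yes q) = let (μ , _ , pμ , l , ne) = find q in
          ⊥-elim (<⇒≱ (lower pμ l ne) (ℤP.≤-trans le (height-nonneg {v = μ} (Δ₁-Pos (P-Δ₁ pμ)))))
        by (suc k) le (yes q) = let (μ , _ , pμ , l , ne) = find q
                                    (g , mg , lg) = below-fuel k μ pμ (pred-bound k (ℤP.<-≤-trans (lower pμ l ne) le))
                                in g , mg , ≼-trans {g} {μ} {γ} lg l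

    below : ∀ {γ} → P γ → ∃ λ g → MinOf C θ P g × g ≼' γ
    below {γ} p = below-fuel ℤ.∣ height γ ∣ γ p (ℤP.≤-reflexive (sym (ℤP.0≤i⇒+∣i∣≡i (height-nonneg {v = γ} (Δ₁-Pos (P-Δ₁ p))))))

    minOf? : ∀ γ → Dec (MinOf C θ P γ)
    minOf? γ = map′ (λ { (p , m) → p , λ μ pμ l → All.lookup m (Δ₁∈ (P-Δ₁ pμ)) pμ l }) (λ { (p , m) → p , All.tabulate (λ {μ} _ → m μ) })
      (P? γ ×-dec All.all? (λ μ → P? μ →-dec (≼? μ γ →-dec (μ ≟V γ))) Δ₁list)

    mins : List (Vec ℤ n)
    mins = filter minOf? Δ₁list

    mins-represents : Represents mins (MinOf C θ P)
    mins-represents x = (λ m → proj₂ (∈P.∈-filter⁻ minOf? {xs = Δ₁list} m)) , (λ m → ∈P.∈-filter⁺ minOf? (Δ₁∈ (P-Δ₁ (proj₁ m))) m)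

    mins-antichain : Antichain C θ mins
    mins-antichain = All.tabulate (λ {x} m → P-Δ₁ (proj₁ (proj₁ (mins-represents x) m))) ,
      λ x y mx my l → proj₂ (proj₁ (mins-represents y) my) x (proj₁ (proj₁ (mins-represents x) mx)) l

  -- The fibres of τ

  Iᵂ : List (Fin n) → Vec ℤ n → Set
  Iᵂ w = Iw C θ (matOf C w)

  Γᵂ : List (Fin n) → Vec ℤ n → Set
  Γᵂ w = Γw C θ (matOf C w)

  I⇒Pos : ∀ w {γ} → Iᵂ w γ → Pos (W w γ)
  I⇒Pos w {γ} (d , nn) = by (coherent (root-W w (proj₁ d)))
    where
    by : Pos (W w γ) ⊎ Neg (W w γ) → Pos (W w γ)
    by (inj₁ p) = p
    by (inj₂ q) = ⊥-elim (nn ((proj₁ d , Δ₁-Pos d) , subst (NegRoot C) (sym (app-matOf w γ)) (root-W w (proj₁ d) , q)))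

  Pos⇒I : ∀ w {γ} → Δ₁ γ → Pos (W w γ) → Iᵂ w γ
  Pos⇒I w {γ} d p = d , λ { (_ , ng) → Pos∧Neg⇒⊥ (root-W w (proj₁ d)) p (proj₂ (subst (NegRoot C) (app-matOf w γ) ng)) }

  I? : ∀ w γ → Dec (Iᵂ w γ)
  I? w γ = map′ (λ { (d , p) → Pos⇒I w d p }) (λ i → proj₁ i , I⇒Pos w i) (Δ₁? γ ×-dec Pos? (W w γ))

  module Min (w : List (Fin n)) = Minimal (Iᵂ w) (I? w) proj₁

  W0⇒W⁰ : ∀ {w} → W0 C θ (matOf C w) → W⁰ w
  W0⇒W⁰ {w} (_ , f) α r p l = subst Pos (app-matOf w α) (proj₂ (f α ((r , p) , trans (form-lev α) (trans (cong (T *_) l) (ℤP.*-zeroʳ T)))))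

  W⁰⇒W0 : ∀ w → W⁰ w → W0 C θ (matOf C w)
  W⁰⇒W0 w f = (w , refl) , λ { α ((r , p) , z) → subst (PosRoot C) (sym (app-matOf w α))
    (root-W w r , f α r p (*-cancel (lev α) 0ℤ T>0 (trans (sym (form-lev α)) (trans z (sym (ℤP.*-zeroʳ T)))))) }

  Up⇒I : ∀ {w} → W⁰ w → ∀ {x} → Up C θ (Γᵂ w) x → Iᵂ w x
  Up⇒I {w} hw {x} (d , g , mg , l) = Pos⇒I w d (W⁰-upper {w} hw {g} {x} l (I⇒Pos w (proj₁ mg)))

  I⇒Up : ∀ {w x} → Iᵂ w x → Up C θ (Γᵂ w) x
  I⇒Up {w} i = proj₁ i , Min.below w i

  Agree : List (Fin n) → List (Fin n) → Set
  Agree u w = ∀ γ → Δ₁ γ → (Pos (W u γ) → Pos (W w γ)) × (Pos (W w γ) → Pos (W u γ))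

  SameΓ : List (Fin n) → List (Fin n) → Set
  SameΓ u w = ∀ x → (Γᵂ u x → Γᵂ w x) × (Γᵂ w x → Γᵂ u x)

  -- The minimal elements generate the ideal, and the ideal records the signs of the element on
  -- Δ(1).
  sameΓ⇒agree : ∀ {u w} → W⁰ u → W⁰ w → SameΓ u w → Agree u w
  sameΓ⇒agree {u} {w} hu hw same γ d =
    (λ p → I⇒Pos w (Up⇒I {w} hw (move (λ x → proj₁ (same x)) (I⇒Up {u} (Pos⇒I u d p))))) ,
    (λ p → I⇒Pos u (Up⇒I {u} hu (move (λ x → proj₂ (same x)) (I⇒Up {w} (Pos⇒I w d p)))))
    where
    move : ∀ {P Q : Vec ℤ n → Set} → (∀ x → P x → Q x) → Up C θ P γ → Up C θ Q γ
    move f (d , g , pg , l) = d , g , f g pg , l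

  agree⇒sameΓ : ∀ {u w} → Agree u w → SameΓ u w
  agree⇒sameΓ {u} {w} ag x = move u w (λ γ d → proj₁ (ag γ d)) (λ γ d → proj₂ (ag γ d)) , move w u (λ γ d → proj₂ (ag γ d)) (λ γ d → proj₁ (ag γ d))
    where
    move : ∀ u w → (∀ γ → Δ₁ γ → Pos (W u γ) → Pos (W w γ)) → (∀ γ → Δ₁ γ → Pos (W w γ) → Pos (W u γ)) → Γᵂ u x → Γᵂ w x
    move u w f g (i , m) = Pos⇒I w (proj₁ i) (f x (proj₁ i) (I⇒Pos u i)) , λ μ iμ l → m μ (Pos⇒I u (proj₁ iμ) (g μ (proj₁ iμ) (I⇒Pos w iμ))) l

  -- Of γ and θ - γ exactly one belongs to I_w. The Lagrangian condition, the value w(θ) and the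
  -- fibre of τ are each compared with this condition.
  NoPair : List (Fin n) → Set
  NoPair w = ∀ γ → Δ₁ γ → (Pos (W w γ) → ¬ Pos (W w (co γ))) × (¬ Pos (W w γ) → Pos (W w (co γ)))

  SimpleImage : List (Fin n) → Set
  SimpleImage w = ±Πl C θ (W w θ)

  pair-sum : ∀ w γ → W w γ ⊕ W w (co γ) ≡ W w θ
  pair-sum w γ = trans (sym (Lin.add (W-lin w) γ (co γ))) (cong (W w) (⊕-⊖ θ γ))

  -- If both roots are positive, their coordinates other than the i-th vanish, and one of the i-th
  -- coordinates does, as they add up to 1; that root would be zero. Two negative roots cannot
  -- produce the coordinate 1.
  sum-simple : ∀ {u v i} → Root u → Root v → u ⊕ v ≡ e i → (Pos u → ¬ Pos v) × (¬ Pos u → Pos v)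
  sum-simple {u} {v} {i} ru rv eq = both-pos , not-neg
    where
    coord : ∀ k → lookup u k + lookup v k ≡ lookup (e i) k
    coord k = trans (sym (lookup-⊕ u v k)) (cong (λ z → lookup z k) eq)
    split1 : ∀ x y → 0ℤ ≤ x → 0ℤ ≤ y → x + y ≡ 1ℤ → x ≡ 0ℤ ⊎ y ≡ 0ℤ
    split1 (+ zero) y _ _ _ = inj₁ refl
    split1 (+ suc x) (+ zero) _ _ _ = inj₂ refl
    split1 (+ suc x) (+ suc y) _ _ p with () ← trans (sym (ℕP.+-suc x y)) (ℕP.suc-injective (ℤP.+-injective p))
    zeroes : ∀ {u v} → Pos u → Pos v → (∀ k → lookup u k + lookup v k ≡ lookup (e i) k) → lookup u i ≡ 0ℤ → u ≡ zeroV
    zeroes {u} {v} pu pv c z = vec-ext λ k → by k (i F.≟ k)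
      where
      by : ∀ k → Dec (i ≡ k) → lookup u k ≡ lookup zeroV k
      by k (yes refl) = trans z (sym (lookup-0 k))
      by k (no ne) = trans (ℤP.≤-antisym (subst₂ _≤_ (ℤP.+-identityʳ (lookup u k)) (trans (c k) (lookup-e-diff ne)) (ℤP.+-monoʳ-≤ (lookup u k) (pv k))) (pu k)) (sym (lookup-0 k))
    both-pos : Pos u → ¬ Pos v
    both-pos pu pv = either (λ z → root-≢0 ru (zeroes {u} {v} pu pv coord z))
      (λ z → root-≢0 rv (zeroes {v} {u} pv pu (λ k → trans (ℤP.+-comm (lookup v k) (lookup u k)) (coord k)) z))
      (split1 (lookup u i) (lookup v i) (pu i) (pv i) (trans (coord i) (lookup-e-same i)))
    not-neg : ¬ Pos u → Pos v
    not-neg nu = either (λ p → p) (λ nv → ⊥-elim (<⇒≱ (+<+ (ℕ.s≤s ℕ.z≤n)) (subst (_≤ 0ℤ) (trans (coord i) (lookup-e-same i)) (ℤP.+-mono-≤ (¬Pos⇒Neg ru nu i) (nv i))))) (coherent rv)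

  neg-⊕ : ∀ (u v : Vec ℤ n) → neg (u ⊕ v) ≡ neg u ⊕ neg v
  neg-⊕ u v = vec-ext λ k → trans (lookup-neg (u ⊕ v) k) (trans (cong -_ (lookup-⊕ u v k)) (trans (ℤP.neg-distrib-+ (lookup u k) (lookup v k))
    (sym (trans (lookup-⊕ (neg u) (neg v) k) (cong₂ _+_ (lookup-neg u k) (lookup-neg v k))))))

  ¬Pos-neg⇒Pos : ∀ {v} → Root v → ¬ Pos (neg v) → Pos v
  ¬Pos-neg⇒Pos {v} r np = Pos-of-neg v (¬Pos⇒Neg (root-neg r) np)

  ¬Pos⇒Pos-neg : ∀ {v} → Root v → ¬ Pos v → Pos (neg v)
  ¬Pos⇒Pos-neg {v} r np = Neg-neg v (¬Pos⇒Neg r np)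

  Pos-neg⇒¬Pos : ∀ {v} → Root v → Pos (neg v) → ¬ Pos v
  Pos-neg⇒¬Pos {v} r p q = Pos∧Neg⇒⊥ r q (Neg-of-neg v p)

  simple⇒noPair : ∀ w → SimpleImage w → NoPair w
  simple⇒noPair w (inj₁ (i , eq , _)) γ d = sum-simple {i = i} (root-W w (proj₁ d)) (root-W w (proj₁ (co-Δ₁ d))) (trans (pair-sum w γ) eq)
  simple⇒noPair w (inj₂ (i , eq , _)) γ d =
    (λ p → Pos-neg⇒¬Pos rc (proj₂ flipped (λ q → Pos-neg⇒¬Pos rγ q p))) ,
    (λ np → ¬Pos-neg⇒Pos rc (proj₁ flipped (¬Pos⇒Pos-neg rγ np)))
    where
    rγ = root-W w (proj₁ d)
    rc = root-W w (proj₁ (co-Δ₁ d))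
    flipped = sum-simple {i = i} (root-neg rγ) (root-neg rc) (trans (sym (neg-⊕ (W w γ) (W w (co γ)))) (trans (cong neg (pair-sum w γ)) eq))

  -- A decomposition of w(θ) into two roots pulls back to some γ and θ - γ, so its members have
  -- opposite signs. A positive root that is not simple would split into two positive ones; a
  -- negative w(θ) is handled through its opposite.
  noPair⇒simple : ∀ w → NoPair w → SimpleImage w
  noPair⇒simple w np = by (coherent rβ)
    where
    β = W w θ
    rβ : Root β
    rβ = root-W w rθ
    nβ : ⟨ β , β ⟩ ≡ ⟨ θ , θ ⟩
    nβ = W-form w θ θ
    decomp : ∀ {u v} → Root u → Root v → u ⊕ v ≡ β → (Pos u → ¬ Pos v) × (¬ Pos u → Pos v)
    decomp {u} {v} ru rv eq = subst₂ (λ x y → (Pos x → ¬ Pos y) × (¬ Pos x → Pos y)) (W-inv′ w u) (trans (cong (W w) (sym (⊕⇒⊖ sum))) (W-inv′ w v)) (np γ (sum-θ rγ (root-W (inv w) rv) sum))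
      where
      γ = W (inv w) u
      rγ : Root γ
      rγ = root-W (inv w) ru
      sum : γ ⊕ W (inv w) v ≡ θ
      sum = trans (sym (Lin.add (W-lin (inv w)) u v)) (trans (cong (W (inv w)) eq) (W-inv w θ))
    simple : ∀ β → Root β → Pos β → (∀ {u v} → Root u → Root v → Pos u → Pos v → u ⊕ v ≡ β → ⊥) → ∃ λ i → β ≡ e i
    simple β r p indec = dec (FP.any? (λ i → β ≟V e i))
      where
      dec : Dec (∃ λ i → β ≡ e i) → ∃ λ i → β ≡ e i
      dec (yes q) = q
      dec (no nq) = let (i , r' , p') = nonsimple-⊖ r p (λ i q → nq (i , q)) in
        ⊥-elim (indec (root-e i) r' (Pos-e i) p' (⊕-⊖ β (e i)))
    by : Pos β ⊎ Neg β → SimpleImage w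
    by (inj₁ p) = let (i , eq) = simple β rβ p (λ ru rv pu pv eq → proj₁ (decomp ru rv eq) pu pv) in
      inj₁ (i , eq , trans (cong (λ z → ⟨ z , z ⟩) (sym eq)) nβ)
    by (inj₂ q) = let (i , eq) = simple (neg β) (root-neg rβ) (Neg-neg β q) (λ {u} {v} ru rv pu pv eq →
                          Pos-neg⇒¬Pos (root-neg rv) (subst Pos (sym (neg-neg v)) pv) (proj₂ (decomp (root-neg ru) (root-neg rv) (trans (sym (neg-⊕ u v)) (trans (cong neg eq) (neg-neg β))))
                            (Pos-neg⇒¬Pos (root-neg ru) (subst Pos (sym (neg-neg u)) pu)))) in
      inj₂ (i , eq , trans (cong (λ z → ⟨ z , z ⟩) (sym eq)) (trans (linFun-neg (form-linˡ (neg β)) β) (trans (cong -_ (linFun-neg (form-linʳ β) β)) (trans (ℤP.neg-involutive ⟨ β , β ⟩) nβ))))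

  θword : List (Fin n)
  θword = rootWord rθ

  sθ≡ : matOf C θword ≡ sθ C θ
  sθ≡ = VP.tabulate-cong λ i → trans (W-rootWord rθ (e i)) (cong (λ z → e i ⊖ (z • θ)) (sym (trans (cong₂ divℤ (trans (cong (+ 2 *_) (form-lev (e i))) (alg T (lev (e i)))) (root-norm rθ))
      (divℤ-exact (lev (e i)) (0<-* {+ 2} {T} (+<+ (ℕ.s≤s ℕ.z≤n)) T>0)))))
    where
    alg : ∀ t l → + 2 * (t * l) ≡ l * (+ 2 * t)
    alg = solve-∀

  partner : List (Fin n) → List (Fin n)
  partner w = w ++ θword

  matOf-partner : ∀ w → compose (matOf C w) (sθ C θ) ≡ matOf C (partner w)
  matOf-partner w = trans (cong (compose (matOf C w)) (sym sθ≡)) (VP.tabulate-cong λ i →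
    trans (cong (app (matOf C w)) (VP.lookup∘tabulate (λ i → W θword (e i)) i)) (trans (app-matOf w (W θword (e i))) (sym (W-++ w θword (e i)))))

  W-partner : ∀ w x → W (partner w) x ≡ W w (x ⊖ (lev x • θ))
  W-partner w x = trans (W-++ w θword x) (cong (W w) (W-rootWord rθ x))

  W-partner-Δ₁ : ∀ w {γ} → Δ₁ γ → W (partner w) γ ≡ neg (W w (co γ))
  W-partner-Δ₁ w {γ} d = trans (W-partner w γ) (trans (cong (W w) (refl-θ (Δ₁-lev d))) (lin-neg (W-lin w) (co γ)))

  W-partner-θ : ∀ w → W (partner w) θ ≡ neg (W w θ)
  W-partner-θ w = trans (W-partner w θ) (trans (cong (W w) eq) (lin-neg (W-lin w) θ))
    where
    alg : ∀ t → t - + 2 * t ≡ - t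
    alg = solve-∀
    eq : θ ⊖ (lev θ • θ) ≡ neg θ
    eq = vec-ext λ i → trans (lookup-⊕• θ (lev θ) θ i) (trans (cong (λ z → lookup θ i - z * lookup θ i) lev-θ) (trans (alg (lookup θ i)) (sym (lookup-neg θ i))))

  W⁰-partner : ∀ {w} → W⁰ w → W⁰ (partner w)
  W⁰-partner {w} hw α r p l = subst Pos (sym (trans (W-partner w α) (cong (W w) eq))) (hw α r p l)
    where
    alg : ∀ x t → x - 0ℤ * t ≡ x
    alg = solve-∀
    eq : α ⊖ (lev α • θ) ≡ α
    eq = vec-ext λ i → trans (lookup-⊕• α (lev α) θ i) (trans (cong (λ z → lookup α i - z * lookup θ i) l) (alg (lookup α i) (lookup θ i)))

  -- w s_θ sends γ to - w(θ - γ), which is positive precisely when w(θ - γ) is negative, and under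
  -- `NoPair` that means w(γ) is positive.
  partner-agree : ∀ w → NoPair w → Agree w (partner w)
  partner-agree w np γ d =
    (λ p → subst Pos (sym (W-partner-Δ₁ w d)) (¬Pos⇒Pos-neg rc (proj₁ (np γ d) p))) ,
    (λ p → by (Pos-neg⇒¬Pos rc (subst Pos (W-partner-Δ₁ w d) p)) (Pos? (W w γ)))
    where
    rc = root-W w (proj₁ (co-Δ₁ d))
    by : ¬ Pos (W w (co γ)) → Dec (Pos (W w γ)) → Pos (W w γ)
    by nc (yes p) = p
    by nc (no q) = ⊥-elim (nc (proj₂ (np γ d) q))

  agree-partner⇒noPair : ∀ w → Agree w (partner w) → NoPair w
  agree-partner⇒noPair w ag γ d =
    (λ p → Pos-neg⇒¬Pos rc (subst Pos (W-partner-Δ₁ w d) (proj₁ (ag γ d) p))) ,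
    (λ q → ¬Pos-neg⇒Pos rc λ p → q (proj₂ (ag γ d) (subst Pos (sym (W-partner-Δ₁ w d)) p)))
    where
    rc = root-W w (proj₁ (co-Δ₁ d))

  -- If u(θ) and w(θ) have the same sign, the two elements agree on all positive roots. If the signs
  -- differ, a pair γ, θ - γ with equal signs would force the same sign on both u(θ) and w(θ); so
  -- there is no such pair, and w s_θ is the other element with this ideal.
  fibre : ∀ {u w} → W⁰ u → W⁰ w → Agree w u → (∀ v → W u v ≡ W w v) ⊎ NoPair w × (∀ v → W u v ≡ W (partner w) v)
  fibre {u} {w} hu hw ag = by (Pos? (W u θ)) (Pos? (W w θ))
    where
    ag' : Agree u w
    ag' γ d = proj₂ (ag γ d) , proj₁ (ag γ d)
    opposite : ((Pos (W u θ) → ¬ Pos (W w θ)) × (¬ Pos (W u θ) → Pos (W w θ))) → NoPair w × (∀ v → W u v ≡ W (partner w) v)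
    opposite (op₁ , op₂) = np , W⁰-determined {u} {partner w} hu (W⁰-partner {w} hw)
        (λ γ d → (λ p → proj₁ (partner-agree w np γ d) (proj₁ (ag' γ d) p)) , (λ p → proj₂ (ag' γ d) (proj₂ (partner-agree w np γ d) p)))
        ((λ p → subst Pos (sym (W-partner-θ w)) (¬Pos⇒Pos-neg (root-W w rθ) (op₁ p))) ,
         (λ p → decide (Pos? (W u θ)) (Pos-neg⇒¬Pos (root-W w rθ) (subst Pos (W-partner-θ w) p))))
      where
      decide : Dec (Pos (W u θ)) → ¬ Pos (W w θ) → Pos (W u θ)
      decide (yes p) _ = p
      decide (no q) nw = ⊥-elim (nw (op₂ q))
      posθ : ∀ x {γ} → Pos (W x γ) → Pos (W x (co γ)) → Pos (W x θ)
      posθ x {γ} p q = subst Pos (pair-sum x γ) (Pos-⊕ (W x γ) (W x (co γ)) p q)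
      negθ : ∀ x {γ} → Δ₁ γ → ¬ Pos (W x γ) → ¬ Pos (W x (co γ)) → ¬ Pos (W x θ)
      negθ x {γ} d p q r = Pos∧Neg⇒⊥ (root-W x rθ) r (subst Neg (pair-sum x γ) λ i → subst (_≤ 0ℤ) (sym (lookup-⊕ (W x γ) (W x (co γ)) i))
        (ℤP.+-mono-≤ (¬Pos⇒Neg (root-W x (proj₁ d)) p i) (¬Pos⇒Neg (root-W x (proj₁ (co-Δ₁ d))) q i)))
      np : NoPair w
      np γ d = (λ p q → op₁ (posθ u {γ} (proj₁ (ag γ d) p) (proj₁ (ag (co γ) (co-Δ₁ d)) q)) (posθ w {γ} p q)) , λ p → dec p (Pos? (W w (co γ)))
        where
        dec : ¬ Pos (W w γ) → Dec (Pos (W w (co γ))) → Pos (W w (co γ))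
        dec p (yes q) = q
        dec p (no q) = ⊥-elim (negθ w d p q (op₂ (negθ u d (λ x → p (proj₂ (ag γ d) x)) (λ x → q (proj₂ (ag (co γ) (co-Δ₁ d)) x)))))
    by : Dec (Pos (W u θ)) → Dec (Pos (W w θ)) → (∀ v → W u v ≡ W w v) ⊎ NoPair w × (∀ v → W u v ≡ W (partner w) v)
    by (yes p) (yes q) = inj₁ (W⁰-determined {u} {w} hu hw ag' ((λ _ → q) , (λ _ → p)))
    by (no p) (no q) = inj₁ (W⁰-determined {u} {w} hu hw ag' ((λ x → ⊥-elim (p x)) , (λ x → ⊥-elim (q x))))
    by (yes p) (no q) = inj₂ (opposite ((λ _ → q) , (λ np → ⊥-elim (np p))))
    by (no p) (yes q) = inj₂ (opposite ((λ x → ⊥-elim (p x)) , (λ _ → q)))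

  -- Lagrangian subsets

  module Halves (w : List (Fin n)) where
    pos? : ∀ γ → Dec (Pos (W w γ))
    pos? γ = Pos? (W w γ)

    Is Ls : List (Vec ℤ n)
    Is = filter pos? Δ₁list
    Ls = filter (λ γ → ¬? (pos? γ)) Δ₁list

    Is⁻ : ∀ {γ} → γ ∈ Is → Δ₁ γ × Pos (W w γ)
    Is⁻ m = let (a , b) = ∈P.∈-filter⁻ pos? {xs = Δ₁list} m in ∈Δ₁ a , b

    Ls⁻ : ∀ {γ} → γ ∈ Ls → Δ₁ γ × ¬ Pos (W w γ)
    Ls⁻ m = let (a , b) = ∈P.∈-filter⁻ (λ γ → ¬? (pos? γ)) {xs = Δ₁list} m in ∈Δ₁ a , b

    Is⁺ : ∀ {γ} → Δ₁ γ → Pos (W w γ) → γ ∈ Is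
    Is⁺ d p = ∈P.∈-filter⁺ pos? (Δ₁∈ d) p

    Ls⁺ : ∀ {γ} → Δ₁ γ → ¬ Pos (W w γ) → γ ∈ Ls
    Ls⁺ d p = ∈P.∈-filter⁺ (λ γ → ¬? (pos? γ)) (Δ₁∈ d) p

    coIs coLs : List (Vec ℤ n)
    coIs = L.map co Is
    coLs = L.map co Ls

    co-inj : ∀ {x y} → x ≢ y → co x ≢ co y
    co-inj {x} {y} ne p = ne (trans (sym (co-co x)) (trans (cong co p) (co-co y)))

    Is-unique : Unique Is
    Is-unique = UP.filter⁺ pos? Δ₁list-unique

    coIs-unique : Unique coIs
    coIs-unique = allPairs-map (λ _ _ → co-inj) Is-unique

    coLs-unique : Unique coLs
    coLs-unique = allPairs-map (λ _ _ → co-inj) (UP.filter⁺ (λ γ → ¬? (pos? γ)) Δ₁list-unique)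

    total : length Is ℕ.+ length Ls ≡ length Δ₁list
    total = length-filter-split pos? Δ₁list

    coIs⊆Ls : (∀ γ → Δ₁ γ → Pos (W w γ) → ¬ Pos (W w (co γ))) → ∀ {γ} → γ ∈ coIs → γ ∈ Ls
    coIs⊆Ls noI m = let (x , mx , eq) = ∈P.∈-map⁻ co m
                        (d , p) = Is⁻ mx in subst (_∈ Ls) (sym eq) (Ls⁺ (co-Δ₁ d) (noI x d p))

    coLs⊆Is : (∀ γ → Δ₁ γ → ¬ Pos (W w γ) → Pos (W w (co γ))) → ∀ {γ} → γ ∈ coLs → γ ∈ Is
    coLs⊆Is noL m = let (x , mx , eq) = ∈P.∈-map⁻ co m
                        (d , p) = Ls⁻ mx in subst (_∈ Is) (sym eq) (Is⁺ (co-Δ₁ d) (noL x d p))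

    Δ₁-card : Card Δ₁ (length Δ₁list)
    Δ₁-card = Δ₁list , refl , All.tabulate ∈Δ₁ , Δ₁list-unique , λ x → Δ₁∈

    -- `S` stands for either description of the ideal, `Up` of the minimal elements or `Iw`, since
    -- the Lagrangian condition is stated for both.
    module _ (S : Vec ℤ n → Set) (to : ∀ {γ} → S γ → Iᵂ w γ) (from : ∀ {γ} → Iᵂ w γ → S γ) where
      S-card : Card S (length Is)
      S-card = Is , refl , All.tabulate (λ m → from (Pos⇒I w (proj₁ (Is⁻ m)) (proj₂ (Is⁻ m)))) , Is-unique , λ x sx → Is⁺ (proj₁ (to sx)) (I⇒Pos w (to sx))

      noPair⇒lagrangian : NoPair w → Lagrangian C θ S
      noPair⇒lagrangian np = (length Is , length Δ₁list , S-card , Δ₁-card , half) , disjoint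
        where
        equal : length Is ≡ length Ls
        equal = ℕP.≤-antisym
          (subst (ℕ._≤ length Ls) (LP.length-map co Is) (unique-⊆⇒length≤ coIs-unique (coIs⊆Ls (λ γ d → proj₁ (np γ d)))))
          (subst (ℕ._≤ length Is) (LP.length-map co Ls) (unique-⊆⇒length≤ coLs-unique (coLs⊆Is (λ γ d → proj₂ (np γ d)))))
        half : 2 ℕ.* length Is ≡ length Δ₁list
        half = trans (cong (length Is ℕ.+_) (trans (ℕP.+-identityʳ (length Is)) equal)) total
        disjoint : ∀ γ₁ γ₂ → S γ₁ → S γ₂ → (γ₁ ⊕ γ₂) ≢ θ
        disjoint γ₁ γ₂ s₁ s₂ eq = proj₁ (np γ₁ (proj₁ (to s₁))) (I⇒Pos w (to s₁)) (subst (λ z → Pos (W w z)) (⊕⇒⊖ eq) (I⇒Pos w (to s₂)))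

      -- γ ↦ θ - γ maps the ideal into its complement. Both have half the size of Δ(1), so the image
      -- is the whole complement.
      lagrangian⇒noPair : Lagrangian C θ S → NoPair w
      lagrangian⇒noPair ((k , m , ck , cm , 2k) , disjoint) γ d = noI γ d , λ np → noL (unique-⊆-full (_∈? coIs) coIs-unique (coIs⊆Ls noI) le (Ls⁺ d np))
        where
        noI : ∀ γ → Δ₁ γ → Pos (W w γ) → ¬ Pos (W w (co γ))
        noI γ d p q = disjoint γ (co γ) (from (Pos⇒I w d p)) (from (Pos⇒I w (co-Δ₁ d) q)) (⊕-⊖ θ γ)
        equal : length Ls ≡ length Is
        equal = ℕP.+-cancelˡ-≡ (length Is) (length Ls) (length Is) (trans total (trans (card-unique Δ₁-card cm) (trans (sym 2k)
          (trans (cong (2 ℕ.*_) (card-unique ck S-card)) (cong (length Is ℕ.+_) (ℕP.+-identityʳ (length Is)))))))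
        le : length Ls ℕ.≤ length coIs
        le = ℕP.≤-reflexive (trans equal (sym (LP.length-map co Is)))
        noL : γ ∈ coIs → Pos (W w (co γ))
        noL mγ = let (x , mx , eq) = ∈P.∈-map⁻ co mγ in subst (λ z → Pos (W w z)) (trans (sym (co-co x)) (cong co (sym eq))) (proj₂ (Is⁻ mx))

  matOf-cong : ∀ {u w} → (∀ v → W u v ≡ W w v) → matOf C u ≡ matOf C w
  matOf-cong h = VP.tabulate-cong λ i → h (e i)

  W-cong-mat : ∀ {u w} → matOf C u ≡ matOf C w → ∀ v → W u v ≡ W w v
  W-cong-mat {u} {w} p v = trans (sym (app-matOf u v)) (trans (cong (λ M → app M v) p) (app-matOf w v))

  fib-self : ∀ w → W⁰ w → Fib C θ (matOf C w) (matOf C w)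
  fib-self w hw = W⁰⇒W0 w hw , λ x → (λ q → q) , (λ q → q)

  fib-partner : ∀ {w} → W⁰ w → NoPair w → Fib C θ (matOf C w) (compose (matOf C w) (sθ C θ))
  fib-partner {w} hw np = subst (Fib C θ (matOf C w)) (sym (matOf-partner w)) (W⁰⇒W0 (partner w) (W⁰-partner {w} hw) , agree⇒sameΓ {w} {partner w} (partner-agree w np))

  fib-cases : ∀ {w M} → W⁰ w → Fib C θ (matOf C w) M → M ≡ matOf C w ⊎ NoPair w × M ≡ compose (matOf C w) (sθ C θ)
  fib-cases {w} hw (((u , refl) , hu) , same) = either (λ q → inj₁ (matOf-cong {u} {w} q)) (λ { (np , q) → inj₂ (np , trans (matOf-cong {u} {partner w} q) (sym (matOf-partner w))) })
    (fibre {u} {w} (W0⇒W⁰ {u} ((u , refl) , hu)) hw (sameΓ⇒agree {w} {u} hw (W0⇒W⁰ {u} ((u , refl) , hu)) same))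

  fib-partner⁻ : ∀ {w} → W⁰ w → Fib C θ (matOf C w) (compose (matOf C w) (sθ C θ)) → NoPair w
  fib-partner⁻ {w} hw fb = agree-partner⇒noPair w (sameΓ⇒agree {w} {partner w} hw (W⁰-partner {w} hw) (proj₂ (subst (Fib C θ (matOf C w)) (matOf-partner w) fb)))

  partner-≢ : ∀ w → matOf C w ≢ compose (matOf C w) (sθ C θ)
  partner-≢ w p = by (coherent rβ)
    where
    β = W w θ
    rβ : Root β
    rβ = root-W w rθ
    β≡ : β ≡ neg β
    β≡ = trans (W-cong-mat {w} {partner w} (trans p (matOf-partner w)) θ) (W-partner-θ w)
    by : Pos β ⊎ Neg β → ⊥
    by (inj₁ q) = Pos-neg⇒¬Pos rβ (subst Pos β≡ q) q
    by (inj₂ q) = Pos∧Neg⇒⊥ rβ (Pos-of-neg β (subst Neg β≡ q)) q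

  module FromAntichain (Γ : List (Vec ℤ n)) (ac : Antichain C θ Γ) where
    U : Vec ℤ n → Set
    U = Up C θ (_∈ Γ)

    U? : ∀ γ → Dec (U γ)
    U? γ = Δ₁? γ ×-dec map′ find′ (λ { (g , m , l) → lose m l }) (Any.any? (λ g → ≼? g γ) Γ)
      where
      find′ : Any (λ g → g ≼' γ) Γ → ∃ λ g → g ∈ Γ × g ≼' γ
      find′ q = find q

    U-up : ∀ {x y} → Δ₁ x → Δ₁ y → U x → x ≼' y → U y
    U-up {x} {y} dx dy (_ , g , m , l) le = dy , g , m , ≼-trans {g} {x} {y} l le

    open Ideal U U? U-up public using () renaming (word to good)

    w : List (Fin n)
    w = proj₁ good

    hw : W⁰ w
    hw = proj₁ (proj₂ good)

    U⇒I : ∀ {γ} → U γ → Iᵂ w γ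
    U⇒I {γ} u = Pos⇒I w (proj₁ u) (proj₁ (proj₂ (proj₂ good) γ (proj₁ u)) u)

    I⇒U : ∀ {γ} → Iᵂ w γ → U γ
    I⇒U {γ} i = by (U? γ)
      where
      by : Dec (U γ) → U γ
      by (yes u) = u
      by (no nu) = ⊥-elim (Pos∧Neg⇒⊥ (root-W w (proj₁ (proj₁ i))) (I⇒Pos w i) (proj₂ (proj₂ (proj₂ good) γ (proj₁ i)) nu))

    Γ⊆U : ∀ {x} → x ∈ Γ → U x
    Γ⊆U {x} m = All.lookup (proj₁ ac) m , x , m , ≼-refl x

    represents : Represents Γ (Γᵂ w)
    represents x = (λ m → U⇒I (Γ⊆U m) , λ μ iμ l → minimal m (I⇒U iμ) l) ,
      λ { (i , min) → back (I⇒U i) min }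
      where
      minimal : ∀ {μ} → x ∈ Γ → U μ → μ ≼' x → μ ≡ x
      minimal {μ} m (_ , g , mg , l) le = ≼-antisym {μ} {x} le (subst (_≼' μ) (proj₂ ac g x mg m (≼-trans {g} {μ} {x} l le)) l)
      back : U x → (∀ μ → Iᵂ w μ → μ ≼' x → μ ≡ x) → x ∈ Γ
      back (_ , g , mg , l) min = subst (_∈ Γ) (min g (U⇒I (Γ⊆U mg)) l) mg

  -- Long roots index both W⁰ and, when not simple, the antichains.

  Long? : ∀ v → Dec (Long v)
  Long? v = map′ ∈long long∈ (v ∈? longs)

  -- Total, with the empty word as value outside the long roots, so that it can be mapped over lists
  -- without carrying proofs.
  longWord : Vec ℤ n → List (Fin n)
  longWord v = by (Long? v)
    where
    by : Dec (Long v) → List (Fin n)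
    by (yes l) = proj₁ (long⇒W⁰ l)
    by (no _) = []

  longWord-spec : ∀ {v} → Long v → W⁰ (longWord v) × W (longWord v) θ ≡ v
  longWord-spec {v} l with Long? v
  ... | yes l' = proj₂ (long⇒W⁰ l')
  ... | no nl = ⊥-elim (nl l)

  W-θ-long : ∀ w → Long (W w θ)
  W-θ-long w = root-W w rθ , W-form w θ θ

  longWord-W : ∀ {w} → W⁰ w → matOf C w ≡ matOf C (longWord (W w θ))
  longWord-W {w} hw = let (hl , eq) = longWord-spec (W-θ-long w) in matOf-cong {w} {longWord (W w θ)} (W⁰-θ-injective {w} {longWord (W w θ)} hw hl (sym eq))

  Πl? : ∀ v → Dec (Πl C θ v)
  Πl? v = FP.any? λ i → (v ≟V e i) ×-dec longSimple? i

  Πl-long : ∀ {v} → Πl C θ v → Long v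
  Πl-long (i , refl , nm) = root-e i , nm

  e-injective : ∀ {i j : Fin n} → i ≢ j → e i ≢ e j
  e-injective {i} {j} ne p with () ← trans (sym (lookup-e-same i)) (trans (cong (λ z → lookup z i) p) (lookup-e-diff (λ q → ne (sym q))))

  simples : List (Vec ℤ n)
  simples = L.map e longSimples

  simples-unique : Unique simples
  simples-unique = allPairs-map (λ _ _ → e-injective) longSimples-unique

  Πl∈ : ∀ {v} → Πl C θ v → v ∈ simples
  Πl∈ (i , eq , nm) = subst (_∈ simples) (sym eq) (∈P.∈-map⁺ e (∈P.∈-filter⁺ longSimple? (∈P.∈-allFin i) nm))

  ∈Πl : ∀ {v} → v ∈ simples → Πl C θ v
  ∈Πl m = let (i , mi , eq) = ∈P.∈-map⁻ e m in i , eq , proj₂ (∈P.∈-filter⁻ longSimple? {xs = allFin n} mi)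

  #Πl : ℕ
  #Πl = length longSimples

  Πl-card : Card (Πl C θ) #Πl
  Πl-card = simples , LP.length-map e longSimples , All.tabulate ∈Πl , simples-unique , λ v → Πl∈

  W0-card : Card (W0 C θ) (h ℕ.* #Πl)
  W0-card = L.map (λ v → matOf C (longWord v)) longs , trans (LP.length-map (λ v → matOf C (longWord v)) longs) longs-length ,
    AllP.map⁺ (All.tabulate (λ {v} m → W⁰⇒W0 (longWord v) (proj₁ (longWord-spec (∈long m))))) ,
    allPairs-map (λ {u} {v} mu mv ne eq → ne (trans (sym (proj₂ (longWord-spec (∈long mu)))) (trans (W-cong-mat {longWord u} {longWord v} eq θ) (proj₂ (longWord-spec (∈long mv)))))) longs-unique ,
    λ { M ((w , refl) , hM) → subst (_∈ L.map (λ v → matOf C (longWord v)) longs) (sym (longWord-W {w} (W0⇒W⁰ {w} ((w , refl) , hM)))) (∈P.∈-map⁺ (λ v → matOf C (longWord v)) (long∈ (W-θ-long w))) }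

  nonsimple? : ∀ v → Dec (¬ Πl C θ v)
  nonsimple? v = ¬? (Πl? v)

  -- Only the elements of Π_l are removed and their negatives stay: over a Lagrangian ideal this
  -- retains one of the two elements w and w s_θ.
  nonsimples : List (Vec ℤ n)
  nonsimples = filter nonsimple? longs

  nonsimples-length : #Πl ℕ.+ length nonsimples ≡ h ℕ.* #Πl
  nonsimples-length = trans (cong (ℕ._+ length nonsimples) (sym eq)) (trans (length-filter-split Πl? longs) longs-length)
    where
    eq : length (filter Πl? longs) ≡ #Πl
    eq = card-unique {P = Πl C θ} (filter Πl? longs , refl , All.tabulate (λ m → proj₂ (∈P.∈-filter⁻ Πl? {xs = longs} m)) , UP.filter⁺ Πl? longs-unique ,
      λ v q → ∈P.∈-filter⁺ Πl? (long∈ (Πl-long q)) q) Πl-card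

  antichainOf : Vec ℤ n → List (Vec ℤ n)
  antichainOf v = Min.mins (longWord v)

  nonsimple⁻ : ∀ {v} → v ∈ nonsimples → Long v × ¬ Πl C θ v
  nonsimple⁻ m = let (a , b) = ∈P.∈-filter⁻ nonsimple? {xs = longs} m in ∈long a , b

  -- Equal antichains leave, besides u = v, only v = - u with u or - u simple, and then one of the
  -- two roots would have been removed.
  antichainOf-distinct : ∀ {u v} → u ∈ nonsimples → v ∈ nonsimples → u ≢ v → ¬ SameSet (antichainOf u) (antichainOf v)
  antichainOf-distinct {u} {v} mu mv ne same = either
      (λ q → ne (trans (sym eu) (trans (sym (q θ)) ev)))
      (λ { (np , q) → either (λ s → proj₂ (nonsimple⁻ mu) (subst (Πl C θ) eu s))
             (λ s → proj₂ (nonsimple⁻ mv) (subst (Πl C θ) (trans (sym (trans (q θ) (W-partner-θ (longWord u)))) ev) s)) (noPair⇒simple (longWord u) np) })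
      (fibre {longWord v} {longWord u} hv hu (sameΓ⇒agree {longWord u} {longWord v} hu hv λ x →
        (λ g → proj₁ (Min.mins-represents (longWord v) x) (proj₁ (same x) (proj₂ (Min.mins-represents (longWord u) x) g))) ,
        (λ g → proj₁ (Min.mins-represents (longWord u) x) (proj₂ (same x) (proj₂ (Min.mins-represents (longWord v) x) g)))))
    where
    hu = proj₁ (longWord-spec (proj₁ (nonsimple⁻ mu)))
    eu = proj₂ (longWord-spec (proj₁ (nonsimple⁻ mu)))
    hv = proj₁ (longWord-spec (proj₁ (nonsimple⁻ mv)))
    ev = proj₂ (longWord-spec (proj₁ (nonsimple⁻ mv)))

  antichainOf-complete : ∀ Γ → Antichain C θ Γ → Any (SameSet Γ) (L.map antichainOf nonsimples)
  antichainOf-complete Γ ac = by (Πl? (W w θ))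
    where
    open FromAntichain Γ ac using (w; hw; represents)
    member : ∀ u → W⁰ u → ¬ Πl C θ (W u θ) → SameΓ w u → Any (SameSet Γ) (L.map antichainOf nonsimples)
    member u hu ns same = lose (∈P.∈-map⁺ antichainOf (∈P.∈-filter⁺ nonsimple? (long∈ (W-θ-long u)) ns)) λ x →
        (λ m → proj₂ (Min.mins-represents û x) (subst (λ M → Γw C θ M x) (longWord-W {u} hu) (proj₁ (same x) (proj₁ (represents x) m)))) ,
        (λ m → proj₂ (represents x) (proj₂ (same x) (subst (λ M → Γw C θ M x) (sym (longWord-W {u} hu)) (proj₁ (Min.mins-represents û x) m))))
      where
      û = longWord (W u θ)
    by : Dec (Πl C θ (W w θ)) → Any (SameSet Γ) (L.map antichainOf nonsimples)
    by (no ns) = member w hw ns (λ x → (λ g → g) , (λ g → g))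
    -- The discarded w(θ) in Π_l is replaced by its negative, passing to w s_θ, which has the same
    -- minimal elements.
    by (yes s) = member (partner w) (W⁰-partner {w} hw) ns (agree⇒sameΓ {w} {partner w} (partner-agree w (simple⇒noPair w (inj₁ s))))
      where
      ns : ¬ Πl C θ (W (partner w) θ)
      ns (j , eq , _) = Pos-neg⇒¬Pos (root-W w rθ) (subst Pos (trans (sym eq) (W-partner-θ w)) (Pos-e j)) (subst Pos (sym (proj₁ (proj₂ s))) (Pos-e (proj₁ s)))

  antichain-card : CardBy SameSet (Antichain C θ) (length nonsimples)
  antichain-card = L.map antichainOf nonsimples , LP.length-map antichainOf nonsimples ,
    AllP.map⁺ (All.tabulate (λ {v} _ → Min.mins-antichain (longWord v))) ,
    allPairs-map antichainOf-distinct (UP.filter⁺ nonsimple? longs-unique) , antichainOf-complete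

theorem4p3 : (n : ℕ) (C : CartanData n) → IsSimpleCartan C
    → (θ : Vec ℤ n) → IsHighestRoot C θ
    → (h : ℕ) → IsCoxeterNumber C h
    →
    ((∀ M → W0 C θ M → Σ (List (Vec ℤ n)) λ Γ → Antichain C θ Γ × Represents Γ (Γw C θ M))
    × (∀ Γ → Antichain C θ Γ → Σ (Mat n) λ M → W0 C θ M × Represents Γ (Γw C θ M))
    × (∀ M → W0 C θ M → ∀ x → (Up C θ (Γw C θ M) x → Iw C θ M x) × (Iw C θ M x → Up C θ (Γw C θ M) x))
    × (∀ M → W0 C θ M
    → (¬ Lagrangian C θ (Up C θ (Γw C θ M)) → Card (Fib C θ M) 1)
    × (Lagrangian C θ (Up C θ (Γw C θ M)) → Card (Fib C θ M) 2)))
    ×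
    (∀ M → W0 C θ M
    → (Lagrangian C θ (Iw C θ M) ⇔ ±Πl C θ (app M θ))
    × (±Πl C θ (app M θ) ⇔ (∀ M' → Fib C θ M M' ⇔ (M' ≡ M ⊎ M' ≡ compose M (sθ C θ)))))
    ×
    (∃ λ a → ∃ λ w → ∃ λ p → CardBy SameSet (Antichain C θ) a × Card (W0 C θ) w × Card (Πl C θ) p
    × (a ≡ w ℕ.∸ p) × (a ≡ (h ℕ.∸ 1) ℕ.* p))
theorem4p3 n C sc θ hθ h hc = (partA , partB , partC , partD) , partE ,
    length nonsimples , h ℕ.* #Πl , #Πl , antichain-card , W0-card , Πl-card , count , trans count (sym (trans (ℕP.*-distribʳ-∸ #Πl h 1) (cong (h ℕ.* #Πl ℕ.∸_) (ℕP.*-identityˡ #Πl))))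
  where
  open Roots C sc
  open CoxeterWords C sc using (app-matOf)
  open Antichains C sc θ hθ (rootEnumeration C sc h hc)
  count : length nonsimples ≡ h ℕ.* #Πl ℕ.∸ #Πl
  count = sym (trans (cong (ℕ._∸ #Πl) (sym nonsimples-length)) (ℕP.m+n∸m≡n #Πl (length nonsimples)))
  partA : ∀ M → W0 C θ M → Σ (List (Vec ℤ n)) λ Γ → Antichain C θ Γ × Represents Γ (Γw C θ M)
  partA M ((w , refl) , _) = Min.mins w , Min.mins-antichain w , Min.mins-represents w
  partB : ∀ Γ → Antichain C θ Γ → Σ (Mat n) λ M → W0 C θ M × Represents Γ (Γw C θ M)
  partB Γ ac = matOf C w , W⁰⇒W0 w hw , represents
    where open FromAntichain Γ ac
  partC : ∀ M → W0 C θ M → ∀ x → (Up C θ (Γw C θ M) x → Iw C θ M x) × (Iw C θ M x → Up C θ (Γw C θ M) x)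
  partC M hM@((w , refl) , _) x = Up⇒I {w} (W0⇒W⁰ {w} hM) , I⇒Up {w}
  partD : ∀ M → W0 C θ M → (¬ Lagrangian C θ (Up C θ (Γw C θ M)) → Card (Fib C θ M) 1) × (Lagrangian C θ (Up C θ (Γw C θ M)) → Card (Fib C θ M) 2)
  partD M hM@((w , refl) , _) = one , two
    where
    hw = W0⇒W⁰ {w} hM
    one : ¬ Lagrangian C θ (Up C θ (Γᵂ w)) → Card (Fib C θ M) 1
    one nl = M ∷ [] , refl , (fib-self w hw All.∷ All.[]) , (All.[] ∷ []) ,
      λ M' fb → here (either (λ q → q) (λ { (np , _) → ⊥-elim (nl (Halves.noPair⇒lagrangian w (Up C θ (Γᵂ w)) (Up⇒I {w} hw) (I⇒Up {w}) np)) }) (fib-cases {w} hw fb))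
    two : Lagrangian C θ (Up C θ (Γᵂ w)) → Card (Fib C θ M) 2
    two lg = M ∷ compose M (sθ C θ) ∷ [] , refl ,
      (fib-self w hw All.∷ fib-partner {w} hw (Halves.lagrangian⇒noPair w (Up C θ (Γᵂ w)) (Up⇒I {w} hw) (I⇒Up {w}) lg) All.∷ All.[]) ,
      ((partner-≢ w All.∷ All.[]) ∷ All.[] ∷ []) ,
      λ M' fb → either {C = λ _ → Any (M' ≡_) (M ∷ compose M (sθ C θ) ∷ [])} here (λ { (_ , q) → there (here q) }) (fib-cases {w} hw fb)
  partE : ∀ M → W0 C θ M → (Lagrangian C θ (Iw C θ M) ⇔ ±Πl C θ (app M θ))
    × (±Πl C θ (app M θ) ⇔ (∀ M' → Fib C θ M M' ⇔ (M' ≡ M ⊎ M' ≡ compose M (sθ C θ))))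
  partE M hM@((w , refl) , _) =
    mk⇔ (λ lg → to± (Halves.lagrangian⇒noPair w (Iᵂ w) (λ i → i) (λ i → i) lg)) (λ sm → Halves.noPair⇒lagrangian w (Iᵂ w) (λ i → i) (λ i → i) (from± sm)) ,
    mk⇔ (λ sm M' → mk⇔ (λ fb → either inj₁ (λ { (_ , q) → inj₂ q }) (fib-cases {w} hw fb))
                       (either (λ q → subst (Fib C θ M) (sym q) (fib-self w hw)) (λ q → subst (Fib C θ M) (sym q) (fib-partner {w} hw (from± sm)))))
        -- The hypothesis is applied to w s_θ: sharing the ideal of `w` turns into `NoPair`, because
        -- w s_θ sends γ to - w(θ - γ).
        (λ hyp → to± (fib-partner⁻ {w} hw (Equivalence.from (hyp (compose M (sθ C θ))) (inj₂ refl))))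
    where
    hw = W0⇒W⁰ {w} hM
    to± : NoPair w → ±Πl C θ (app M θ)
    to± np = subst (±Πl C θ) (sym (app-matOf w θ)) (noPair⇒simple w np)
    from± : ±Πl C θ (app M θ) → NoPair w
    from± sm = simple⇒noPair w (subst (±Πl C θ) (app-matOf w θ) sm)
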